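{- Let $p$ be a prime and let $\Gamma$ be a strictly Deza circulant with parameters $(2p,k,b,a)$. Then $p\equiv 1 \pmod 4$, and $\Gamma$ is isomorphic to the $2$-clique-extension $P(p)[K_2]$ of the Paley graph $P(p)$. In particular, $k=p$, $b=p-1$ and $a=\frac{p-1}{2}$.
   Context: Graphs are finite, undirected and simple. A graph is strongly regular with parameters $(n,k,\lambda,\mu)$ if it has $n$ vertices, is $k$-regular, any two adjacent vertices have exactly $\lambda$ common neighbours, and any two distinct non-adjacent vertices have exactly $\mu$ common neighbours. Let $n,k,b,a$ be integers with $0\le a\le b\le k<n$. A graph is a Deza graph with parameters $(n,k,b,a)$ if it has $n$ vertices, is $k$-regular, and for any two distinct vertices the number of their common neighbours takes precisely the values $a$ or $b$ (there is a pair of distinct vertices with $a$ common neighbours and a pair with $b$ common neighbours). A strictly Deza graph is a Deza graph that has diameter $2$ and is not strongly regular. For a group $G$ and a generating set $S$ of $G$ with $e_G\notin S$ and $S^{ -1}=S$, the Cayley graph $Cay(G,S)$ has vertex set $G$, with $x,y$ adjacent if and only if $xy^{ -1}\in S$. A circulant is a graph isomorphic to a Cayley graph of a cyclic group. For a prime power $q\equiv 1\pmod 4$, the Paley graph $P(q)$ is the Cayley graph of the additive group $\mathbb{F}_q^+$ whose connection set is the set of squares of $\mathbb{F}_q^*$. The $2$-clique-extension $\Gamma_1[K_2]$ of a graph $\Gamma_1$ is the lexicographical product of $\Gamma_1$ with $K_2$: its vertex set is $V(\Gamma_1)\times V(K_2)$, and $(u_1,u_2)$, $(v_1,v_2)$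 are adjacent if and only if either $u_1\sim v_1$ in $\Gamma_1$, or $u_1=v_1$ and $u_2\sim v_2$ in $K_2$. -}

module Defs where

open import Algebra.Bundles using (CommutativeRing; Group)
open import Data.Fin.Base using (Fin)
open import Data.Integer.Base as ℤ using (ℤ; +_; 0ℤ; 1ℤ)
open import Data.Integer.Divisibility.Signed as ℤ∣ using (_∣_)
import Data.Integer.Properties as ℤ
open import Data.Integer.Tactic.RingSolver using (solve-∀)
open import Data.Nat.Base using (ℕ; zero; suc; _≤_; _<_)
open import Data.Product.Base using (_×_; _,_; ∃₂; ∃-syntax; Σ-syntax)
open import Data.Product.Relation.Binary.Lex.Strict using (×-Lex; ×-respects₂)
open import Data.Product.Relation.Binary.Pointwise.NonDependent using (_×ₛ_)
open import Data.Sum.Base using (_⊎_)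
open import Data.Vec.Base using (Vec; count; tabulate)
open import Function.Bundles using (Inverse; _⇔_)
open import Level using (0ℓ)
open import Relation.Binary.Bundles using (Setoid)
open import Relation.Binary.Core using (Rel)
open import Relation.Binary.Definitions using (Irreflexive; Symmetric; _Respects_; _Respects₂_)
import Relation.Binary.Definitions as Binary
open import Relation.Binary.PropositionalEquality as ≡ using (_≡_; _≢_)
open import Relation.Nullary.Decidable using (_×-dec_)
open import Relation.Nullary.Negation using (¬_)
open import Relation.Unary using (Pred)

record Digraph : Set₁ where
  infix 4 _~_
  field
    vertices : Setoid 0ℓ 0ℓ

  open Setoid vertices public using (_≈_; _≉_) renaming (Carrier to Vertex)

  field
    _~_      : Rel Vertex 0ℓ
    ~-resp-≈ : _~_ Respects₂ _≈_

infix 4 _≅_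

record _≅_ (Γ Δ : Digraph) : Set where
  private
    module Γ = Digraph Γ
    module Δ = Digraph Δ

  field
    bijection : Inverse Γ.vertices Δ.vertices

  open Inverse bijection public using (to; from)

  field
    adjacency : ∀ x y → x Γ.~ y ⇔ to x Δ.~ to y

record Graph : Set₁ where
  field
    digraph : Digraph

  open Digraph digraph public

  field
    order       : ℕ
    enumeration : Inverse (≡.setoid (Fin order)) vertices
    _~?_        : Binary.Decidable _~_
    ~-sym       : Symmetric _~_
    ~-irrefl    : Irreflexive _≈_ _~_

  vertexList : Vec Vertex order
  vertexList = tabulate (Inverse.to enumeration)

  degree : Vertex → ℕ
  degree x = count (x ~?_) vertexList

  commonNeighbours : Vertex → Vertex → ℕ
  commonNeighbours x y = count (λ z → (x ~? z) ×-dec (y ~? z)) vertexList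

  IsRegular : ℕ → Set
  IsRegular k = ∀ x → degree x ≡ k

  data Walk : ℕ → Rel Vertex 0ℓ where
    stop : ∀ {x y} → x ≈ y → Walk zero x y
    step : ∀ {l x y z} → x ~ y → Walk l y z → Walk (suc l) x z

  HasDistance : Vertex → Vertex → ℕ → Set
  HasDistance x y d = Walk d x y × (∀ l → Walk l x y → d ≤ l)

  HasDiameter : ℕ → Set
  HasDiameter d =
    (∀ x y → ∃[ l ] (l ≤ d × HasDistance x y l)) ×
    (∃₂ λ x y → HasDistance x y d)

record IsStronglyRegular (Γ : Graph) (n k λ′ μ : ℕ) : Set where
  open Graph Γ
  field
    order-≡     : order ≡ n
    regular     : IsRegular k
    adjacent    : ∀ x y → x ~ y → commonNeighbours x y ≡ λ′
    nonadjacent : ∀ x y → x ≉ y → ¬ (x ~ y) → commonNeighbours x y ≡ μ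

record IsDeza (Γ : Graph) (n k b a : ℕ) : Set where
  open Graph Γ
  field
    a≤b        : a ≤ b
    b≤k        : b ≤ k
    k<n        : k < n
    order-≡    : order ≡ n
    regular    : IsRegular k
    values     : ∀ x y → x ≉ y → commonNeighbours x y ≡ a ⊎ commonNeighbours x y ≡ b
    a-attained : ∃₂ λ x y → x ≉ y × commonNeighbours x y ≡ a
    b-attained : ∃₂ λ x y → x ≉ y × commonNeighbours x y ≡ b

record IsStrictlyDeza (Γ : Graph) (n k b a : ℕ) : Set where
  field
    isDeza            : IsDeza Γ n k b a
    diameter-2        : Graph.HasDiameter Γ 2
    ¬strongly-regular : ¬ (∃₂ λ n′ k′ → ∃₂ λ λ′ μ → IsStronglyRegular Γ n′ k′ λ′ μ)

module _ (G : Group 0ℓ 0ℓ) where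
  open Group G

  data GeneratedBy (S : Pred Carrier 0ℓ) : Pred Carrier 0ℓ where
    gen  : ∀ {x} → S x → GeneratedBy S x
    unit : GeneratedBy S ε
    mult : ∀ {x y} → GeneratedBy S x → GeneratedBy S y → GeneratedBy S (x ∙ y)
    inv  : ∀ {x} → GeneratedBy S x → GeneratedBy S (x ⁻¹)
    resp : ∀ {x y} → x ≈ y → GeneratedBy S x → GeneratedBy S y

  Generates : Pred Carrier 0ℓ → Set
  Generates S = ∀ x → GeneratedBy S x

  IsCyclic : Set
  IsCyclic = ∃[ g ] Generates (g ≈_)

  -- S⁻¹ = S is equivalent to S⁻¹ ⊆ S.

  record IsConnectionSet (S : Pred Carrier 0ℓ) : Set where
    field
      S-resp-≈  : S Respects _≈_
      generates : Generates S
      ε∉S       : ¬ S ε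
      S⁻¹⊆S     : ∀ {x} → S x → S (x ⁻¹)

  cayley : (S : Pred Carrier 0ℓ) → S Respects _≈_ → Digraph
  cayley S S-resp-≈ = record
    { vertices = setoid
    ; _~_      = λ x y → S (x ∙ y ⁻¹)
    ; ~-resp-≈ = (λ y≈z → S-resp-≈ (∙-congˡ (⁻¹-cong y≈z)))
               , (λ y≈z → S-resp-≈ (∙-congʳ y≈z))
    }

IsCirculant : Graph → Set₁
IsCirculant Γ =
  Σ[ G ∈ Group 0ℓ 0ℓ ] IsCyclic G ×
  (Σ[ S ∈ Pred (Group.Carrier G) 0ℓ ] Σ[ conn ∈ IsConnectionSet G S ]
    Graph.digraph Γ ≅ cayley G S (IsConnectionSet.S-resp-≈ conn))

-- For a finite field F the nonzero squares form a connection set of F⁺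
-- exactly when the order of F is not 3 modulo 4 (-1 has to be a square),
-- so in general this is only a digraph. An isomorphism with a Graph makes it
-- symmetric.

module _ (F : CommutativeRing 0ℓ 0ℓ) where
  open CommutativeRing F

  IsSquareOfUnit : Pred Carrier 0ℓ
  IsSquareOfUnit x = ∃[ y ] (¬ (y ≈ 0#) × x ≈ y * y)

  paley : Digraph
  paley = cayley +-group IsSquareOfUnit
    λ { x≈z (y , y≉0 , x≈y²) → y , y≉0 , trans (sym x≈z) x≈y² }

-- The ring of integers modulo n, as ℤ with congruence as its equality;
-- for n prime it is the field with n elements.

module _ (n : ℕ) where

  infix 4 _≈ₙ_

  -- A record rather than a synonym, so that x and y can be inferred.
  record _≈ₙ_ (x y : ℤ) : Set where
    constructor mod
    field
      n∣x-y : + n ∣ x ℤ.- y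

  private
    reflexive : ∀ {x y} → x ≡ y → x ≈ₙ y
    reflexive {x} ≡.refl = mod (≡.subst (+ n ∣_) (≡.sym (ℤ.+-inverseʳ x)) (ℤ∣.divides 0ℤ ≡.refl))

    ≈-sym : ∀ {x y} → x ≈ₙ y → y ≈ₙ x
    ≈-sym {x} {y} (mod p) = mod (≡.subst (+ n ∣_) (lemma x y) (ℤ∣.∣m⇒∣-m p))
      where
      lemma : ∀ x y → ℤ.- (x ℤ.- y) ≡ y ℤ.- x
      lemma = solve-∀

    ≈-trans : ∀ {x y z} → x ≈ₙ y → y ≈ₙ z → x ≈ₙ z
    ≈-trans {x} {y} {z} (mod p) (mod q) =
      mod (≡.subst (+ n ∣_) (lemma x y z) (ℤ∣.∣m∣n⇒∣m+n p q))
      where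
      lemma : ∀ x y z → (x ℤ.- y) ℤ.+ (y ℤ.- z) ≡ x ℤ.- z
      lemma = solve-∀

    +-cong : ∀ {x y u v} → x ≈ₙ y → u ≈ₙ v → x ℤ.+ u ≈ₙ y ℤ.+ v
    +-cong {x} {y} {u} {v} (mod p) (mod q) =
      mod (≡.subst (+ n ∣_) (lemma x y u v) (ℤ∣.∣m∣n⇒∣m+n p q))
      where
      lemma : ∀ x y u v → (x ℤ.- y) ℤ.+ (u ℤ.- v) ≡ (x ℤ.+ u) ℤ.- (y ℤ.+ v)
      lemma = solve-∀

    neg-cong : ∀ {x y} → x ≈ₙ y → ℤ.- x ≈ₙ ℤ.- y
    neg-cong {x} {y} (mod p) = mod (≡.subst (+ n ∣_) (lemma x y) (ℤ∣.∣m⇒∣-m p))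
      where
      lemma : ∀ x y → ℤ.- (x ℤ.- y) ≡ ℤ.- x ℤ.- ℤ.- y
      lemma = solve-∀

    *-cong : ∀ {x y u v} → x ≈ₙ y → u ≈ₙ v → x ℤ.* u ≈ₙ y ℤ.* v
    *-cong {x} {y} {u} {v} (mod p) (mod q) = mod (≡.subst (+ n ∣_) (lemma x y u v)
      (ℤ∣.∣m∣n⇒∣m+n (ℤ∣.∣m⇒∣m*n u p) (ℤ∣.∣n⇒∣m*n y q)))
      where
      lemma : ∀ x y u v → (x ℤ.- y) ℤ.* u ℤ.+ y ℤ.* (u ℤ.- v) ≡ x ℤ.* u ℤ.- y ℤ.* v
      lemma = solve-∀

  ℤ/_ : CommutativeRing 0ℓ 0ℓ
  ℤ/_ = record
    { Carrier = ℤ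
    ; _≈_     = _≈ₙ_
    ; _+_     = ℤ._+_
    ; _*_     = ℤ._*_
    ; -_      = ℤ.-_
    ; 0#      = 0ℤ
    ; 1#      = 1ℤ
    ; isCommutativeRing = record
      { isRing = record
        { +-isAbelianGroup = record
          { isGroup = record
            { isMonoid = record
              { isSemigroup = record
                { isMagma = record
                  { isEquivalence = record
                    { refl  = reflexive ≡.refl
                    ; sym   = ≈-sym
                    ; trans = ≈-trans
                    }
                  ; ∙-cong = +-cong
                  }
                ; assoc = λ x y z → reflexive (ℤ.+-assoc x y z)
                }
              ; identity = (λ x → reflexive (ℤ.+-identityˡ x))
                         , (λ x → reflexive (ℤ.+-identityʳ x))
              }
            ; inverse = (λ x → reflexive (ℤ.+-inverseˡ x))
                      , (λ x → reflexive (ℤ.+-inverseʳ x))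
            ; ⁻¹-cong = neg-cong
            }
          ; comm = λ x y → reflexive (ℤ.+-comm x y)
          }
        ; *-cong     = *-cong
        ; *-assoc    = λ x y z → reflexive (ℤ.*-assoc x y z)
        ; *-identity = (λ x → reflexive (ℤ.*-identityˡ x))
                     , (λ x → reflexive (ℤ.*-identityʳ x))
        ; distrib    = (λ x y z → reflexive (ℤ.*-distribˡ-+ x y z))
                     , (λ x y z → reflexive (ℤ.*-distribʳ-+ x y z))
        }
      ; *-comm = λ x y → reflexive (ℤ.*-comm x y)
      }
    }

K₂ : Digraph
K₂ = record
  { vertices = ≡.setoid (Fin 2)
  ; _~_      = _≢_
  ; ~-resp-≈ = ≡.resp₂ _≢_
  }

infix 8 _⟦_⟧

_⟦_⟧ : Digraph → Digraph → Digraph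
Γ ⟦ Δ ⟧ = record
  { vertices = Γ.vertices ×ₛ Δ.vertices
  ; _~_      = ×-Lex Γ._≈_ Γ._~_ Δ._~_
  ; ~-resp-≈ = ×-respects₂ (Setoid.isEquivalence Γ.vertices) Γ.~-resp-≈ Δ.~-resp-≈
  }
  where
  module Γ = Digraph Γ
  module Δ = Digraph Δ

{-# OPTIONS --safe #-}

-- For p = 2 only the 4-cycle is left, which is strongly regular. For p odd, identify
-- the group with ℤ/2 × ℤ/p and let A and B be the indicators of the two halves of the
-- connection set. In the group ring ℤ[ℤ/p] the numbers of common
-- neighbours are the coefficients of A² + B² and of 2AB, and the Frobenius map of
-- 𝔽₂[ℤ/p] gives (A² + B²)(2y) ≡ A(y) + B(y) modulo 2. If a and b have different
-- parity, then 2AB is constant, so p divides |A| |B| and one of A, B is empty or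
-- full, which leads only to complete, disconnected or complete bipartite graphs.
-- Otherwise a and b are even, so A and B agree off 0. If B = A, then A² is constant
-- off 0 and, again modulo 2, so is A: the graph is complete multipartite. If
-- B = A + 1, then A² + A is constant off 0, and U = 2A + 1 − J, where J is the sum of
-- all group elements, has values ±1 off 0 and satisfies U² = N + cJ. So the odd powers
-- of U are combinations of U and J. Comparing the p-th power with the Frobenius map
-- of 𝔽ₚ[ℤ/p] shows that p divides N, hence 2|A| + 1 = p, and comparing the q-th power
-- modulo any other odd prime q yields U(qx) = ± U(x). Hence A is stable under
-- multiplication by squares, and by its size it is a coset of the group of squares.

module Submission where

open import Algebra.Bundles using (AbelianGroup; CommutativeMonoid; CommutativeRing; Group)
import Algebra.Properties.CommutativeMonoid.Sum as MonoidSum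
import Algebra.Properties.CommutativeSemiring.Binomial as Binomial
import Algebra.Properties.Group as GroupProperties
import Algebra.Properties.Monoid.Mult as MonoidMult
import Algebra.Properties.Semiring.Exp as Exp
import Algebra.Properties.Semiring.Mult as Mult
import Algebra.Properties.Semiring.Sum as SemiringSum
import Algebra.Solver.Ring.NaturalCoefficients.Default as SemiringSolver
open import Data.Bool.Base using (if_then_else_)
open import Data.Empty using (⊥; ⊥-elim)
open import Data.Fin.Base using (Fin; zero; suc; toℕ; fromℕ; fromℕ<; inject₁; punchOut; splitAt; _↑ˡ_; _↑ʳ_)
open import Data.Fin.Patterns using (0F; 1F; 2F; 3F)
import Data.Fin.Properties as Fin
open import Data.Integer.Base as ℤ using (ℤ; +_; 0ℤ; 1ℤ)
open import Data.Integer.Divisibility.Signed as ℤ∣ using (_∣_)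
import Data.Integer.DivMod as ℤ
import Data.Integer.Properties as ℤ
open import Data.Integer.Tactic.RingSolver using (solve-∀)
open import Data.List.Base using ([]; _∷_)
open import Data.List.Relation.Unary.All using (All; []; _∷_)
open import Data.Nat.Base as ℕ using (ℕ; zero; suc; s≤s)
import Data.Nat.Combinatorics as ℕ
import Data.Nat.Divisibility as ℕ∣
import Data.Nat.DivMod as ℕ
import Data.Nat.GCD as GCD
import Data.Nat.Properties as ℕ
import Data.Nat.Tactic.RingSolver as ℕ-Solver
open import Data.Nat.Coprimality using (prime⇒coprime; coprime-Bézout)
open import Data.Nat.ListAction using (product)
open import Data.Nat.Primality
  using (Prime; prime[2]; ¬prime[0]; ¬prime[1]; prime⇒nonZero; prime⇒nonTrivial; prime⇒irreducible; euclidsLemma)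
open import Data.Nat.Primality.Factorisation using (factorise; PrimeFactorisation)
open import Data.Product.Base using (_×_; _,_; proj₁; proj₂; ∃-syntax)
open import Data.Product.Relation.Binary.Pointwise.NonDependent using (_×ₛ_)
open import Data.Sum.Base as Sum using (_⊎_; inj₁; inj₂; [_,_]′)
open import Data.Vec.Base using (count; tabulate)
open import Function.Base using (_∘_; id)
open import Function.Bundles using (Equivalence; Func; Inverse; _⇔_; mk⇔)
import Function.Construct.Composition as Comp
import Function.Construct.Symmetry as Symm
open import Level using (0ℓ)
open import Relation.Binary.Bundles using (Setoid)
open import Relation.Binary.Definitions using (_Respects_)
import Relation.Binary.Reasoning.Setoid as ≈-Reasoning
open import Relation.Binary.PropositionalEquality as ≡ using (_≡_; _≢_)
open import Relation.Nullary.Decidable using (Dec; does; yes; no; map′; decidable-stable; ¬?; _×-dec_)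
open import Relation.Nullary.Negation using (¬_; contradiction)
open import Relation.Unary using (Pred)
open import Defs

-- In the last case `A ⊛ A = d - A` off 0 says that the Cayley graph of ℤ/p with connection set `A`
-- is strongly regular with λ = d - 1 and μ = d. The usual continuation uses eigenvalues, Gauss sums
-- and the Galois group of a cyclotomic field. Here no root of unity appears: the Frobenius map
-- modulo q replaces the Galois automorphism that raises roots of unity to the power q. Comparing
-- q-th powers is the Gauss sum proof of quadratic reciprocity read backwards. There `U` is the
-- Legendre symbol and the sign in U(qx) = ± U(x) is sought; here `U` is unknown and the existence
-- of a sign determines it. The sign itself is never computed, since only squares of multipliers
-- matter. In the end N = p and c = -1, so that `U ⊛ U = p δ - J` is the group ring form of the
-- evaluation of the squared Gauss sum. All computation takes place in ℤ: the ring ℤ/q has the same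
-- carrier and operations and only a coarser equality, so an identity over ℤ is also one modulo q.

Enumeration : ℕ → Setoid 0ℓ 0ℓ → Set
Enumeration n X = Inverse (≡.setoid (Fin n)) X

-- Sums over finite setoids

module _ {c ℓ} (M : CommutativeMonoid c ℓ) where
  open CommutativeMonoid M
  open MonoidSum M

  -- The two enumerations and `π` compose to a permutation of indices. The sizes `m` and `n` are
  -- kept apart, so that sums of `2 * p` and of `p + p` terms, or of `order` and of `n` terms, can
  -- be compared without a cast.
  ∑-reindex : {X Y : Setoid 0ℓ 0ℓ} {m n : ℕ} (eX : Enumeration m X) (eY : Enumeration n Y)
              (π : Inverse X Y) (f : Func Y setoid) →
              sum (Func.to f ∘ Inverse.to eY) ≈
              sum (Func.to f ∘ Inverse.to π ∘ Inverse.to eX)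
  ∑-reindex {m = m} eX eY π f = trans
    (sum-permute _ (Comp.inverse eX (Comp.inverse π (Symm.inverse eY))))
    (sum-cong-≋ {m} λ i → Func.cong f (Inverse.strictlyInverseˡ eY _))

module _ {X : Setoid 0ℓ 0ℓ} {m : ℕ} (enum : Enumeration m X) where
  private
    module E = Inverse enum
    module X = Setoid X

    to₂ : Fin m ⊎ Fin m → X.Carrier × Fin 2
    to₂ (inj₁ i) = E.to i , 0F
    to₂ (inj₂ i) = E.to i , 1F

    from₂ : X.Carrier × Fin 2 → Fin (m ℕ.+ m)
    from₂ (x , 0F) = E.from x ↑ˡ m
    from₂ (x , 1F) = m ↑ʳ E.from x

    to₂-from₂ : ∀ y → Setoid._≈_ (X ×ₛ ≡.setoid (Fin 2)) (to₂ (splitAt m (from₂ y))) y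
    to₂-from₂ (x , 0F) rewrite Fin.splitAt-↑ˡ m (E.from x) m = E.strictlyInverseˡ x , ≡.refl
    to₂-from₂ (x , 1F) rewrite Fin.splitAt-↑ʳ m m (E.from x) = E.strictlyInverseˡ x , ≡.refl

    from₂-to₂ : ∀ i → from₂ (to₂ (splitAt m i)) ≡ i
    from₂-to₂ i with splitAt m i in eq
    ... | inj₁ j = ≡.trans (≡.cong (_↑ˡ m) (E.strictlyInverseʳ j)) (Fin.splitAt⁻¹-↑ˡ eq)
    ... | inj₂ j = ≡.trans (≡.cong (m ↑ʳ_) (E.strictlyInverseʳ j)) (Fin.splitAt⁻¹-↑ʳ eq)

    from₂-cong : ∀ {y y′} → Setoid._≈_ (X ×ₛ ≡.setoid (Fin 2)) y y′ → from₂ y ≡ from₂ y′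
    from₂-cong {x , 0F} (x≈x′ , ≡.refl) = ≡.cong (_↑ˡ m) (E.from-cong x≈x′)
    from₂-cong {x , 1F} (x≈x′ , ≡.refl) = ≡.cong (m ↑ʳ_) (E.from-cong x≈x′)

  enumerate-×2 : Enumeration (m ℕ.+ m) (X ×ₛ ≡.setoid (Fin 2))
  enumerate-×2 = record
    { to = to₂ ∘ splitAt m ; from = from₂
    ; to-cong = λ { ≡.refl → X.refl , ≡.refl }
    ; from-cong = from₂-cong
    ; inverse = (λ { {y} ≡.refl → to₂-from₂ y })
              , (λ {i} y≈ → ≡.trans (from₂-cong y≈) (from₂-to₂ i))
    }

  module _ {c ℓ} (M : CommutativeMonoid c ℓ) where
    open CommutativeMonoid M
    open MonoidSum M using (sum; sum-cong-≋)

    sum-++ : ∀ m {n} (t : Fin (m ℕ.+ n) → Carrier) →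
             sum t ≈ sum (λ i → t (i ↑ˡ n)) ∙ sum (λ i → t (m ↑ʳ i))
    sum-++ zero    t = sym (identityˡ _)
    sum-++ (suc m) t = trans (∙-congˡ (sum-++ m (t ∘ suc))) (sym (assoc _ _ _))

    sum-×2 : (f : X.Carrier × Fin 2 → Carrier) →
             sum (f ∘ Inverse.to enumerate-×2) ≈ sum (λ i → f (E.to i , 0F)) ∙ sum (λ i → f (E.to i , 1F))
    sum-×2 f = trans (sum-++ m (f ∘ Inverse.to enumerate-×2)) (∙-cong
      (sum-cong-≋ {m} λ i → reflexive (≡.cong (f ∘ to₂) (Fin.splitAt-↑ˡ m i m)))
      (sum-cong-≋ {m} λ i → reflexive (≡.cong (f ∘ to₂) (Fin.splitAt-↑ʳ m m i))))

-- Integers modulo n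

module Residues (n : ℕ) .{{_ : ℕ.NonZero n}} where
  open CommutativeRing (ℤ/ n) public
    using (setoid; _≈_; refl; sym; trans; reflexive; +-cong; +-congˡ; +-congʳ; -‿cong; *-cong; *-congˡ; *-congʳ)

  residue : ℤ → Fin n
  residue x = fromℕ< (ℤ.n%ℕd<d x n)

  ≈-residue : ∀ x → + toℕ (residue x) ≈ x
  ≈-residue x = sym (mod (ℤ∣.divides (x ℤ./ℕ n) (begin
    x ℤ.- + toℕ (residue x)     ≡⟨ ≡.cong (λ r → x ℤ.- + r) (Fin.toℕ-fromℕ< (ℤ.n%ℕd<d x n)) ⟩
    x ℤ.- + (x ℤ.%ℕ n)          ≡⟨ ≡.cong (ℤ._- + (x ℤ.%ℕ n)) (ℤ.a≡a%ℕn+[a/ℕn]*n x n) ⟩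
    + (x ℤ.%ℕ n) ℤ.+ x ℤ./ℕ n ℤ.* + n ℤ.- + (x ℤ.%ℕ n) ≡⟨ lemma (+ (x ℤ.%ℕ n)) _ ⟩
    x ℤ./ℕ n ℤ.* + n            ∎)))
    where
    open ≡.≡-Reasoning
    lemma : ∀ r q → r ℤ.+ q ℤ.- r ≡ q
    lemma = solve-∀

  private
    ≤-case : ∀ {i j} → i ℕ.≤ j → j ℕ.< n → + j ≈ + i → j ≡ i
    ≤-case {i} {j} i≤j j<n (mod d) = begin
      j               ≡⟨ ℕ.m∸n+n≡m i≤j ⟨
      j ℕ.∸ i ℕ.+ i   ≡⟨ ≡.cong (ℕ._+ i) (≡.trans (≡.sym (ℕ.m<n⇒m%n≡m (ℕ.≤-<-trans (ℕ.m∸n≤m j i) j<n)))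
                          (ℕ∣.n∣m⇒m%n≡0 (j ℕ.∸ i) n
                          (ℤ∣.∣⇒∣ᵤ (≡.subst (+ n ∣_) (≡.trans (ℤ.m-n≡m⊖n j i) (ℤ.⊖-≥ i≤j)) d)))) ⟩
      i               ∎
      where open ≡.≡-Reasoning

  <-≈⇒≡ : ∀ {i j} → i ℕ.< n → j ℕ.< n → + i ≈ + j → i ≡ j
  <-≈⇒≡ {i} {j} i<n j<n eq with ℕ.≤-total i j
  ... | inj₁ i≤j = ≡.sym (≤-case i≤j j<n (sym eq))
  ... | inj₂ j≤i = ≤-case j≤i i<n eq

  1≉0 : 1 ℕ.< n → ¬ (1ℤ ≈ 0ℤ)
  1≉0 1<n 1≈0 = contradiction (<-≈⇒≡ 1<n (ℕ.<-trans ℕ.z<s 1<n) 1≈0) λ ()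

  residue-cong : ∀ {x y} → x ≈ y → residue x ≡ residue y
  residue-cong {x} {y} x≈y = Fin.toℕ-injective (<-≈⇒≡ (Fin.toℕ<n (residue x)) (Fin.toℕ<n (residue y))
    (trans (≈-residue x) (trans x≈y (sym (≈-residue y)))))

  residues : Enumeration n setoid
  residues = record
    { to        = λ i → + toℕ i
    ; from      = residue
    ; to-cong   = λ { ≡.refl → refl }
    ; from-cong = residue-cong
    ; inverse   = (λ { {x} ≡.refl → ≈-residue x })
                , λ {i} {x} x≈i → Fin.toℕ-injective (<-≈⇒≡ (Fin.toℕ<n (residue x)) (Fin.toℕ<n i)
                    (trans (≈-residue x) x≈i))
    }

  infix 4 _≟_

  -- Opaque because congruence is only ever split into its two cases; the remainders behind the
  -- decision should not appear in terms built from `δ`.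
  opaque
    _≟_ : ∀ x y → Dec (x ≈ y)
    x ≟ y = map′ (λ eq → trans (sym (≈-residue x)) (trans (reflexive (≡.cong (λ i → + toℕ i) eq)) (≈-residue y)))
                 residue-cong (residue x Fin.≟ residue y)

private module Two = Residues 2

0≢1 : ∀ {x} → x ≡ 0ℤ → ¬ (x ≡ 1ℤ)
0≢1 ≡.refl ()

-- The group ring K[ℤ/n], with its elements as functions on ℤ.
module GroupRing (n : ℕ) .{{_ : ℕ.NonZero n}} (K : CommutativeRing 0ℓ 0ℓ) where
  private
    module H = Residues n
  open CommutativeRing K hiding (zero)
  open SemiringSum semiring using (sum; sum-cong-≋; ∑-comm; ∑-distrib-+; *-distribˡ-sum; *-distribʳ-sum)
  open ≈-Reasoning setoid

  infix  8 ∑_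
  infixl 7 _⊛_

  ∑_ : (ℤ → Carrier) → Carrier
  ∑ f = sum {n} (λ i → f (+ toℕ i))

  δ : ℤ → ℤ → Carrier
  δ x y = if does (x H.≟ y) then 1# else 0#

  _⊛_ : (ℤ → Carrier) → (ℤ → Carrier) → ℤ → Carrier
  (f ⊛ g) x = ∑ λ y → f y * g (x ℤ.- y)

  -- `∑` sees only the representatives 0, ..., n - 1. The congruence packed into `Fn` makes a sum
  -- invariant under bijections of the residues; laws that do not move the summation variable are
  -- stated for bare functions.
  Fn : Set
  Fn = Func H.setoid setoid

  open Func

  ∑-cong : ∀ {f g} → (∀ x → f x ≈ g x) → ∑ f ≈ ∑ g
  ∑-cong f≈g = sum-cong-≋ {n} (λ i → f≈g (+ toℕ i))

  ∑-bij : (π : Inverse H.setoid H.setoid) (f : Fn) → ∑ (to f ∘ Inverse.to π) ≈ ∑ (to f)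
  ∑-bij π f = sym (∑-reindex +-commutativeMonoid H.residues H.residues π f)

  ∑-swap : ∀ (f : ℤ → ℤ → Carrier) → ∑ (λ x → ∑ (f x)) ≈ ∑ (λ y → ∑ (λ x → f x y))
  ∑-swap f = ∑-comm {n} {n} (λ i j → f (+ toℕ i) (+ toℕ j))

  ∑-+ : ∀ (f g : ℤ → Carrier) → ∑ (λ x → f x + g x) ≈ ∑ f + ∑ g
  ∑-+ f g = ∑-distrib-+ {n} _ _

  ∑-*ˡ : ∀ c f → c * ∑ f ≈ ∑ (λ x → c * f x)
  ∑-*ˡ c f = *-distribˡ-sum {n} c _

  ∑-*ʳ : ∀ c f → ∑ f * c ≈ ∑ (λ x → f x * c)
  ∑-*ʳ c f = *-distribʳ-sum {n} c _

  translation : ℤ → Inverse H.setoid H.setoid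
  translation c = record
    { to = ℤ._+ c ; from = ℤ._- c
    ; to-cong = λ eq → H.+-congʳ eq ; from-cong = λ eq → H.+-congʳ eq
    ; inverse = (λ {x} {y} eq → H.trans (H.+-congʳ eq) (H.reflexive (lemma₁ x c)))
              , (λ {x} {y} eq → H.trans (H.+-congʳ eq) (H.reflexive (lemma₂ x c)))
    }
    where
    lemma₁ : ∀ x c → x ℤ.- c ℤ.+ c ≡ x
    lemma₁ = solve-∀
    lemma₂ : ∀ x c → x ℤ.+ c ℤ.- c ≡ x
    lemma₂ = solve-∀

  reflection : ℤ → Inverse H.setoid H.setoid
  reflection c = record
    { to = λ x → c ℤ.- x ; from = λ x → c ℤ.- x
    ; to-cong = λ eq → H.+-congˡ {c} (H.-‿cong eq) ; from-cong = λ eq → H.+-congˡ {c} (H.-‿cong eq)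
    ; inverse = (λ {x} {y} eq → H.trans (H.+-congˡ {c} (H.-‿cong eq)) (H.reflexive (lemma c x)))
              , (λ {x} {y} eq → H.trans (H.+-congˡ {c} (H.-‿cong eq)) (H.reflexive (lemma c x)))
    }
    where
    lemma : ∀ c x → c ℤ.- (c ℤ.- x) ≡ x
    lemma = solve-∀

  δ-cong : ∀ {x x′ y y′} → x H.≈ x′ → y H.≈ y′ → δ x y ≡ δ x′ y′
  δ-cong {x} {x′} {y} {y′} p q with x H.≟ y | x′ H.≟ y′
  ... | yes _ | yes _ = ≡.refl
  ... | no  _ | no  _ = ≡.refl
  ... | yes r | no ¬r = contradiction (H.trans (H.sym p) (H.trans r q)) ¬r
  ... | no ¬r | yes r = contradiction (H.trans p (H.trans r (H.sym q))) ¬r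

  δ-≈ : ∀ {x y} → x H.≈ y → δ x y ≡ 1#
  δ-≈ {x} {y} p with x H.≟ y
  ... | yes _ = ≡.refl
  ... | no ¬r = contradiction p ¬r

  δ-≉ : ∀ {x y} → ¬ (x H.≈ y) → δ x y ≡ 0#
  δ-≉ {x} {y} p with x H.≟ y
  ... | yes r = contradiction r p
  ... | no _  = ≡.refl

  δ⟨_⟩ : ℤ → Fn
  δ⟨ x ⟩ = record { to = δ x ; cong = λ eq → reflexive (δ-cong (H.refl {x}) eq) }

  private
    sum-zero : ∀ {m} (t : Fin m → Carrier) → (∀ i → t i ≈ 0#) → sum t ≈ 0#
    sum-zero {zero}  t z = refl
    sum-zero {suc m} t z = trans (+-cong (z zero) (sum-zero (t ∘ suc) (z ∘ suc))) (+-identityˡ 0#)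

    sum-single : ∀ {m} (t : Fin m → Carrier) j → (∀ i → i ≢ j → t i ≈ 0#) → sum t ≈ t j
    sum-single {suc m} t zero z =
      trans (+-congˡ (sum-zero _ (λ i → z (suc i) λ ()))) (+-identityʳ _)
    sum-single {suc m} t (suc j) z =
      trans (+-cong (z zero λ ()) (sum-single (t ∘ suc) j (λ i i≢j → z (suc i) (i≢j ∘ Fin.suc-injective))))
            (+-identityˡ _)

  ∑-single : ∀ (f : Fn) x → (∀ y → ¬ (x H.≈ y) → to f y ≈ 0#) → ∑ (to f) ≈ to f x
  ∑-single f x z = trans
    (sum-single {n} _ (H.residue x) λ i i≢r → z (+ toℕ i) λ x≈i →
      i≢r (≡.sym (Fin.toℕ-injective (H.<-≈⇒≡ (Fin.toℕ<n _) (Fin.toℕ<n i)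
        (H.trans (H.≈-residue x) x≈i)))))
    (cong f (H.≈-residue x))

  δ-sift : ∀ x (f : Fn) → ∑ (λ y → δ x y * to f y) ≈ to f x
  δ-sift x f = trans
    (∑-single (record { to = λ y → δ x y * to f y
                      ; cong = λ eq → *-cong (cong δ⟨ x ⟩ eq) (cong f eq) }) x
      λ y x≉y → trans (*-congʳ (reflexive (δ-≉ x≉y))) (zeroˡ _))
    (trans (*-congʳ (reflexive (δ-≈ (H.refl {x})))) (*-identityˡ _))

  ⊛-congᵢ : ∀ (f g : Fn) {x y} → x H.≈ y → (to f ⊛ to g) x ≈ (to f ⊛ to g) y
  ⊛-congᵢ f g eq = ∑-cong λ z → *-congˡ {x = to f z} (cong g (H.+-congʳ {ℤ.- z} eq))

  _⊛ᶠ_ : Fn → Fn → Fn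
  f ⊛ᶠ g = record { to = to f ⊛ to g ; cong = ⊛-congᵢ f g }

  ⊛-comm : ∀ (f g : Fn) x → (to f ⊛ to g) x ≈ (to g ⊛ to f) x
  ⊛-comm f g x = begin
    ∑ (λ y → to f y * to g (x ℤ.- y))
      ≈⟨ ∑-bij (reflection x) (record { to = λ y → to f y * to g (x ℤ.- y)
               ; cong = λ eq → *-cong (cong f eq) (cong g (H.+-congˡ {x} (H.-‿cong eq))) }) ⟨
    ∑ (λ y → to f (x ℤ.- y) * to g (x ℤ.- (x ℤ.- y)))
      ≈⟨ ∑-cong (λ y → trans (*-comm (to f (x ℤ.- y)) _) (*-congʳ (reflexive (≡.cong (to g) (lemma x y))))) ⟩
    ∑ (λ y → to g y * to f (x ℤ.- y)) ∎
    where
    lemma : ∀ c x → c ℤ.- (c ℤ.- x) ≡ x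
    lemma = solve-∀

  ⊛-cong : ∀ {f f′ g g′ : ℤ → Carrier} → (∀ x → f x ≈ f′ x) → (∀ x → g x ≈ g′ x) →
           ∀ x → (f ⊛ g) x ≈ (f′ ⊛ g′) x
  ⊛-cong p q x = ∑-cong λ y → *-cong (p y) (q (x ℤ.- y))

  ⊛-assoc : ∀ (f g h : Fn) x → ((to f ⊛ to g) ⊛ to h) x ≈ (to f ⊛ (to g ⊛ to h)) x
  ⊛-assoc f g h x = begin
    ∑ (λ y → ∑ (λ z → to f z * to g (y ℤ.- z)) * to h (x ℤ.- y))
      ≈⟨ ∑-cong (λ y → ∑-*ʳ (to h (x ℤ.- y)) (λ z → to f z * to g (y ℤ.- z))) ⟩
    ∑ (λ y → ∑ (λ z → to f z * to g (y ℤ.- z) * to h (x ℤ.- y)))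
      ≈⟨ ∑-swap (λ y z → to f z * to g (y ℤ.- z) * to h (x ℤ.- y)) ⟩
    ∑ (λ z → ∑ (λ y → to f z * to g (y ℤ.- z) * to h (x ℤ.- y)))
      ≈⟨ ∑-cong (λ z → begin
        ∑ (λ y → to f z * to g (y ℤ.- z) * to h (x ℤ.- y))
          -- Replacing `y` by `y + z` turns the inner sum into a convolution at `x - z`.
          ≈⟨ ∑-bij (translation z) (record { to = λ y → to f z * to g (y ℤ.- z) * to h (x ℤ.- y)
                   ; cong = λ eq → *-cong (*-congˡ (cong g (H.+-congʳ {ℤ.- z} eq)))
                                          (cong h (H.+-congˡ {x} (H.-‿cong eq))) }) ⟨
        ∑ (λ y → to f z * to g (y ℤ.+ z ℤ.- z) * to h (x ℤ.- (y ℤ.+ z)))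
          ≈⟨ ∑-cong (λ y → trans (*-assoc (to f z) _ _) (*-congˡ (*-cong
               (reflexive (≡.cong (to g) (lemma₁ y z))) (reflexive (≡.cong (to h) (lemma₂ x y z)))))) ⟩
        ∑ (λ y → to f z * (to g y * to h (x ℤ.- z ℤ.- y)))
          ≈⟨ ∑-*ˡ (to f z) (λ y → to g y * to h (x ℤ.- z ℤ.- y)) ⟨
        to f z * ∑ (λ y → to g y * to h (x ℤ.- z ℤ.- y)) ∎) ⟩
    ∑ (λ z → to f z * ∑ (λ y → to g y * to h (x ℤ.- z ℤ.- y))) ∎
    where
    lemma₁ : ∀ y z → y ℤ.+ z ℤ.- z ≡ y
    lemma₁ = solve-∀
    lemma₂ : ∀ x y z → x ℤ.- (y ℤ.+ z) ≡ x ℤ.- z ℤ.- y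
    lemma₂ = solve-∀

  ⊛-distribˡ : ∀ (f g h : ℤ → Carrier) x → (f ⊛ (λ y → g y + h y)) x ≈ (f ⊛ g) x + (f ⊛ h) x
  ⊛-distribˡ f g h x = trans (∑-cong λ y → distribˡ (f y) (g (x ℤ.- y)) (h (x ℤ.- y)))
    (∑-+ (λ y → f y * g (x ℤ.- y)) (λ y → f y * h (x ℤ.- y)))

  ⊛-distribʳ : ∀ (f g h : ℤ → Carrier) x → ((λ y → g y + h y) ⊛ f) x ≈ (g ⊛ f) x + (h ⊛ f) x
  ⊛-distribʳ f g h x = trans (∑-cong λ y → distribʳ (f (x ℤ.- y)) (g y) (h y))
    (∑-+ (λ y → g y * f (x ℤ.- y)) (λ y → h y * f (x ℤ.- y)))

  ⊛-identityˡ : ∀ (f : Fn) x → (δ 0ℤ ⊛ to f) x ≈ to f x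
  ⊛-identityˡ f x = trans
    (δ-sift 0ℤ (record { to = λ y → to f (x ℤ.- y)
                       ; cong = λ eq → cong f (H.+-congˡ {x} (H.-‿cong eq)) }))
    (reflexive (≡.cong (to f) (ℤ.+-identityʳ x)))

  groupRing : CommutativeRing 0ℓ 0ℓ
  groupRing = record
    { Carrier = Fn
    ; _≈_ = λ f g → ∀ x → to f x ≈ to g x
    ; _+_ = λ f g → record { to = λ x → to f x + to g x ; cong = λ eq → +-cong (cong f eq) (cong g eq) }
    ; _*_ = _⊛ᶠ_
    ; -_  = λ f → record { to = λ x → - to f x ; cong = λ eq → -‿cong (cong f eq) }
    ; 0#  = record { to = λ _ → 0# ; cong = λ _ → refl }
    ; 1#  = δ⟨ 0ℤ ⟩
    ; isCommutativeRing = record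
      { isRing = record
        { +-isAbelianGroup = record
          { isGroup = record
            { isMonoid = record
              { isSemigroup = record
                { isMagma = record
                  { isEquivalence = record
                    { refl  = λ x → refl
                    ; sym   = λ p x → sym (p x)
                    ; trans = λ p q x → trans (p x) (q x)
                    }
                  ; ∙-cong = λ p q x → +-cong (p x) (q x)
                  }
                ; assoc = λ f g h x → +-assoc _ _ _
                }
              ; identity = (λ f x → +-identityˡ _) , (λ f x → +-identityʳ _)
              }
            ; inverse = (λ f x → -‿inverseˡ _) , (λ f x → -‿inverseʳ _)
            ; ⁻¹-cong = λ p x → -‿cong (p x)
            }
          ; comm = λ f g x → +-comm _ _
          }
        ; *-cong     = ⊛-cong
        ; *-assoc    = ⊛-assoc
        ; *-identity = ⊛-identityˡ
                     , (λ f x → trans (⊛-comm f δ⟨ 0ℤ ⟩ x) (⊛-identityˡ f x))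
        ; distrib    = (λ f g h → ⊛-distribˡ (to f) (to g) (to h))
                     , (λ f g h → ⊛-distribʳ (to f) (to g) (to h))
        }
      ; *-comm = ⊛-comm
      }
    }

-- The Frobenius map

prime∤! : ∀ {q k} → Prime q → k ℕ.< q → ¬ (q ℕ∣.∣ k ℕ.!)
prime∤! {q} {zero}  q-prime k<q q∣1 = ¬prime[1] (≡.subst Prime (ℕ∣.∣1⇒≡1 q∣1) q-prime)
prime∤! {q} {suc k} q-prime k<q q∣k! with euclidsLemma (suc k) (k ℕ.!) q-prime q∣k!
... | inj₁ q∣1+k = ℕ∣.>⇒∤ k<q q∣1+k
... | inj₂ q∣k!′ = prime∤! q-prime (ℕ.<-trans (ℕ.n<1+n k) k<q) q∣k!′

prime∣C : ∀ {q k} → Prime q → 0 ℕ.< k → k ℕ.< q → q ℕ∣.∣ q ℕ.C k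
prime∣C {q@(suc q-1)} {k} q-prime 0<k k<q
  with euclidsLemma (q ℕ.C k) (k ℕ.! ℕ.* (q ℕ.∸ k) ℕ.!) q-prime (≡.subst (q ℕ∣.∣_) q!≡ (ℕ∣.m∣m*n (q-1 ℕ.!)))
  where
  instance _ = ℕ.m*n≢0 (k ℕ.!) ((q ℕ.∸ k) ℕ.!) {{ℕ._!≢0 k}} {{ℕ._!≢0 (q ℕ.∸ k)}}
  q!≡ : q ℕ.! ≡ (q ℕ.C k) ℕ.* (k ℕ.! ℕ.* (q ℕ.∸ k) ℕ.!)
  q!≡ = ≡.trans (≡.sym (ℕ.m/n*n≡m (ℕ.k![n∸k]!∣n! (ℕ.<⇒≤ k<q))))
                (≡.cong (ℕ._* (k ℕ.! ℕ.* (q ℕ.∸ k) ℕ.!)) (≡.sym (ℕ.nCk≡n!/k![n-k]! (ℕ.<⇒≤ k<q))))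
... | inj₁ q∣C = q∣C
... | inj₂ q∣k![q-k]! with euclidsLemma (k ℕ.!) ((q ℕ.∸ k) ℕ.!) q-prime q∣k![q-k]!
...   | inj₁ q∣k! = contradiction q∣k! (prime∤! q-prime k<q)
...   | inj₂ q∣[q-k]! = contradiction q∣[q-k]! (prime∤! q-prime (ℕ.∸-monoʳ-< {q} {k} {0} 0<k (ℕ.<⇒≤ k<q)))
prime∣C {zero} q-prime = contradiction q-prime ¬prime[0]

module Frobenius (R : CommutativeRing 0ℓ 0ℓ) where
  open CommutativeRing R hiding (zero)
  open SemiringSum semiring
  open Exp semiring
  open Mult semiring renaming (_×_ to _·_)
  open Binomial commutativeSemiring using (binomialTerm; theorem)
  open ≈-Reasoning setoid

  module _ {q : ℕ} (q-prime : Prime q) (char-q : q · 1# ≈ 0#) where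

    q×-zero : ∀ x → q · x ≈ 0#
    q×-zero x = begin
      q · x            ≈⟨ ×-congʳ q (*-identityˡ x) ⟨
      q · (1# * x)     ≈⟨ ×-assoc-* q 1# x ⟨
      (q · 1#) * x     ≈⟨ *-congʳ char-q ⟩
      0# * x           ≈⟨ zeroˡ x ⟩
      0#               ∎

    ∣⇒×-zero : ∀ {m} x → q ℕ∣.∣ m → m · x ≈ 0#
    ∣⇒×-zero {m} x (ℕ∣.divides c m≡c*q) = begin
      m · x            ≈⟨ ×-congˡ m≡c*q ⟩
      (c ℕ.* q) · x    ≈⟨ ×-congˡ (ℕ.*-comm c q) ⟩
      (q ℕ.* c) · x    ≈⟨ ×-assocˡ x q c ⟨
      q · (c · x)      ≈⟨ q×-zero _ ⟩
      0#               ∎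

    -- In the binomial theorem only the two end terms survive: every other coefficient is a multiple
    -- of `q`.
    ^q-distrib-+ : ∀ x y → (x + y) ^ q ≈ x ^ q + y ^ q
    ^q-distrib-+ x y = go q ≡.refl
      where
      go : ∀ r → r ≡ q → (x + y) ^ r ≈ x ^ r + y ^ r
      go zero    ≡.refl = contradiction q-prime ¬prime[0]
      go (suc r) ≡.refl = begin
        (x + y) ^ suc r                                 ≈⟨ theorem (suc r) x y ⟩
        t zero + sum (t ∘ suc)                          ≈⟨ +-congˡ (sum-init-last (t ∘ suc)) ⟩
        t zero + (sum {r} middle + t (suc (fromℕ r)))   ≈⟨ +-cong first (+-cong middle-zero last) ⟩
        y ^ suc r + (0# + x ^ suc r)                    ≈⟨ +-congˡ (+-identityˡ _) ⟩
        y ^ suc r + x ^ suc r                           ≈⟨ +-comm _ _ ⟩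
        x ^ suc r + y ^ suc r                           ∎
        where
        t : Fin (suc (suc r)) → Carrier
        t = binomialTerm x y (suc r)
        middle : Fin r → Carrier
        middle i = t (suc (inject₁ i))
        middle-zero : sum middle ≈ 0#
        middle-zero = trans (sum-cong-≋ {r} λ i → ∣⇒×-zero _
          (prime∣C q-prime ℕ.z<s (ℕ.s<s (≡.subst (ℕ._< r) (≡.sym (Fin.toℕ-inject₁ i)) (Fin.toℕ<n i)))))
          (sum-replicate-zero r)
        first : t zero ≈ y ^ suc r
        first = trans (×-homo-1 _) (*-identityˡ _)
        last : t (suc (fromℕ r)) ≈ x ^ suc r
        last rewrite Fin.toℕ-fromℕ r | ℕ.nCn≡1 (suc r) | ℕ.n∸n≡0 r =
          trans (×-homo-1 _) (*-identityʳ _)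

    ^q-distrib-sum : ∀ {m} (t : Fin m → Carrier) → sum t ^ q ≈ sum (λ i → t i ^ q)
    ^q-distrib-sum {zero}  t = go q ≡.refl
      where
      go : ∀ r → r ≡ q → 0# ^ r ≈ 0#
      go zero    ≡.refl = contradiction q-prime ¬prime[0]
      go (suc r) _      = zeroˡ _
    ^q-distrib-sum {suc m} t = trans (^q-distrib-+ _ _) (+-congˡ (^q-distrib-sum (t ∘ suc)))

module GroupRingFrobenius (n : ℕ) .{{_ : ℕ.NonZero n}} (K : CommutativeRing 0ℓ 0ℓ)
  {q : ℕ} (q-prime : Prime q)
  (char-q : CommutativeRing._≈_ K
    (Mult._×_ (CommutativeRing.semiring K) q (CommutativeRing.1# K)) (CommutativeRing.0# K)) where
  private
    module H = Residues n
    module R where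
      open CommutativeRing (GroupRing.groupRing n K) public
      open SemiringSum semiring public
      open Exp semiring public
      open Mult semiring public
  open GroupRing n K
  open CommutativeRing K hiding (zero)
  open SemiringSum semiring using (sum)
  open Exp semiring
  open Mult semiring renaming (_×_ to _·_)
  open ≈-Reasoning setoid
  open Func

  private
    to-sum : ∀ {m} (t : Fin m → Fn) x → to (R.sum t) x ≈ sum (λ i → to (t i) x)
    to-sum {zero}  t x = refl
    to-sum {suc m} t x = +-congˡ (to-sum (t ∘ suc) x)

    to-× : ∀ m (f : Fn) x → to (m R.× f) x ≈ m · to f x
    to-× zero    f x = refl
    to-× (suc m) f x = +-congˡ (to-× m f x)

    -- The monomial `c [h]` of the group ring; every element is the sum of its monomials, by
    -- `expand`.
    single : Carrier → ℤ → Fn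
    single c h = record { to = λ x → c * δ h x ; cong = λ eq → *-congˡ (cong δ⟨ h ⟩ eq) }

    single-^ : ∀ c h m x → to (single c h R.^ m) x ≈ c ^ m * δ (+ m ℤ.* h) x
    single-^ c h zero    x = sym (trans (*-identityˡ _) (reflexive (δ-cong (H.reflexive (ℤ.*-zeroˡ h)) (H.refl {x}))))
    single-^ c h (suc m) x = begin
      ∑ (λ y → c * δ h y * to (single c h R.^ m) (x ℤ.- y))
        ≈⟨ ∑-cong {f = λ y → c * δ h y * to (single c h R.^ m) (x ℤ.- y)}
             (λ y → trans (*-congˡ (single-^ c h m (x ℤ.- y)))
                    (trans (*-congʳ (*-comm c (δ h y))) (*-assoc (δ h y) c _))) ⟩
      ∑ (λ y → δ h y * (c * (c ^ m * δ (+ m ℤ.* h) (x ℤ.- y))))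
        ≈⟨ δ-sift h (record { to = λ y → c * (c ^ m * δ (+ m ℤ.* h) (x ℤ.- y))
                            ; cong = λ eq → *-congˡ (*-congˡ (cong δ⟨ + m ℤ.* h ⟩ (H.+-congˡ {x} (H.-‿cong eq)))) }) ⟩
      c * (c ^ m * δ (+ m ℤ.* h) (x ℤ.- h))
        ≈⟨ *-assoc c _ _ ⟨
      c * c ^ m * δ (+ m ℤ.* h) (x ℤ.- h)
        ≡⟨ ≡.cong (c * c ^ m *_) shift ⟩
      c * c ^ m * δ (+ suc m ℤ.* h) x ∎
      where
      lemma₁ : ∀ k h → k ℤ.* h ℤ.+ h ≡ (1ℤ ℤ.+ k) ℤ.* h
      lemma₁ = solve-∀
      lemma₂ : ∀ x h → x ℤ.- h ℤ.+ h ≡ x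
      lemma₂ = solve-∀
      shift : δ (+ m ℤ.* h) (x ℤ.- h) ≡ δ (+ suc m ℤ.* h) x
      shift with (+ m ℤ.* h) H.≟ (x ℤ.- h) | (+ suc m ℤ.* h) H.≟ x
      ... | yes _ | yes _ = ≡.refl
      ... | no  _ | no  _ = ≡.refl
      ... | yes r | no ¬r = contradiction (H.trans (H.reflexive (≡.sym (lemma₁ (+ m) h)))
                              (H.trans (H.+-congʳ {h} r) (H.reflexive (lemma₂ x h)))) ¬r
      ... | no ¬r | yes r = contradiction (H.trans (H.reflexive (lemma₃ (+ m) h)) (H.+-congʳ {ℤ.- h} r)) ¬r
        where
        lemma₃ : ∀ k h → k ℤ.* h ≡ (1ℤ ℤ.+ k) ℤ.* h ℤ.- h
        lemma₃ = solve-∀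

    expand : ∀ (f : Fn) → f R.≈ R.sum {n} (λ i → single (to f (+ toℕ i)) (+ toℕ i))
    expand f x = sym (begin
      to (R.sum {n} (λ i → single (to f (+ toℕ i)) (+ toℕ i))) x
        ≈⟨ to-sum {n} (λ i → single (to f (+ toℕ i)) (+ toℕ i)) x ⟩
      ∑ (λ y → to f y * δ y x)
        ≈⟨ ∑-cong (λ y → trans (*-comm (to f y) (δ y x)) (*-congʳ (reflexive (δ-sym y x)))) ⟩
      ∑ (λ y → δ x y * to f y)
        ≈⟨ δ-sift x f ⟩
      to f x ∎)
      where
      δ-sym : ∀ x y → δ x y ≡ δ y x
      δ-sym x y with x H.≟ y | y H.≟ x
      ... | yes _ | yes _ = ≡.refl
      ... | no  _ | no  _ = ≡.refl
      ... | yes r | no ¬r = contradiction (H.sym r) ¬r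
      ... | no ¬r | yes r = contradiction (H.sym r) ¬r

    ringChar : (q R.× R.1#) R.≈ R.0#
    ringChar x = begin
      to (q R.× R.1#) x   ≈⟨ to-× q R.1# x ⟩
      q · δ 0ℤ x          ≈⟨ Frobenius.q×-zero K q-prime char-q (δ 0ℤ x) ⟩
      0#                  ∎

  -- The `q`-th power is additive in characteristic `q` and sends the monomial `c [h]` to
  -- `c ^ q [q h]`.
  frobenius : ∀ (f : Fn) x → to (f R.^ q) x ≈ ∑ (λ h → to f h ^ q * δ (+ q ℤ.* h) x)
  frobenius f x = begin
    to (f R.^ q) x
      ≈⟨ R.^-congˡ q (expand f) x ⟩
    to (R.sum {n} (λ i → single (to f (+ toℕ i)) (+ toℕ i)) R.^ q) x
      ≈⟨ Frobenius.^q-distrib-sum groupRing q-prime ringChar {n} (λ i → single (to f (+ toℕ i)) (+ toℕ i)) x ⟩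
    to (R.sum {n} (λ i → single (to f (+ toℕ i)) (+ toℕ i) R.^ q)) x
      ≈⟨ to-sum {n} (λ i → single (to f (+ toℕ i)) (+ toℕ i) R.^ q) x ⟩
    sum {n} (λ i → to (single (to f (+ toℕ i)) (+ toℕ i) R.^ q) x)
      ≈⟨ ∑-cong {f = λ y → to (single (to f y) y R.^ q) x} (λ h → single-^ (to f h) h q x) ⟩
    ∑ (λ h → to f h ^ q * δ (+ q ℤ.* h) x) ∎

  private
    term : Fn → ℤ → Fn
    term f x = record
      { to   = λ h → to f h ^ q * δ (+ q ℤ.* h) x
      ; cong = λ eq → *-cong (^-congˡ q (cong f eq)) (reflexive (δ-cong (H.*-congˡ {+ q} eq) (H.refl {x})))
      }

  -- When multiplication by `q` is injective, `h = x` is the only index whose monomial lands on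
  -- `q x`.
  frobenius-invertible : (∀ {x y} → + q ℤ.* x H.≈ + q ℤ.* y → x H.≈ y) →
                         ∀ (f : Fn) x → to (f R.^ q) (+ q ℤ.* x) ≈ to f x ^ q
  frobenius-invertible inj f x = begin
    to (f R.^ q) (+ q ℤ.* x)                        ≈⟨ frobenius f (+ q ℤ.* x) ⟩
    ∑ (λ h → to f h ^ q * δ (+ q ℤ.* h) (+ q ℤ.* x))
      ≈⟨ ∑-single (term f (+ q ℤ.* x)) x (λ h x≉h →
           trans (*-congˡ (reflexive (δ-≉ (x≉h ∘ inj ∘ H.sym)))) (zeroʳ _)) ⟩
    to f x ^ q * δ (+ q ℤ.* x) (+ q ℤ.* x)          ≈⟨ *-congˡ (reflexive (δ-≈ H.refl)) ⟩
    to f x ^ q * 1#                                 ≈⟨ *-identityʳ _ ⟩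
    to f x ^ q                                      ∎

  -- When `q` vanishes modulo `n`, all monomials land on the identity of the group.
  frobenius-zero : + q H.≈ 0ℤ → ∀ (f : Fn) {x} → ¬ (x H.≈ 0ℤ) → to (f R.^ q) x ≈ 0#
  frobenius-zero q≈0 f {x} x≉0 = begin
    to (f R.^ q) x                             ≈⟨ frobenius f x ⟩
    ∑ (λ h → to f h ^ q * δ (+ q ℤ.* h) x)     ≈⟨ ∑-single (term f x) 0ℤ (λ h _ → zeroTerm h) ⟩
    to f 0ℤ ^ q * δ (+ q ℤ.* 0ℤ) x             ≈⟨ zeroTerm 0ℤ ⟩
    0#                                         ∎
    where
    zeroTerm : ∀ h → to f h ^ q * δ (+ q ℤ.* h) x ≈ 0#
    zeroTerm h = trans (*-congˡ (reflexive (δ-≉ λ qh≈x → x≉0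
      (H.trans (H.sym qh≈x) (H.trans (H.*-congʳ {h} q≈0) (H.reflexive (ℤ.*-zeroˡ h))))))) (zeroʳ _)

-- Cyclic groups and circulants

module CyclicGroup (G : Group 0ℓ 0ℓ) (cyclic : IsCyclic G)
  {n : ℕ} .{{_ : ℕ.NonZero n}} (enum : Enumeration n (Group.setoid G)) where
  open Group G
  open GroupProperties G
  open MonoidMult monoid renaming (_×_ to _·_)
  open ≈-Reasoning setoid
  private
    module H = Residues n
    g : Carrier
    g = proj₁ cyclic

    -- Induction on how `x` is generated. Commutativity takes two uses: with `z = g` it shows that
    -- each `x` commutes with `g`, and then with `z = x` that `x` commutes with everything.
    commutes : ∀ {z x} → z ∙ g ≈ g ∙ z → GeneratedBy G (g ≈_) x → z ∙ x ≈ x ∙ z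
    commutes zg≈gz (gen g≈x) = trans (∙-congˡ (sym g≈x)) (trans zg≈gz (∙-congʳ g≈x))
    commutes zg≈gz unit = trans (identityʳ _) (sym (identityˡ _))
    commutes {z} zg≈gz (mult {x} {y} p q) = begin
      z ∙ (x ∙ y)   ≈⟨ assoc z x y ⟨
      z ∙ x ∙ y     ≈⟨ ∙-congʳ (commutes zg≈gz p) ⟩
      x ∙ z ∙ y     ≈⟨ assoc x z y ⟩
      x ∙ (z ∙ y)   ≈⟨ ∙-congˡ (commutes zg≈gz q) ⟩
      x ∙ (y ∙ z)   ≈⟨ assoc x y z ⟨
      x ∙ y ∙ z     ∎
    commutes {z} zg≈gz (inv {x} p) = begin
      z ∙ x ⁻¹                 ≈⟨ ∙-congʳ (\\-leftDividesʳ x z) ⟨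
      x ⁻¹ ∙ (x ∙ z) ∙ x ⁻¹    ≈⟨ ∙-congʳ (∙-congˡ (commutes zg≈gz p)) ⟨
      x ⁻¹ ∙ (z ∙ x) ∙ x ⁻¹    ≈⟨ assoc _ _ _ ⟩
      x ⁻¹ ∙ (z ∙ x ∙ x ⁻¹)    ≈⟨ ∙-congˡ (//-rightDividesʳ x z) ⟩
      x ⁻¹ ∙ z                 ∎
    commutes zg≈gz (resp x≈y p) =
      trans (∙-congˡ (sym x≈y)) (trans (commutes zg≈gz p) (∙-congʳ x≈y))

  comm : ∀ x y → x ∙ y ≈ y ∙ x
  comm x y = commutes (sym (commutes refl (proj₂ cyclic x))) (proj₂ cyclic y)

  private
    M : CommutativeMonoid 0ℓ 0ℓ
    M = record { isCommutativeMonoid = record { isMonoid = isMonoid ; comm = comm } }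

    open MonoidSum M using (sum; ∑-distrib-+; sum-replicate)

    multiplication : Carrier → Inverse setoid setoid
    multiplication x = record
      { to = x ∙_ ; from = x ⁻¹ ∙_
      ; to-cong = ∙-congˡ ; from-cong = ∙-congˡ
      ; inverse = (λ eq → trans (∙-congˡ eq) (\\-leftDividesˡ x _))
                , (λ eq → trans (∙-congˡ eq) (\\-leftDividesʳ x _))
      }

  -- Translation by `x` permutes the group. The sum of all elements is therefore unchanged, although
  -- each of the `n` terms has gained an `x`.
  order· : ∀ x → n · x ≈ ε
  order· x = ∙-cancelʳ (sum e) (n · x) ε (begin
    n · x ∙ sum e             ≈⟨ ∙-congʳ (sum-replicate n) ⟨
    sum {n} (λ _ → x) ∙ sum e ≈⟨ ∑-distrib-+ {n} (λ _ → x) e ⟨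
    sum (λ i → x ∙ e i)       ≈⟨ ∑-reindex M enum enum (multiplication x) (record { to = λ y → y ; cong = λ eq → eq }) ⟨
    sum e                     ≈⟨ identityˡ _ ⟨
    ε ∙ sum e                 ∎)
    where
    e : Fin n → Carrier
    e = Inverse.to enum

  -- The exponent is reduced to a natural number below `n` first. This covers negative exponents and
  -- makes congruent exponents give the same power at once; the homomorphism law then rests on
  -- `order·`.
  power : ℤ → Carrier
  power i = toℕ (H.residue i) · g

  power-cong : ∀ {i j} → i H.≈ j → power i ≈ power j
  power-cong i≈j = ×-congˡ (≡.cong toℕ (H.residue-cong i≈j))

  private
    power-+ : ∀ k → power (+ k) ≈ k · g
    power-+ k = begin
      toℕ (H.residue (+ k)) · g           ≈⟨ ×-congˡ (Fin.toℕ-fromℕ< (ℕ.m%n<n k n)) ⟩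
      (k ℕ.% n) · g                       ≈⟨ identityʳ _ ⟨
      (k ℕ.% n) · g ∙ ε                   ≈⟨ ∙-congˡ (order· ((k ℕ./ n) · g)) ⟨
      (k ℕ.% n) · g ∙ n · ((k ℕ./ n) · g) ≈⟨ ∙-congˡ (×-assocˡ g n _) ⟩
      (k ℕ.% n) · g ∙ (n ℕ.* (k ℕ./ n)) · g ≈⟨ ×-homo-+ g (k ℕ.% n) _ ⟨
      (k ℕ.% n ℕ.+ n ℕ.* (k ℕ./ n)) · g   ≈⟨ ×-congˡ (≡.trans
                                              (≡.cong (k ℕ.% n ℕ.+_) (ℕ.*-comm n _))
                                              (≡.sym (ℕ.m≡m%n+[m/n]*n k n))) ⟩
      k · g                               ∎

  power-homo : ∀ i j → power (i ℤ.+ j) ≈ power i ∙ power j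
  power-homo i j = begin
    power (i ℤ.+ j)       ≈⟨ power-cong (H.sym (H.+-cong (H.≈-residue i) (H.≈-residue j))) ⟩
    power (+ (r ℕ.+ s))   ≈⟨ power-+ (r ℕ.+ s) ⟩
    (r ℕ.+ s) · g         ≈⟨ ×-homo-+ g r s ⟩
    power i ∙ power j     ∎
    where
    r = toℕ (H.residue i)
    s = toℕ (H.residue j)

  power-0 : power 0ℤ ≈ ε
  power-0 = power-+ 0

  power-neg : ∀ i → power (ℤ.- i) ≈ power i ⁻¹
  power-neg i = inverseˡ-unique (power (ℤ.- i)) (power i) (begin
    power (ℤ.- i) ∙ power i   ≈⟨ power-homo (ℤ.- i) i ⟨
    power (ℤ.- i ℤ.+ i)       ≡⟨ ≡.cong power (ℤ.+-inverseˡ i) ⟩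
    power 0ℤ                  ≈⟨ power-0 ⟩
    ε                         ∎)

  private
    power-surjective : ∀ {x} → GeneratedBy G (g ≈_) x → ∃[ i ] power i ≈ x
    power-surjective (gen g≈x) = 1ℤ , trans (power-+ 1) (trans (×-homo-1 g) g≈x)
    power-surjective unit = 0ℤ , power-0
    power-surjective (mult p q) with power-surjective p | power-surjective q
    ... | i , pi≈x | j , pj≈y = i ℤ.+ j , trans (power-homo i j) (∙-cong pi≈x pj≈y)
    power-surjective (inv p) with power-surjective p
    ... | i , pi≈x = ℤ.- i , trans (power-neg i) (⁻¹-cong pi≈x)
    power-surjective (resp x≈y p) with power-surjective p
    ... | i , pi≈x = i , trans pi≈x x≈y

  -- Read off from the derivation that `x` is generated by `g`, hence not visibly compatible with
  -- `_≈_`; compatibility comes from `power-injective`.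
  log : Carrier → ℤ
  log x = proj₁ (power-surjective (proj₂ cyclic x))

  power-log : ∀ x → power (log x) ≈ x
  power-log x = proj₂ (power-surjective (proj₂ cyclic x))

  -- If two distinct residues r and s gave the same power, the residues other
  -- than s would already account for all n elements of the group.
  power-injective : ∀ {i j} → power i ≈ power j → i H.≈ j
  power-injective {i} {j} pi≈pj with i H.≟ j
  ... | yes i≈j = i≈j
  ... | no  i≉j = go n ≡.refl enum r s r≢s pi≈pj′ logs pow-logs
    where
    r = H.residue i
    s = H.residue j
    r≢s : s ≢ r
    r≢s eq = i≉j (H.trans (H.sym (H.≈-residue i))
      (H.trans (H.reflexive (≡.cong (λ k → + toℕ k) (≡.sym eq))) (H.≈-residue j)))
    pi≈pj′ : toℕ r · g ≈ toℕ s · g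
    pi≈pj′ = pi≈pj
    logs : Carrier → Fin n
    logs x = H.residue (log x)
    pow-logs : ∀ x → toℕ (logs x) · g ≈ x
    pow-logs = power-log
    go : ∀ m → m ≡ n → Enumeration m setoid → (r s : Fin m) → s ≢ r → toℕ r · g ≈ toℕ s · g →
         (l : Carrier → Fin m) → (∀ x → toℕ (l x) · g ≈ x) → i H.≈ j
    go (suc m) _ e r s s≢r r≈s l l-pow =
      contradiction (Fin.injective⇒≤ {f = f} f-injective) (ℕ.<⇒≱ (ℕ.n<1+n m))
      where
      avoid : ∀ (t : Fin (suc m)) → ∃[ t′ ] (s ≢ t′ × toℕ t′ · g ≈ toℕ t · g)
      avoid t with s Fin.≟ t
      ... | yes ≡.refl = r , s≢r , r≈s
      ... | no  s≢t    = t , s≢t , refl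
      a : (k : Fin (suc m)) → _
      a k = avoid (l (Inverse.to e k))
      f : Fin (suc m) → Fin m
      f k = punchOut (proj₁ (proj₂ (a k)))
      f-injective : ∀ {k k′} → f k ≡ f k′ → k ≡ k′
      f-injective {k} {k′} eq = ≡.trans (≡.sym (Inverse.strictlyInverseʳ e k)) (≡.trans (Inverse.from-cong e (begin
        Inverse.to e k                     ≈⟨ l-pow _ ⟨
        toℕ (l (Inverse.to e k)) · g       ≈⟨ proj₂ (proj₂ (a k)) ⟨
        toℕ (proj₁ (a k)) · g              ≈⟨ ×-congˡ (≡.cong toℕ
                                               (Fin.punchOut-injective (proj₁ (proj₂ (a k))) (proj₁ (proj₂ (a k′))) eq)) ⟩
        toℕ (proj₁ (a k′)) · g             ≈⟨ proj₂ (proj₂ (a k′)) ⟩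
        toℕ (l (Inverse.to e k′)) · g      ≈⟨ l-pow _ ⟩
        Inverse.to e k′                    ∎)) (Inverse.strictlyInverseʳ e k′))

  logarithm : Inverse setoid H.setoid
  logarithm = record
    { to = log ; from = power
    ; to-cong = λ x≈y → power-injective (trans (power-log _) (trans x≈y (sym (power-log _))))
    ; from-cong = power-cong
    ; inverse = (λ x≈pi → power-injective (trans (power-log _) x≈pi))
              , (λ i≈lx → trans (power-cong i≈lx) (power-log _))
    }

  power-log-quotient : ∀ x y → power (log x ℤ.- log y) ≈ x ∙ y ⁻¹
  power-log-quotient x y = trans (power-homo (log x) (ℤ.- log y))
    (∙-cong (power-log x) (trans (power-neg (log y)) (⁻¹-cong (power-log y))))

-- Indicator functions and graphs on ℤ/n

indicator : {A : Set} → Dec A → ℤ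
indicator a? = if does a? then 1ℤ else 0ℤ

indicator-⇔ : {A B : Set} (a? : Dec A) (b? : Dec B) → (A → B) → (B → A) → indicator a? ≡ indicator b?
indicator-⇔ (yes a) (yes b) f g = ≡.refl
indicator-⇔ (no ¬a) (no ¬b) f g = ≡.refl
indicator-⇔ (yes a) (no ¬b) f g = contradiction (f a) ¬b
indicator-⇔ (no ¬a) (yes b) f g = contradiction (g b) ¬a

indicator-× : {A B : Set} (a? : Dec A) (b? : Dec B) → indicator (a? ×-dec b?) ≡ indicator a? ℤ.* indicator b?
indicator-× (yes a) (yes b) = ≡.refl
indicator-× (yes a) (no ¬b) = ≡.refl
indicator-× (no ¬a) b?      = ≡.refl

indicator-1 : {A : Set} (a? : Dec A) → A → indicator a? ≡ 1ℤ
indicator-1 (yes a) _ = ≡.refl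
indicator-1 (no ¬a) a = contradiction a ¬a

indicator-0 : {A : Set} (a? : Dec A) → ¬ A → indicator a? ≡ 0ℤ
indicator-0 (yes a) ¬a = contradiction a ¬a
indicator-0 (no ¬a) _  = ≡.refl

indicator-1⁻¹ : {A : Set} (a? : Dec A) → indicator a? ≡ 1ℤ → A
indicator-1⁻¹ (yes a) _ = a

Is01 : (ℤ → ℤ) → Set
Is01 f = ∀ x → f x ≡ 0ℤ ⊎ f x ≡ 1ℤ

indicator-01 : {A : Set} (a? : Dec A) → indicator a? ≡ 0ℤ ⊎ indicator a? ≡ 1ℤ
indicator-01 (yes a) = inj₂ ≡.refl
indicator-01 (no ¬a) = inj₁ ≡.refl

open import Algebra.Properties.Semiring.Sum (CommutativeRing.semiring ℤ.+-*-commutativeRing)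
  using (sum; sum-cong-≗)

count-tabulate : {A : Set} {P : Pred A 0ℓ} (P? : ∀ x → Dec (P x)) {m : ℕ} (f : Fin m → A) →
                 + count P? (tabulate f) ≡ sum (λ i → indicator (P? (f i)))
count-tabulate P? {zero}  f = ≡.refl
count-tabulate P? {suc m} f with P? (f zero)
... | yes _ = ≡.cong (λ c → 1ℤ ℤ.+ c) (count-tabulate P? (f ∘ suc))
... | no  _ = ≡.trans (count-tabulate P? (f ∘ suc)) (≡.sym (ℤ.+-identityˡ _))

record IsSymmetricSet (n : ℕ) (s : ℤ → ℤ) : Set where
  field
    s-cong : ∀ {x y} → _≈ₙ_ n x y → s x ≡ s y
    s-01   : Is01 s
    s-neg  : ∀ x → s (ℤ.- x) ≡ s x

-- The hypotheses on the graph with vertex set ℤ/n in which x ~ y iff s (x − y) ≡ 1,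
-- read off the numbers (s ⊛ s) (x − y) of common neighbours.
record IsDezaSet (n : ℕ) .{{_ : ℕ.NonZero n}} (k b a : ℕ) (s : ℤ → ℤ) : Set where
  open GroupRing n ℤ.+-*-commutativeRing
  field
    isSymmetricSet : IsSymmetricSet n s
    s-0            : s 0ℤ ≡ 0ℤ
    cardinality    : ∑ s ≡ + k
    values         : ∀ {x} → ¬ (_≈ₙ_ n x 0ℤ) → (s ⊛ s) x ≡ + a ⊎ (s ⊛ s) x ≡ + b
    reachable      : ∀ {x} → ¬ (_≈ₙ_ n x 0ℤ) → s x ≡ 1ℤ ⊎ (∃[ y ] (s y ≡ 1ℤ × s (x ℤ.- y) ≡ 1ℤ))
    incomplete     : ¬ (∀ {x} → ¬ (_≈ₙ_ n x 0ℤ) → s x ≡ 1ℤ)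
    ¬srg           : ∀ λ′ μ → ¬ (∀ {x} → ¬ (_≈ₙ_ n x 0ℤ) →
                       (s x ≡ 1ℤ → (s ⊛ s) x ≡ λ′) × (s x ≡ 0ℤ → (s ⊛ s) x ≡ μ))
  open IsSymmetricSet isSymmetricSet public

module _ (Γ : Graph) (n : ℕ) .{{_ : ℕ.NonZero n}} where
  private
    module Γ = Graph Γ
    module H = Residues n
  open GroupRing n ℤ.+-*-commutativeRing

  -- A circulant with its group replaced by ℤ/n. The connection set `T` is a bare predicate: its
  -- decidability and symmetry are inherited from adjacency to the vertex with coordinate 0.
  record DifferenceGraph : Set₁ where
    field
      coordinate : Inverse Γ.vertices H.setoid
      T          : Pred ℤ 0ℓ
      T-resp     : T Respects H._≈_
      adjacency  : ∀ x y → x Γ.~ y ⇔ T (Inverse.to coordinate x ℤ.- Inverse.to coordinate y)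

    open Inverse coordinate public using (to; from; to-cong; from-cong; strictlyInverseˡ; strictlyInverseʳ)

    vertex-adjacency : ∀ i j → from i Γ.~ from j ⇔ T (i ℤ.- j)
    vertex-adjacency i j = mk⇔
      (T-resp eq ∘ Equivalence.to (adjacency (from i) (from j)))
      (Equivalence.from (adjacency (from i) (from j)) ∘ T-resp (H.sym eq))
      where
      eq : to (from i) ℤ.- to (from j) H.≈ i ℤ.- j
      eq = H.+-cong (strictlyInverseˡ i) (H.-‿cong (strictlyInverseˡ j))

    T? : ∀ i → Dec (T i)
    T? i = map′
      (T-resp (H.reflexive (ℤ.+-identityʳ i)) ∘ Equivalence.to (vertex-adjacency i 0ℤ))
      (Equivalence.from (vertex-adjacency i 0ℤ) ∘ T-resp (H.reflexive (≡.sym (ℤ.+-identityʳ i))))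
      (from i Γ.~? from 0ℤ)

    s : ℤ → ℤ
    s i = indicator (T? i)

    T-neg : ∀ {i} → T i → T (ℤ.- i)
    T-neg {i} Ti = T-resp (H.reflexive (ℤ.+-identityˡ (ℤ.- i)))
      (Equivalence.to (vertex-adjacency 0ℤ i) (Γ.~-sym
        (Equivalence.from (vertex-adjacency i 0ℤ) (T-resp (H.reflexive (≡.sym (ℤ.+-identityʳ i))) Ti))))

    symmetric : IsSymmetricSet n s
    symmetric = record
      { s-cong = λ {x} {y} x≈y → indicator-⇔ (T? x) (T? y) (T-resp x≈y) (T-resp (H.sym x≈y))
      ; s-01   = λ x → indicator-01 (T? x)
      ; s-neg  = λ x → indicator-⇔ (T? (ℤ.- x)) (T? x)
                   (T-resp (H.reflexive (ℤ.neg-involutive x)) ∘ T-neg) T-neg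
      }
    open IsSymmetricSet symmetric

    sᶠ : Fn
    sᶠ = record { to = s ; cong = s-cong }

    indicator-~ : ∀ x z → indicator (x Γ.~? z) ≡ s (to x ℤ.- to z)
    indicator-~ x z = indicator-⇔ (x Γ.~? z) (T? _)
      (Equivalence.to (adjacency x z)) (Equivalence.from (adjacency x z))

    vertexSum : ∀ (f : Fn) → sum (λ i → Func.to f (to (Inverse.to Γ.enumeration i))) ≡ ∑ (Func.to f)
    vertexSum f = ≡.sym (∑-reindex (CommutativeRing.+-commutativeMonoid ℤ.+-*-commutativeRing)
      Γ.enumeration H.residues coordinate f)

    degree-∑ : ∀ x → + Γ.degree x ≡ ∑ s
    degree-∑ x = begin
      + Γ.degree x
        ≡⟨ count-tabulate (x Γ.~?_) (Inverse.to Γ.enumeration) ⟩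
      sum (λ i → indicator (x Γ.~? Inverse.to Γ.enumeration i))
        ≡⟨ sum-cong-≗ (λ i → indicator-~ x (Inverse.to Γ.enumeration i)) ⟩
      sum (λ i → s (to x ℤ.- to (Inverse.to Γ.enumeration i)))
        ≡⟨ vertexSum (record { to = λ y → s (to x ℤ.- y) ; cong = λ eq → s-cong (H.+-congˡ {to x} (H.-‿cong eq)) }) ⟩
      ∑ (λ y → s (to x ℤ.- y))
        ≡⟨ ∑-bij (reflection (to x)) sᶠ ⟩
      ∑ s ∎
      where open ≡.≡-Reasoning

    -- Counting common neighbours gives a correlation of `s` with itself; the substitution
    -- `z ↦ to x - z` and the evenness of `s` turn it into a convolution.
    commonNeighbours-⊛ : ∀ x y → + Γ.commonNeighbours x y ≡ (s ⊛ s) (to x ℤ.- to y)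
    commonNeighbours-⊛ x y = begin
      + Γ.commonNeighbours x y
        ≡⟨ count-tabulate (λ z → (x Γ.~? z) ×-dec (y Γ.~? z)) (Inverse.to Γ.enumeration) ⟩
      sum (λ i → indicator ((x Γ.~? e i) ×-dec (y Γ.~? e i)))
        ≡⟨ sum-cong-≗ (λ i → ≡.trans (indicator-× (x Γ.~? e i) (y Γ.~? e i))
             (≡.cong₂ ℤ._*_ (indicator-~ x (e i)) (indicator-~ y (e i)))) ⟩
      sum (λ i → s (to x ℤ.- to (e i)) ℤ.* s (to y ℤ.- to (e i)))
        ≡⟨ vertexSum f ⟩
      ∑ (λ z → s (to x ℤ.- z) ℤ.* s (to y ℤ.- z))
        ≡⟨ ∑-bij (reflection (to x)) f ⟨
      ∑ (λ z → s (to x ℤ.- (to x ℤ.- z)) ℤ.* s (to y ℤ.- (to x ℤ.- z)))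
        ≡⟨ ∑-cong (λ z → ≡.cong₂ ℤ._*_ (≡.cong s (lemma₁ (to x) z))
             (≡.trans (≡.cong s (lemma₂ (to x) (to y) z)) (s-neg _))) ⟩
      ∑ (λ z → s z ℤ.* s (to x ℤ.- to y ℤ.- z)) ∎
      where
      open ≡.≡-Reasoning
      e = Inverse.to Γ.enumeration
      f : Fn
      f = record
        { to = λ z → s (to x ℤ.- z) ℤ.* s (to y ℤ.- z)
        ; cong = λ eq → ≡.cong₂ ℤ._*_ (s-cong (H.+-congˡ {to x} (H.-‿cong eq)))
                                      (s-cong (H.+-congˡ {to y} (H.-‿cong eq))) }
      lemma₁ : ∀ x z → x ℤ.- (x ℤ.- z) ≡ z
      lemma₁ = solve-∀
      lemma₂ : ∀ x y z → y ℤ.- (x ℤ.- z) ≡ ℤ.- (x ℤ.- y ℤ.- z)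
      lemma₂ = solve-∀

    isDezaSet : ∀ {k b a} → IsStrictlyDeza Γ n k b a → IsDezaSet n k b a s
    isDezaSet {k} {b} {a} strictlyDeza = record
      { isSymmetricSet = symmetric
      ; s-0         = indicator-0 (T? 0ℤ) λ T0 → Γ.~-irrefl (Setoid.refl Γ.vertices)
                        (Equivalence.from (vertex-adjacency 0ℤ 0ℤ) T0)
      ; cardinality = ≡.trans (≡.sym (degree-∑ (from 0ℤ))) (≡.cong +_ (regular (from 0ℤ)))
      ; values      = λ {x} x≉0 → Sum.map (cn x) (cn x) (isDezaValues x x≉0)
      ; reachable   = λ {x} x≉0 → reach x x≉0 (proj₁ diameter-2 (from x) (from 0ℤ))
      ; incomplete  = λ complete → far complete (proj₂ diameter-2)
      -- Strong regularity asks for natural parameters: taking absolute values in `+ count ≡ λ′`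
      -- provides them without knowing that `λ′` is nonnegative.
      ; ¬srg        = λ λ′ μ srg → ¬strongly-regular (Γ.order , k , ℤ.∣ λ′ ∣ , ℤ.∣ μ ∣ , record
          { order-≡     = ≡.refl
          ; regular     = regular
          ; adjacent    = λ x y x~y → ≡.cong ℤ.∣_∣ (≡.trans (commonNeighbours-⊛ x y)
              (proj₁ (srg (to-≉ λ x≈y → Γ.~-irrefl x≈y x~y))
                (indicator-1 (T? _) (Equivalence.to (adjacency x y) x~y))))
          ; nonadjacent = λ x y x≉y x≁y → ≡.cong ℤ.∣_∣ (≡.trans (commonNeighbours-⊛ x y)
              (proj₂ (srg (to-≉ x≉y))
                (indicator-0 (T? _) (x≁y ∘ Equivalence.from (adjacency x y)))))
          })
      }
      where
      open IsStrictlyDeza strictlyDeza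
      open IsDeza isDeza using (regular)
      module V = Setoid Γ.vertices
      from-to-0 : ∀ x → to (from x) ℤ.- to (from 0ℤ) H.≈ x
      from-to-0 x = H.trans (H.+-cong (strictlyInverseˡ x) (H.-‿cong (strictlyInverseˡ 0ℤ)))
                            (H.reflexive (ℤ.+-identityʳ x))
      from-≈ : ∀ {x} → from x V.≈ from 0ℤ → x H.≈ 0ℤ
      from-≈ {x} eq = H.trans (H.sym (strictlyInverseˡ x)) (H.trans (to-cong eq) (strictlyInverseˡ 0ℤ))
      to-≉ : ∀ {x y} → ¬ (x V.≈ y) → ¬ (to x ℤ.- to y H.≈ 0ℤ)
      to-≉ {x} {y} x≉y eq = x≉y (V.trans (V.sym (strictlyInverseʳ x)) (V.trans (from-cong
        (H.trans (H.reflexive (lemma (to x) (to y))) (H.trans (H.+-congʳ {to y} eq) (H.reflexive (ℤ.+-identityˡ _)))))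
        (strictlyInverseʳ y)))
        where
        lemma : ∀ x y → x ≡ x ℤ.- y ℤ.+ y
        lemma = solve-∀
      cn : ∀ x {c} → Γ.commonNeighbours (from x) (from 0ℤ) ≡ c → (s ⊛ s) x ≡ + c
      cn x eq = ≡.trans (≡.sym (≡.trans (commonNeighbours-⊛ (from x) (from 0ℤ)) (⊛-congᵢ sᶠ sᶠ (from-to-0 x))))
                        (≡.cong +_ eq)
      isDezaValues : ∀ x → ¬ (x H.≈ 0ℤ) → _
      isDezaValues x x≉0 = IsDeza.values isDeza (from x) (from 0ℤ) (x≉0 ∘ from-≈)
      reach : ∀ x → ¬ (x H.≈ 0ℤ) → ∃[ l ] (l ℕ.≤ 2 × Γ.HasDistance (from x) (from 0ℤ) l) →
              s x ≡ 1ℤ ⊎ (∃[ y ] (s y ≡ 1ℤ × s (x ℤ.- y) ≡ 1ℤ))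
      reach x x≉0 (.0 , _ , Graph.stop x≈y , _) = contradiction (from-≈ x≈y) x≉0
      reach x x≉0 (.1 , _ , Graph.step x~z (Graph.stop z≈0) , _) = inj₁ (≡.trans
        (s-cong (H.sym (H.trans (H.+-congˡ {to (from x)} (H.-‿cong (to-cong z≈0))) (from-to-0 x))))
        (indicator-1 (T? _) (Equivalence.to (adjacency _ _) x~z)))
      reach x x≉0 (.2 , _ , Graph.step {y = z} x~z (Graph.step z~w (Graph.stop w≈0)) , _) = inj₂
        ( to z
        , ≡.trans (s-cong (H.sym (H.trans (H.+-congˡ {to z} (H.-‿cong (H.trans (to-cong w≈0) (strictlyInverseˡ 0ℤ))))
                                          (H.reflexive (ℤ.+-identityʳ _)))))
                  (indicator-1 (T? _) (Equivalence.to (adjacency _ _) z~w))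
        , ≡.trans (s-cong (H.sym (H.+-congʳ {ℤ.- to z} (strictlyInverseˡ x))))
                  (indicator-1 (T? _) (Equivalence.to (adjacency _ _) x~z)) )
      reach x x≉0 (suc (suc (suc _)) , s≤s (s≤s ()) , _)
      far : (∀ {x} → ¬ (x H.≈ 0ℤ) → s x ≡ 1ℤ) → ¬ (∃[ x ] ∃[ y ] Γ.HasDistance x y 2)
      far complete (x , y , _ , minimal) =
        contradiction (minimal 1 (Graph.step (Equivalence.from (adjacency x y)
          (indicator-1⁻¹ (T? _) (complete (to-≉ λ x≈y →
            contradiction (minimal 0 (Graph.stop x≈y)) λ ())))) (Graph.stop V.refl)))
          λ { (s≤s ()) }

circulant⇒differenceGraph : ∀ Γ n .{{_ : ℕ.NonZero n}} → Graph.order Γ ≡ n → IsCirculant Γ → DifferenceGraph Γ n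
circulant⇒differenceGraph Γ n order≡n (G , cyclic , S , connectionSet , iso) = record
  { coordinate = Comp.inverse bijection logarithm
  ; T          = λ i → S (power i)
  ; T-resp     = λ i≈j → S-resp-≈ (power-cong i≈j)
  ; adjacency  = λ x y → mk⇔
      (S-resp-≈ (G.sym (power-log-quotient (to x) (to y))) ∘ Equivalence.to (adjacency x y))
      (Equivalence.from (adjacency x y) ∘ S-resp-≈ (power-log-quotient (to x) (to y)))
  }
  where
  module G = Group G
  open IsConnectionSet connectionSet
  open _≅_ iso
  open CyclicGroup G cyclic {n} (Comp.inverse
    (≡.subst (λ m → Enumeration m (Graph.vertices Γ)) order≡n (Graph.enumeration Γ)) bijection)

-- Order 4

module _ {k b a : ℕ} {s : ℤ → ℤ} (dezaSet : IsDezaSet 4 k b a s) where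
  open IsDezaSet dezaSet
  private module H = Residues 4
  open GroupRing 4 ℤ.+-*-commutativeRing

  private
    s3≡s1 : s (+ 3) ≡ s (+ 1)
    s3≡s1 = ≡.trans (s-cong (mod (ℤ∣.divides 1ℤ ≡.refl))) (s-neg (+ 1))

    byResidue : (P : ℤ → Set) → (∀ {x y} → x H.≈ y → P y → P x) →
                P (+ 1) → P (+ 2) → P (+ 3) → ∀ {x} → ¬ (x H.≈ 0ℤ) → P x
    byResidue P P-resp P1 P2 P3 {x} x≉0 with H.residue x | H.≈-residue x
    ... | 0F | 0≈x = contradiction (H.sym 0≈x) x≉0
    ... | 1F | i≈x = P-resp (H.sym i≈x) P1
    ... | 2F | i≈x = P-resp (H.sym i≈x) P2
    ... | 3F | i≈x = P-resp (H.sym i≈x) P3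

    s-resp : ∀ {c x y} → x H.≈ y → s y ≡ c → s x ≡ c
    s-resp x≈y = ≡.trans (s-cong x≈y)

    -- Otherwise the connection set has at most the element 2, and then 1 is neither in it nor a sum
    -- of two of its elements.
    s1≡1 : s (+ 1) ≡ 1ℤ
    s1≡1 with s-01 (+ 1)
    ... | inj₂ s1≡1 = s1≡1
    ... | inj₁ s1≡0 with reachable (H.1≉0 (ℕ.s≤s (ℕ.s≤s ℕ.z≤n)))
    ...   | inj₁ s1≡1 = s1≡1
    ...   | inj₂ (y , sy≡1 , s1-y≡1) with H.residue y | H.≈-residue y
    ...     | 0F | i≈y = contradiction sy≡1 (0≢1 (s-resp (H.sym i≈y) s-0))
    ...     | 1F | i≈y = contradiction sy≡1 (0≢1 (s-resp (H.sym i≈y) s1≡0))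
    ...     | 2F | i≈y = contradiction s1-y≡1 (0≢1 (s-resp (H.+-congˡ {+ 1} (H.-‿cong (H.sym i≈y))) (≡.trans (s-neg (+ 1)) s1≡0)))
    ...     | 3F | i≈y = contradiction sy≡1 (0≢1 (s-resp (H.sym i≈y) (≡.trans s3≡s1 s1≡0)))

    s2≡0 : s (+ 2) ≡ 0ℤ
    s2≡0 with s-01 (+ 2)
    ... | inj₁ s2≡0 = s2≡0
    ... | inj₂ s2≡1 = ⊥-elim (incomplete (byResidue (λ x → s x ≡ 1ℤ) s-resp s1≡1 s2≡1 (≡.trans s3≡s1 s1≡1)))

  -- The only candidate left is the 4-cycle, which is strongly regular.
  ¬dezaSet-4 : ⊥
  ¬dezaSet-4 = ¬srg 0ℤ (+ 2) (byResidue
    (λ x → (s x ≡ 1ℤ → (s ⊛ s) x ≡ 0ℤ) × (s x ≡ 0ℤ → (s ⊛ s) x ≡ + 2))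
    (λ { x≈y (f , g) → (λ e → ≡.trans (⊛-congᵢ sᶠ sᶠ x≈y) (f (≡.trans (≡.sym (s-cong x≈y)) e)))
                     , (λ e → ≡.trans (⊛-congᵢ sᶠ sᶠ x≈y) (g (≡.trans (≡.sym (s-cong x≈y)) e))) })
    ((λ _ → c1) , λ e → contradiction s1≡1 (0≢1 e))
    ((λ e → contradiction e (0≢1 s2≡0)) , λ _ → c2)
    ((λ _ → c3) , λ e → contradiction (≡.trans s3≡s1 s1≡1) (0≢1 e)))
    where
    sᶠ : Fn
    sᶠ = record { to = s ; cong = s-cong }
    c1 : (s ⊛ s) (+ 1) ≡ 0ℤ
    c1 rewrite s-0 | s1≡1 | s2≡0 | s3≡s1 | s1≡1 | s-neg (+ 2) | s2≡0 = ≡.refl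
    c2 : (s ⊛ s) (+ 2) ≡ + 2
    c2 rewrite s-0 | s1≡1 | s2≡0 | s3≡s1 | s1≡1 | s-neg (+ 1) | s1≡1 = ≡.refl
    c3 : (s ⊛ s) (+ 3) ≡ 0ℤ
    c3 rewrite s-0 | s1≡1 | s2≡0 | s3≡s1 | s1≡1 = ≡.refl

-- The decomposition of ℤ/2p as ℤ/p × ℤ/2

record IsDezaPair (p : ℕ) .{{_ : ℕ.NonZero p}} (k b a : ℕ) (A B : ℤ → ℤ) : Set where
  open GroupRing p ℤ.+-*-commutativeRing
  field
    A-set       : IsSymmetricSet p A
    B-set       : IsSymmetricSet p B
    A-0         : A 0ℤ ≡ 0ℤ
    cardinality : ∑ A ℤ.+ ∑ B ≡ + k

  c₀ : ℤ → ℤ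
  c₀ x = (A ⊛ A) x ℤ.+ (B ⊛ B) x

  c₁ : ℤ → ℤ
  c₁ x = (A ⊛ B) x ℤ.+ (A ⊛ B) x

  field
    values₀     : ∀ {x} → ¬ (_≈ₙ_ p x 0ℤ) → c₀ x ≡ + a ⊎ c₀ x ≡ + b
    values₁     : ∀ x → c₁ x ≡ + a ⊎ c₁ x ≡ + b
    reachable   : ∀ x → B x ≡ 1ℤ ⊎ (∃[ y ] (A y ≡ 1ℤ × B (x ℤ.- y) ≡ 1ℤ))
    incomplete  : ¬ ((∀ {x} → ¬ (_≈ₙ_ p x 0ℤ) → A x ≡ 1ℤ) × (∀ x → B x ≡ 1ℤ))
    ¬srg        : ∀ λ′ μ → ¬ (
      (∀ {x} → ¬ (_≈ₙ_ p x 0ℤ) → (A x ≡ 1ℤ → c₀ x ≡ λ′) × (A x ≡ 0ℤ → c₀ x ≡ μ)) ×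
      (∀ x → (B x ≡ 1ℤ → c₁ x ≡ λ′) × (B x ≡ 0ℤ → c₁ x ≡ μ)))

module ChineseRemainder (p : ℕ) .{{_ : ℕ.NonZero p}} (t : ℤ) (odd : + p ≡ 1ℤ ℤ.+ + 2 ℤ.* t) where
  instance
    2p≢0 : ℕ.NonZero (2 ℕ.* p)
    2p≢0 = ℕ.m*n≢0 2 p

  private
    module H = Residues (2 ℕ.* p)
    module P = Residues p

  -- e is 0 modulo 2 and 1 modulo p.
  e : ℤ
  e = 1ℤ ℤ.+ + p

  private
    2p≡ : + (2 ℕ.* p) ≡ + 2 ℤ.* + p
    2p≡ = ℤ.pos-* 2 p

    2p∣ : ∀ {x y} q → x ℤ.- y ≡ q ℤ.* (+ 2 ℤ.* + p) → x H.≈ y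
    2p∣ q eq = mod (ℤ∣.divides q (≡.trans eq (≡.cong (q ℤ.*_) (≡.sym 2p≡))))

    p∣ : ∀ {x y} q → x ℤ.- y ≡ q ℤ.* + p → x P.≈ y
    p∣ q eq = mod (ℤ∣.divides q eq)

  ≈₂ₚ⇒≈ₚ : ∀ {x y} → x H.≈ y → x P.≈ y
  ≈₂ₚ⇒≈ₚ (mod d) = mod (ℤ∣.∣-trans (ℤ∣.divides (+ 2) 2p≡) d)

  ≈₂ₚ⇒≈₂ : ∀ {x y} → x H.≈ y → x Two.≈ y
  ≈₂ₚ⇒≈₂ (mod d) = mod (ℤ∣.∣-trans (ℤ∣.divides (+ p) (≡.trans 2p≡ (ℤ.*-comm (+ 2) (+ p)))) d)

  -- The even and the odd class modulo 2p above the class of `y` modulo p.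
  even∙ odd∙ : ℤ → ℤ
  even∙ y = e ℤ.* y
  odd∙ y = e ℤ.* y ℤ.+ + p

  even-cong : ∀ {x y} → x P.≈ y → even∙ x H.≈ even∙ y
  even-cong {x} {y} (mod (ℤ∣.divides q eq)) = 2p∣ (q ℤ.* (1ℤ ℤ.+ t)) (begin
    e ℤ.* x ℤ.- e ℤ.* y                           ≡⟨ lemma₁ e x y ⟩
    e ℤ.* (x ℤ.- y)                               ≡⟨ ≡.cong₂ (λ p → (1ℤ ℤ.+ p) ℤ.*_) odd eq ⟩
    (1ℤ ℤ.+ (1ℤ ℤ.+ + 2 ℤ.* t)) ℤ.* (q ℤ.* + p)   ≡⟨ lemma₂ t q (+ p) ⟩
    q ℤ.* (1ℤ ℤ.+ t) ℤ.* (+ 2 ℤ.* + p)            ∎)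
    where
    open ≡.≡-Reasoning
    lemma₁ : ∀ e x y → e ℤ.* x ℤ.- e ℤ.* y ≡ e ℤ.* (x ℤ.- y)
    lemma₁ = solve-∀
    lemma₂ : ∀ t q p → (1ℤ ℤ.+ (1ℤ ℤ.+ + 2 ℤ.* t)) ℤ.* (q ℤ.* p) ≡ q ℤ.* (1ℤ ℤ.+ t) ℤ.* (+ 2 ℤ.* p)
    lemma₂ = solve-∀

  odd-cong : ∀ {x y} → x P.≈ y → odd∙ x H.≈ odd∙ y
  odd-cong x≈y = H.+-congʳ {+ p} (even-cong x≈y)

  even≈ₚ : ∀ y → even∙ y P.≈ y
  even≈ₚ y = p∣ y (lemma (+ p) y)
    where
    lemma : ∀ p y → (1ℤ ℤ.+ p) ℤ.* y ℤ.- y ≡ y ℤ.* p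
    lemma = solve-∀

  odd≈ₚ : ∀ y → odd∙ y P.≈ y
  odd≈ₚ y = p∣ (1ℤ ℤ.+ y) (lemma (+ p) y)
    where
    lemma : ∀ p y → (1ℤ ℤ.+ p) ℤ.* y ℤ.+ p ℤ.- y ≡ (1ℤ ℤ.+ y) ℤ.* p
    lemma = solve-∀

  even≈₂ : ∀ y → even∙ y Two.≈ 0ℤ
  even≈₂ y = mod (ℤ∣.divides ((1ℤ ℤ.+ t) ℤ.* y)
    (≡.trans (≡.cong (λ p → (1ℤ ℤ.+ p) ℤ.* y ℤ.- 0ℤ) odd) (lemma t y)))
    where
    lemma : ∀ t y → (1ℤ ℤ.+ (1ℤ ℤ.+ + 2 ℤ.* t)) ℤ.* y ℤ.- 0ℤ ≡ (1ℤ ℤ.+ t) ℤ.* y ℤ.* + 2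
    lemma = solve-∀

  odd≈₂ : ∀ y → odd∙ y Two.≈ 1ℤ
  odd≈₂ y = mod (ℤ∣.divides ((1ℤ ℤ.+ t) ℤ.* y ℤ.+ t)
    (≡.trans (≡.cong (λ p → (1ℤ ℤ.+ p) ℤ.* y ℤ.+ p ℤ.- 1ℤ) odd) (lemma t y)))
    where
    lemma : ∀ t y → (1ℤ ℤ.+ (1ℤ ℤ.+ + 2 ℤ.* t)) ℤ.* y ℤ.+ (1ℤ ℤ.+ + 2 ℤ.* t) ℤ.- 1ℤ ≡
                    ((1ℤ ℤ.+ t) ℤ.* y ℤ.+ t) ℤ.* + 2
    lemma = solve-∀

  ≈₂0⇒even : ∀ {x} → 0ℤ Two.≈ x → even∙ x H.≈ x
  ≈₂0⇒even {x} (mod (ℤ∣.divides q eq)) = 2p∣ (ℤ.- q) (≡.trans (lemma₁ (+ p) x)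
    (≡.trans (≡.cong (λ z → ℤ.- z ℤ.* + p) eq) (lemma₂ q (+ p))))
    where
    lemma₁ : ∀ p x → (1ℤ ℤ.+ p) ℤ.* x ℤ.- x ≡ ℤ.- (0ℤ ℤ.- x) ℤ.* p
    lemma₁ = solve-∀
    lemma₂ : ∀ q p → ℤ.- (q ℤ.* + 2) ℤ.* p ≡ ℤ.- q ℤ.* (+ 2 ℤ.* p)
    lemma₂ = solve-∀

  ≈₂1⇒odd : ∀ {x} → 1ℤ Two.≈ x → odd∙ x H.≈ x
  ≈₂1⇒odd {x} (mod (ℤ∣.divides q eq)) = 2p∣ (1ℤ ℤ.- q) (≡.trans (lemma₁ (+ p) x)
    (≡.trans (≡.cong (λ z → (+ 2 ℤ.- z) ℤ.* + p) eq) (lemma₂ q (+ p))))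
    where
    lemma₁ : ∀ p x → (1ℤ ℤ.+ p) ℤ.* x ℤ.+ p ℤ.- x ≡ (+ 2 ℤ.- (1ℤ ℤ.- x)) ℤ.* p
    lemma₁ = solve-∀
    lemma₂ : ∀ q p → (+ 2 ℤ.- q ℤ.* + 2) ℤ.* p ≡ (1ℤ ℤ.- q) ℤ.* (+ 2 ℤ.* p)
    lemma₂ = solve-∀

  combine : ℤ × Fin 2 → ℤ
  combine (y , 0F) = even∙ y
  combine (y , 1F) = odd∙ y

  split : ℤ → ℤ × Fin 2
  split x = x , Two.residue x

  split-combine : ∀ y → Setoid._≈_ (P.setoid ×ₛ ≡.setoid (Fin 2)) (split (combine y)) y
  split-combine (y , 0F) = even≈ₚ y , Two.residue-cong (even≈₂ y)
  split-combine (y , 1F) = odd≈ₚ y , Two.residue-cong (odd≈₂ y)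

  combine-split : ∀ x → combine (split x) H.≈ x
  combine-split x with Two.residue x | Two.≈-residue x
  ... | 0F | 0≈x = ≈₂0⇒even 0≈x
  ... | 1F | 1≈x = ≈₂1⇒odd 1≈x

  split-cong : ∀ {x x′} → x H.≈ x′ → Setoid._≈_ (P.setoid ×ₛ ≡.setoid (Fin 2)) (split x) (split x′)
  split-cong eq = ≈₂ₚ⇒≈ₚ eq , Two.residue-cong (≈₂ₚ⇒≈₂ eq)

  combine-cong : ∀ {y y′} → Setoid._≈_ (P.setoid ×ₛ ≡.setoid (Fin 2)) y y′ → combine y H.≈ combine y′
  combine-cong {y , 0F} (eq , ≡.refl) = even-cong eq
  combine-cong {y , 1F} (eq , ≡.refl) = odd-cong eq

  crt : Inverse H.setoid (P.setoid ×ₛ ≡.setoid (Fin 2))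
  crt = record
    { to = split ; from = combine ; to-cong = split-cong ; from-cong = combine-cong
    ; inverse = (λ {y} eq → let (p , q) = split-cong eq ; (p′ , q′) = split-combine y
                            in P.trans p p′ , ≡.trans q q′)
              , (λ {x} eq → H.trans (combine-cong eq) (combine-split x))
    }

  ∑-split : (f : GroupRing.Fn (2 ℕ.* p) ℤ.+-*-commutativeRing) →
            GroupRing.∑_ (2 ℕ.* p) ℤ.+-*-commutativeRing (Func.to f) ≡
            GroupRing.∑_ p ℤ.+-*-commutativeRing (λ y → Func.to f (even∙ y)) ℤ.+
            GroupRing.∑_ p ℤ.+-*-commutativeRing (λ y → Func.to f (odd∙ y))
  ∑-split f = ≡.trans
    (∑-reindex M (enumerate-×2 P.residues) H.residues (Symm.inverse crt) f)
    (sum-×2 P.residues M (Func.to f ∘ combine))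
    where
    M = CommutativeRing.+-commutativeMonoid ℤ.+-*-commutativeRing

  module _ {k b a : ℕ} {s : ℤ → ℤ} (dezaSet : IsDezaSet (2 ℕ.* p) k b a s) where
    open IsDezaSet dezaSet
    private
      module H⊛ = GroupRing (2 ℕ.* p) ℤ.+-*-commutativeRing
      A B : ℤ → ℤ
      A y = s (even∙ y)
      B y = s (odd∙ y)
      sᶠ : H⊛.Fn
      sᶠ = record { to = s ; cong = s-cong }
    open GroupRing p ℤ.+-*-commutativeRing

    private
      evenSet : IsSymmetricSet p A
      evenSet = record
        { s-cong = λ eq → s-cong (even-cong eq)
        ; s-01   = λ x → s-01 (even∙ x)
        ; s-neg  = λ x → ≡.trans (≡.cong s (lemma e x)) (s-neg (even∙ x))
        }
        where
        lemma : ∀ e x → e ℤ.* (ℤ.- x) ≡ ℤ.- (e ℤ.* x)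
        lemma = solve-∀

      oddSet : IsSymmetricSet p B
      oddSet = record
        { s-cong = λ eq → s-cong (odd-cong eq)
        ; s-01   = λ x → s-01 (odd∙ x)
        -- The classes of p and -p modulo 2p agree, so the shift by p is compatible with negation.
        ; s-neg  = λ x → ≡.trans (s-cong (2p∣ 1ℤ (lemma e x (+ p)))) (s-neg (odd∙ x))
        }
        where
        lemma : ∀ e x p → e ℤ.* (ℤ.- x) ℤ.+ p ℤ.- (ℤ.- (e ℤ.* x ℤ.+ p)) ≡ 1ℤ ℤ.* (+ 2 ℤ.* p)
        lemma = solve-∀

      module A = IsSymmetricSet evenSet
      module B = IsSymmetricSet oddSet
      Aᶠ Bᶠ : Fn
      Aᶠ = record { to = A ; cong = A.s-cong }
      Bᶠ = record { to = B ; cong = B.s-cong }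

      even-even : ∀ x y → s (even∙ x ℤ.- even∙ y) ≡ A (x ℤ.- y)
      even-even x y = ≡.cong s (lemma e x y)
        where
        lemma : ∀ e x y → e ℤ.* x ℤ.- e ℤ.* y ≡ e ℤ.* (x ℤ.- y)
        lemma = solve-∀

      odd-even : ∀ x y → s (odd∙ x ℤ.- even∙ y) ≡ B (x ℤ.- y)
      odd-even x y = ≡.cong s (lemma e x y (+ p))
        where
        lemma : ∀ e x y p → e ℤ.* x ℤ.+ p ℤ.- e ℤ.* y ≡ e ℤ.* (x ℤ.- y) ℤ.+ p
        lemma = solve-∀

      even-odd : ∀ x y → s (even∙ x ℤ.- odd∙ y) ≡ B (x ℤ.- y)
      even-odd x y = s-cong (2p∣ (ℤ.- 1ℤ) (lemma e x y (+ p)))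
        where
        lemma : ∀ e x y p → e ℤ.* x ℤ.- (e ℤ.* y ℤ.+ p) ℤ.- (e ℤ.* (x ℤ.- y) ℤ.+ p) ≡ ℤ.- 1ℤ ℤ.* (+ 2 ℤ.* p)
        lemma = solve-∀

      odd-odd : ∀ x y → s (odd∙ x ℤ.- odd∙ y) ≡ A (x ℤ.- y)
      odd-odd x y = ≡.cong s (lemma e x y (+ p))
        where
        lemma : ∀ e x y p → e ℤ.* x ℤ.+ p ℤ.- (e ℤ.* y ℤ.+ p) ≡ e ℤ.* (x ℤ.- y)
        lemma = solve-∀

      ⊛-split : ∀ d → (s H⊛.⊛ s) d ≡
                ∑ (λ y → A y ℤ.* s (d ℤ.- even∙ y)) ℤ.+ ∑ (λ y → B y ℤ.* s (d ℤ.- odd∙ y))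
      ⊛-split d = ∑-split (record
        { to = λ y → s y ℤ.* s (d ℤ.- y)
        ; cong = λ eq → ≡.cong₂ ℤ._*_ (s-cong eq) (s-cong (H.+-congˡ {d} (H.-‿cong eq))) })

      ⊛-even : ∀ x → (s H⊛.⊛ s) (even∙ x) ≡ (A ⊛ A) x ℤ.+ (B ⊛ B) x
      ⊛-even x = ≡.trans (⊛-split (even∙ x)) (≡.cong₂ ℤ._+_
        (∑-cong λ y → ≡.cong (A y ℤ.*_) (even-even x y))
        (∑-cong λ y → ≡.cong (B y ℤ.*_) (even-odd x y)))

      ⊛-odd : ∀ x → (s H⊛.⊛ s) (odd∙ x) ≡ (A ⊛ B) x ℤ.+ (A ⊛ B) x
      ⊛-odd x = ≡.trans (⊛-split (odd∙ x)) (≡.cong₂ ℤ._+_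
        (∑-cong λ y → ≡.cong (A y ℤ.*_) (odd-even x y))
        (≡.trans (∑-cong λ y → ≡.cong (B y ℤ.*_) (odd-odd x y)) (⊛-comm Bᶠ Aᶠ x)))

      even-≉ : ∀ {x} → ¬ (x P.≈ 0ℤ) → ¬ (even∙ x H.≈ 0ℤ)
      even-≉ {x} x≉0 eq = x≉0 (P.trans (P.sym (even≈ₚ x)) (≈₂ₚ⇒≈ₚ eq))

      odd-≉ : ∀ x → ¬ (odd∙ x H.≈ 0ℤ)
      odd-≉ x eq = Two.1≉0 (ℕ.n<1+n 1) (Two.trans (Two.sym (odd≈₂ x)) (≈₂ₚ⇒≈₂ eq))

      byParity : (Q : ℤ → Set) → (∀ {x y} → x H.≈ y → Q x → Q y) →
                 (∀ {x} → ¬ (x P.≈ 0ℤ) → Q (even∙ x)) → (∀ x → Q (odd∙ x)) →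
                 ∀ {x} → ¬ (x H.≈ 0ℤ) → Q x
      byParity Q Q-resp Q-even Q-odd {x} x≉0 with Two.residue x | Two.≈-residue x
      ... | 0F | 0≈x = Q-resp (≈₂0⇒even 0≈x) (Q-even λ x≈0 → x≉0 (H.trans (H.sym (≈₂0⇒even 0≈x))
                         (H.trans (even-cong x≈0) (H.reflexive (ℤ.*-zeroʳ e)))))
      ... | 1F | 1≈x = Q-resp (≈₂1⇒odd 1≈x) (Q-odd x)

    dezaPair : IsDezaPair p k b a A B
    dezaPair = record
      { A-set = evenSet
      ; B-set = oddSet
      ; A-0 = ≡.trans (≡.cong s (ℤ.*-zeroʳ e)) s-0
      ; cardinality = ≡.trans (≡.sym (∑-split sᶠ)) cardinality
      ; values₀ = λ {x} x≉0 → Sum.map (≡.trans (≡.sym (⊛-even x))) (≡.trans (≡.sym (⊛-even x)))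
                                      (values (even-≉ x≉0))
      ; values₁ = λ x → Sum.map (≡.trans (≡.sym (⊛-odd x))) (≡.trans (≡.sym (⊛-odd x)))
                                (values (odd-≉ x))
      ; reachable = λ x → Sum.map₂ (reach x) (reachable (odd-≉ x))
      ; incomplete = λ (A≡1 , B≡1) → incomplete λ {x} → byParity (λ x → s x ≡ 1ℤ)
          (λ x≈y → ≡.trans (≡.sym (s-cong x≈y))) A≡1 B≡1 {x}
      ; ¬srg = λ λ′ μ (srg₀ , srg₁) → ¬srg λ′ μ λ {x} → byParity
          (λ x → (s x ≡ 1ℤ → (s H⊛.⊛ s) x ≡ λ′) × (s x ≡ 0ℤ → (s H⊛.⊛ s) x ≡ μ))
          (λ { x≈y (f , g) → (λ eq → ≡.trans (≡.sym (H⊛.⊛-congᵢ sᶠ sᶠ x≈y)) (f (≡.trans (s-cong x≈y) eq)))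
                           , (λ eq → ≡.trans (≡.sym (H⊛.⊛-congᵢ sᶠ sᶠ x≈y)) (g (≡.trans (s-cong x≈y) eq))) })
          (λ {x} x≉0 → (λ eq → ≡.trans (⊛-even x) (proj₁ (srg₀ x≉0) eq))
                     , (λ eq → ≡.trans (⊛-even x) (proj₂ (srg₀ x≉0) eq)))
          (λ x → (λ eq → ≡.trans (⊛-odd x) (proj₁ (srg₁ x) eq))
               , (λ eq → ≡.trans (⊛-odd x) (proj₂ (srg₁ x) eq)))
          {x}
      }
      where
      reach : ∀ x → ∃[ y ] (s y ≡ 1ℤ × s (odd∙ x ℤ.- y) ≡ 1ℤ) → ∃[ y ] (A y ≡ 1ℤ × B (x ℤ.- y) ≡ 1ℤ)
      reach x (y , sy , sx-y) with Two.residue y | Two.≈-residue y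
      ... | 0F | 0≈y = y
        , ≡.trans (s-cong (≈₂0⇒even 0≈y)) sy
        , ≡.trans (≡.sym (odd-even x y)) (≡.trans (s-cong (H.+-congˡ {odd∙ x} (H.-‿cong (≈₂0⇒even 0≈y)))) sx-y)
      -- For odd `y` the first step of the walk lies in `B` and the second in `A`; the steps are
      -- exchanged, and `x - y` becomes the one in `A`.
      ... | 1F | 1≈y = x ℤ.- y
        , ≡.trans (≡.sym (odd-odd x y)) (≡.trans (s-cong (H.+-congˡ {odd∙ x} (H.-‿cong (≈₂1⇒odd 1≈y)))) sx-y)
        , ≡.trans (≡.cong B (lemma x y)) (≡.trans (s-cong (≈₂1⇒odd 1≈y)) sy)
        where
        lemma : ∀ x y → x ℤ.- (x ℤ.- y) ≡ y
        lemma = solve-∀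

-- Sums of integers and the field ℤ/p

sum-mono-≤ : ∀ {m} {t u : Fin m → ℤ} → (∀ i → t i ℤ.≤ u i) → sum t ℤ.≤ sum u
sum-mono-≤ {zero}  t≤u = ℤ.≤-refl
sum-mono-≤ {suc m} t≤u = ℤ.+-mono-≤ (t≤u zero) (sum-mono-≤ (t≤u ∘ suc))

-- One strict inequality would separate the sums. This is how a count is turned into an identity of
-- sets, for full and empty sets, translation invariance and square roots alike.
sum-≤-≡ : ∀ {m} {t u : Fin m → ℤ} → (∀ i → t i ℤ.≤ u i) → sum t ≡ sum u → ∀ i → t i ≡ u i
sum-≤-≡ {suc m} {t} {u} t≤u eq with t zero ℤ.≟ u zero
... | no  t₀≢u₀ = contradiction eq (ℤ.<⇒≢ (ℤ.+-mono-<-≤ (ℤ.≤∧≢⇒< (t≤u zero) t₀≢u₀) (sum-mono-≤ (t≤u ∘ suc))))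
... | yes t₀≡u₀ = λ
  { zero    → t₀≡u₀
  ; (suc i) → sum-≤-≡ (t≤u ∘ suc) (∙-cancelˡ (t zero) _ _
      (≡.trans eq (≡.cong (ℤ._+ sum (u ∘ suc)) (≡.sym t₀≡u₀)))) i
  }
  where open GroupProperties (AbelianGroup.group ℤ.+-0-abelianGroup)

sum-const : ∀ m c → sum {m} (λ _ → c) ≡ + m ℤ.* c
sum-const zero    c = ≡.sym (ℤ.*-zeroˡ c)
sum-const (suc m) c = ≡.trans (≡.cong (λ x → c ℤ.+ x) (sum-const m c)) (lemma (+ m) c)
  where
  lemma : ∀ m c → c ℤ.+ m ℤ.* c ≡ (1ℤ ℤ.+ m) ℤ.* c
  lemma = solve-∀

≡0⊎≡1⇒* : ∀ {x} → x ≡ 0ℤ ⊎ x ≡ 1ℤ → x ℤ.* x ≡ x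
≡0⊎≡1⇒* (inj₁ ≡.refl) = ≡.refl
≡0⊎≡1⇒* (inj₂ ≡.refl) = ≡.refl

char-ℤ/ : ∀ q → CommutativeRing._≈_ (ℤ/ q)
  (Mult._×_ (CommutativeRing.semiring (ℤ/ q)) q 1ℤ) 0ℤ
char-ℤ/ q = mod (ℤ∣.divides 1ℤ (≡.trans (≡.cong (ℤ._- 0ℤ) (go q)) (lemma (+ q))))
  where
  go : ∀ m → Mult._×_ (CommutativeRing.semiring (ℤ/ q)) m 1ℤ ≡ + m
  go zero    = ≡.refl
  go (suc m) = ≡.cong (λ x → 1ℤ ℤ.+ x) (go m)
  lemma : ∀ q → q ℤ.- 0ℤ ≡ 1ℤ ℤ.* q
  lemma = solve-∀

module PrimeField (p : ℕ) .{{_ : ℕ.NonZero p}} (p-prime : Prime p) where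
  open Residues p public
  open GroupRing p ℤ.+-*-commutativeRing public

  private
    eqℤ : ∀ a b c d → 1 ℕ.+ a ℕ.* b ≡ c ℕ.* d → 1ℤ ℤ.+ + a ℤ.* + b ≡ + c ℤ.* + d
    eqℤ a b c d eq = ≡.trans (≡.cong (λ x → 1ℤ ℤ.+ x) (≡.sym (ℤ.pos-* a b)))
                             (≡.trans (≡.cong +_ eq) (ℤ.pos-* c d))

  1<p : 1 ℕ.< p
  1<p = ℕ.nonTrivial⇒n>1 p {{prime⇒nonTrivial p-prime}}

  ≈0⇒∣ : ∀ {x} → x ≈ 0ℤ → + p ∣ x
  ≈0⇒∣ {x} (mod d) = ≡.subst (+ p ∣_) (ℤ.+-identityʳ x) d

  ∣⇒≈0 : ∀ {x} → + p ∣ x → x ≈ 0ℤ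
  ∣⇒≈0 {x} d = mod (≡.subst (+ p ∣_) (≡.sym (ℤ.+-identityʳ x)) d)

  *-≈0 : ∀ x y → x ℤ.* y ≈ 0ℤ → x ≈ 0ℤ ⊎ y ≈ 0ℤ
  *-≈0 x y xy≈0 = Sum.map (∣⇒≈0 ∘ ℤ∣.∣ᵤ⇒∣) (∣⇒≈0 ∘ ℤ∣.∣ᵤ⇒∣)
    (euclidsLemma ℤ.∣ x ∣ ℤ.∣ y ∣ p-prime
      (≡.subst (p ℕ∣.∣_) (ℤ.abs-* x y) (ℤ∣.∣⇒∣ᵤ (≈0⇒∣ xy≈0))))

  2≉0 : p ≢ 2 → ¬ (+ 2 ≈ 0ℤ)
  2≉0 p≢2 2≈0 = p≢2 (ℕ.≤-antisym (ℕ∣.∣⇒≤ (ℤ∣.∣⇒∣ᵤ (≈0⇒∣ 2≈0))) 1<p)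

  ≈⇒-≈0 : ∀ {x y} → x ≈ y → x ℤ.- y ≈ 0ℤ
  ≈⇒-≈0 (mod d) = ∣⇒≈0 d

  -≈0⇒≈ : ∀ {x y} → x ℤ.- y ≈ 0ℤ → x ≈ y
  -≈0⇒≈ d = mod (≈0⇒∣ d)

  *-cancelˡ-≈ : ∀ c {x y} → ¬ (c ≈ 0ℤ) → c ℤ.* x ≈ c ℤ.* y → x ≈ y
  *-cancelˡ-≈ c {x} {y} c≉0 eq = [ (λ c≈0 → contradiction c≈0 c≉0) , -≈0⇒≈ ]′
    (*-≈0 c (x ℤ.- y) (trans (reflexive (lemma c x y)) (≈⇒-≈0 eq)))
    where
    lemma : ∀ c x y → c ℤ.* (x ℤ.- y) ≡ c ℤ.* x ℤ.- c ℤ.* y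
    lemma = solve-∀

  inverse : ∀ {x} → ¬ (x ≈ 0ℤ) → ∃[ u ] u ℤ.* x ≈ 1ℤ
  inverse {x} x≉0 with residue x | ≈-residue x
  ... | zero | 0≈x = contradiction (sym 0≈x) x≉0
  ... | r@(suc _) | r≈x with coprime-Bézout (prime⇒coprime p-prime (Fin.toℕ<n r))
  ...   | GCD.Bézout.+- u v eq = ℤ.- + v , trans (*-congˡ {ℤ.- + v} (sym r≈x)) (mod (ℤ∣.divides (ℤ.- + u)
    (≡.trans (lemma₁ (+ v) (+ toℕ r)) (≡.trans (≡.cong ℤ.-_ (eqℤ v (toℕ r) u p eq)) (ℤ.neg-distribˡ-* (+ u) (+ p))))))
    where
    lemma₁ : ∀ v r → ℤ.- v ℤ.* r ℤ.- 1ℤ ≡ ℤ.- (1ℤ ℤ.+ v ℤ.* r)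
    lemma₁ = solve-∀
  ...   | GCD.Bézout.-+ u v eq = + v , trans (*-congˡ {+ v} (sym r≈x)) (mod (ℤ∣.divides (+ u)
    (≡.trans (≡.cong (ℤ._- 1ℤ) (≡.sym (eqℤ u p v (toℕ r) eq))) (lemma₂ (+ u) (+ p)))))
    where
    lemma₂ : ∀ u p → 1ℤ ℤ.+ u ℤ.* p ℤ.- 1ℤ ≡ u ℤ.* p
    lemma₂ = solve-∀

-- Even subsets of ℤ/p and their convolutions

module SymmetricSets (p : ℕ) .{{_ : ℕ.NonZero p}} (p-prime : Prime p) where
  open PrimeField p p-prime public
  open Func

  ∑-const : ∀ c → ∑ (λ _ → c) ≡ + p ℤ.* c
  ∑-const = sum-const p

  ∑-≤-≡ : (f g : Fn) → (∀ x → to f x ℤ.≤ to g x) → ∑ (to f) ≡ ∑ (to g) → ∀ x → to f x ≡ to g x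
  ∑-≤-≡ f g f≤g eq x = ≡.trans (≡.sym (cong f (≈-residue x))) (≡.trans
    (sum-≤-≡ (λ i → f≤g (+ toℕ i)) eq (residue x)) (cong g (≈-residue x)))

  -- `∑` is the augmentation of the group ring: after exchanging the sums, each inner sum runs over
  -- a translate of `g`.
  ∑-⊛ : (f g : Fn) → ∑ (to f ⊛ to g) ≡ ∑ (to f) ℤ.* ∑ (to g)
  ∑-⊛ f g = begin
    ∑ (λ x → ∑ (λ y → to f y ℤ.* to g (x ℤ.- y)))  ≡⟨ ∑-swap (λ x y → to f y ℤ.* to g (x ℤ.- y)) ⟩
    ∑ (λ y → ∑ (λ x → to f y ℤ.* to g (x ℤ.- y)))  ≡⟨ ∑-cong (λ y → ∑-*ˡ (to f y) (λ x → to g (x ℤ.- y))) ⟨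
    ∑ (λ y → to f y ℤ.* ∑ (λ x → to g (x ℤ.- y)))
      ≡⟨ ∑-cong (λ y → ≡.cong (to f y ℤ.*_) (∑-bij (translation (ℤ.- y)) g)) ⟩
    ∑ (λ y → to f y ℤ.* ∑ (to g))                  ≡⟨ ∑-*ʳ (∑ (to g)) (to f) ⟨
    ∑ (to f) ℤ.* ∑ (to g)                          ∎
    where open ≡.≡-Reasoning

  ∑-δ : ∑ (δ 0ℤ) ≡ 1ℤ
  ∑-δ = ≡.trans (∑-cong λ y → ≡.sym (ℤ.*-identityʳ (δ 0ℤ y)))
                (δ-sift 0ℤ (record { to = λ _ → 1ℤ ; cong = λ _ → ≡.refl }))

  scaling : ∀ {c} → ¬ (c ≈ 0ℤ) → Inverse setoid setoid
  scaling {c} c≉0 = let (u , uc≈1) = inverse c≉0 in record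
    { to = c ℤ.*_ ; from = u ℤ.*_
    ; to-cong = *-congˡ {c} ; from-cong = *-congˡ {u}
    ; inverse = (λ {x} eq → trans (*-congˡ {c} eq) (trans (reflexive (lemma c u x)) (cancel {u} {x} uc≈1)))
              , (λ {x} eq → trans (*-congˡ {u} eq) (trans (reflexive (≡.sym (ℤ.*-assoc u c x))) (cancel {u} {x} uc≈1)))
    }
    where
    lemma : ∀ c u x → c ℤ.* (u ℤ.* x) ≡ u ℤ.* c ℤ.* x
    lemma = solve-∀
    cancel : ∀ {u x} → u ℤ.* c ≈ 1ℤ → u ℤ.* c ℤ.* x ≈ x
    cancel {u} {x} eq = trans (*-congʳ {x} eq) (reflexive (ℤ.*-identityˡ x))

  module SymmetricSet {f : ℤ → ℤ} (f-set : IsSymmetricSet p f) where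
    open IsSymmetricSet f-set

    fn : Fn
    fn = record { to = f ; cong = s-cong }

    0≤ : ∀ x → 0ℤ ℤ.≤ f x
    0≤ x with s-01 x
    ... | inj₁ eq = ℤ.≤-reflexive (≡.sym eq)
    ... | inj₂ eq = ≡.subst (0ℤ ℤ.≤_) (≡.sym eq) (ℤ.+≤+ ℕ.z≤n)

    ≤1 : ∀ x → f x ℤ.≤ 1ℤ
    ≤1 x with s-01 x
    ... | inj₁ eq = ≡.subst (ℤ._≤ 1ℤ) (≡.sym eq) (ℤ.+≤+ ℕ.z≤n)
    ... | inj₂ eq = ℤ.≤-reflexive eq

    ∑≡0⇒empty : ∑ f ≡ 0ℤ → ∀ x → f x ≡ 0ℤ
    ∑≡0⇒empty eq x = ≡.sym (∑-≤-≡ (record { to = λ _ → 0ℤ ; cong = λ _ → ≡.refl }) fn 0≤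
      (≡.trans (∑-const 0ℤ) (≡.trans (ℤ.*-zeroʳ (+ p)) (≡.sym eq))) x)

    ∑≡p⇒full : ∑ f ≡ + p → ∀ x → f x ≡ 1ℤ
    ∑≡p⇒full eq x = ∑-≤-≡ fn (record { to = λ _ → 1ℤ ; cong = λ _ → ≡.refl }) ≤1
      (≡.trans eq (≡.sym (≡.trans (∑-const 1ℤ) (ℤ.*-identityʳ (+ p))))) x

    0≤∑ : 0ℤ ℤ.≤ ∑ f
    0≤∑ = ℤ.≤-trans (ℤ.≤-reflexive (≡.sym (≡.trans (∑-const 0ℤ) (ℤ.*-zeroʳ (+ p)))))
                    (sum-mono-≤ {p} λ i → 0≤ (+ toℕ i))

    ∑≤p : ∑ f ℤ.≤ + p
    ∑≤p = ℤ.≤-trans (sum-mono-≤ {p} λ i → ≤1 (+ toℕ i))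
                    (ℤ.≤-reflexive (≡.trans (∑-const 1ℤ) (ℤ.*-identityʳ (+ p))))

    -- A cardinality lies between 0 and p, and only the two ends are multiples of p.
    p∣∑⇒trivial : + p ∣ ∑ f → (∀ x → f x ≡ 0ℤ) ⊎ (∀ x → f x ≡ 1ℤ)
    p∣∑⇒trivial d with ∑ f in eq | 0≤∑ | ∑≤p
    ... | + zero  | _ | _ = inj₁ (∑≡0⇒empty eq)
    ... | + suc r | _ | r≤p = inj₂ (∑≡p⇒full (≡.trans eq (≡.cong +_
          (ℕ.≤-antisym (ℤ.drop‿+≤+ r≤p) (ℕ∣.∣⇒≤ (ℤ∣.∣⇒∣ᵤ d))))))
      where import Data.Nat.Divisibility as ℕ∣
    ... | ℤ.-[1+ r ] | () | _

    ⊛-0 : (f ⊛ f) 0ℤ ≡ ∑ f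
    ⊛-0 = ∑-cong λ y → ≡.trans (≡.cong (f y ℤ.*_) (≡.trans (≡.cong f (ℤ.+-identityˡ (ℤ.- y))) (s-neg y)))
                               (≡0⊎≡1⇒* (s-01 y))

    private
      -- Each term `f y * f (x - y)` is at most `f y`. Equal sums force equality termwise, so
      -- `x - y` and, by evenness, `y - x` stay in the set.
      step : ∀ {x} → (f ⊛ f) x ≡ ∑ f → ∀ {y} → f y ≡ 1ℤ → f (y ℤ.- x) ≡ 1ℤ
      step {x} eq {y} fy≡1 = ≡.trans (≡.trans (≡.cong f (lemma x y)) (s-neg (x ℤ.- y)))
        (≡.trans (≡.sym (ℤ.*-identityˡ _)) (≡.trans (≡.cong (ℤ._* f (x ℤ.- y)) (≡.sym fy≡1))
        (≡.trans (∑-≤-≡ (record { to = λ y → f y ℤ.* f (x ℤ.- y)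
            ; cong = λ e → ≡.cong₂ ℤ._*_ (s-cong e) (s-cong (+-congˡ {x} (-‿cong e))) }) fn le eq y) fy≡1)))
        where
        lemma : ∀ x y → y ℤ.- x ≡ ℤ.- (x ℤ.- y)
        lemma = solve-∀
        le : ∀ y → f y ℤ.* f (x ℤ.- y) ℤ.≤ f y
        le y with s-01 y
        ... | inj₁ e rewrite e = ℤ.≤-reflexive (ℤ.*-zeroˡ (f (x ℤ.- y)))
        ... | inj₂ e rewrite e = ℤ.≤-trans (ℤ.≤-reflexive (ℤ.*-identityˡ _)) (≤1 (x ℤ.- y))

      iterate : ∀ {x} → (f ⊛ f) x ≡ ∑ f → ∀ {y} → f y ≡ 1ℤ → ∀ k → f (y ℤ.- + k ℤ.* x) ≡ 1ℤ
      iterate {x} eq {y} fy≡1 zero = ≡.trans (≡.cong f (lemma x y)) fy≡1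
        where
        lemma : ∀ x y → y ℤ.- 0ℤ ℤ.* x ≡ y
        lemma = solve-∀
      iterate {x} eq {y} fy≡1 (suc k) = ≡.trans (≡.cong f (lemma x y (+ k))) (step eq (iterate eq fy≡1 k))
        where
        lemma : ∀ x y k → y ℤ.- (1ℤ ℤ.+ k) ℤ.* x ≡ y ℤ.- k ℤ.* x ℤ.- x
        lemma = solve-∀

    -- A set equal to its translate by x is a union of cosets of the subgroup generated by x.
    translate-invariant⇒full : ∀ {x} → ¬ (x ≈ 0ℤ) → (f ⊛ f) x ≡ ∑ f → ∀ {y} → f y ≡ 1ℤ → ∀ z → f z ≡ 1ℤ
    translate-invariant⇒full {x} x≉0 eq {y} fy≡1 z = ≡.trans (s-cong z≈) (iterate eq fy≡1 k)
      where
      u = proj₁ (inverse x≉0)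
      k = toℕ (residue ((y ℤ.- z) ℤ.* u))
      lemma₁ : ∀ x y z u → (y ℤ.- z) ℤ.* u ℤ.* x ≡ (y ℤ.- z) ℤ.* (u ℤ.* x)
      lemma₁ = solve-∀
      lemma₂ : ∀ y z → z ≡ y ℤ.- (y ℤ.- z) ℤ.* 1ℤ
      lemma₂ = solve-∀
      z≈ : z ≈ y ℤ.- + k ℤ.* x
      z≈ = trans (reflexive (lemma₂ y z)) (+-congˡ {y} (-‿cong (sym (trans
        (*-congʳ {x} (≈-residue ((y ℤ.- z) ℤ.* u))) (trans (reflexive (lemma₁ x y z u))
        (*-congˡ {y ℤ.- z} (proj₂ (inverse x≉0))))))))

    module _ (p≢2 : p ≢ 2) where
      private
        module F₂ = CommutativeRing (ℤ/ 2)
        module R₂ = CommutativeRing (GroupRing.groupRing p (ℤ/ 2))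
        fn₂ : GroupRing.Fn p (ℤ/ 2)
        fn₂ = record { to = f ; cong = λ e → F₂.reflexive (s-cong e) }

      -- The Frobenius map of 𝔽₂[ℤ/p]; p is odd, so that doubling is invertible.
      ⊛-double : ∀ y → _≈ₙ_ 2 ((f ⊛ f) (+ 2 ℤ.* y)) (f y)
      ⊛-double y = F₂.trans
        (F₂.sym (R₂.*-congˡ {fn₂} {fn₂ R₂.* R₂.1#} {fn₂} (R₂.*-identityʳ fn₂) (+ 2 ℤ.* y)))
        (F₂.trans (GroupRingFrobenius.frobenius-invertible p (ℤ/ 2) prime[2] (char-ℤ/ 2)
                     (*-cancelˡ-≈ (+ 2) (2≉0 p≢2)) fn₂ y)
                  (F₂.reflexive (≡.trans (≡.cong (f y ℤ.*_) (ℤ.*-identityʳ (f y))) (≡0⊎≡1⇒* (s-01 y)))))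

-- Parity of the numbers of common neighbours

even-double : ∀ x → x ℤ.+ x Two.≈ 0ℤ
even-double x = mod (ℤ∣.divides x (lemma x))
  where
  lemma : ∀ x → x ℤ.+ x ℤ.- 0ℤ ≡ x ℤ.* + 2
  lemma = solve-∀

even-sum⇒≈₂ : ∀ {x y} → x ℤ.+ y Two.≈ 0ℤ → x Two.≈ y
even-sum⇒≈₂ {x} {y} (mod (ℤ∣.divides q eq)) = mod (ℤ∣.divides (q ℤ.- y) (≡.trans (lemma₁ x y)
  (≡.trans (≡.cong (ℤ._- + 2 ℤ.* y) eq) (lemma₂ q y))))
  where
  lemma₁ : ∀ x y → x ℤ.- y ≡ x ℤ.+ y ℤ.- 0ℤ ℤ.- + 2 ℤ.* y
  lemma₁ = solve-∀
  lemma₂ : ∀ q y → q ℤ.* + 2 ℤ.- + 2 ℤ.* y ≡ (q ℤ.- y) ℤ.* + 2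
  lemma₂ = solve-∀

01-≈₂⇒≡ : ∀ {x y} → x ≡ 0ℤ ⊎ x ≡ 1ℤ → y ≡ 0ℤ ⊎ y ≡ 1ℤ → x Two.≈ y → x ≡ y
01-≈₂⇒≡ (inj₁ ≡.refl) (inj₁ ≡.refl) _   = ≡.refl
01-≈₂⇒≡ (inj₂ ≡.refl) (inj₂ ≡.refl) _   = ≡.refl
01-≈₂⇒≡ (inj₁ ≡.refl) (inj₂ ≡.refl) 0≈1 = contradiction (Two.sym 0≈1) (Two.1≉0 (ℕ.n<1+n 1))
01-≈₂⇒≡ (inj₂ ≡.refl) (inj₁ ≡.refl) 1≈0 = contradiction 1≈0 (Two.1≉0 (ℕ.n<1+n 1))

double-injective : ∀ {x y} → x ℤ.+ x ≡ y ℤ.+ y → x ≡ y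
double-injective {x} {y} eq = ℤ.*-cancelˡ-≡ (+ 2) x y
  (≡.trans (lemma x) (≡.trans eq (≡.sym (lemma y))))
  where
  lemma : ∀ x → + 2 ℤ.* x ≡ x ℤ.+ x
  lemma = solve-∀

-- Serves to show that convolution values are constant off 0: it is enough that they lie in a set of
-- two values and avoid the one taken at 0.
other-value : ∀ {u v x : ℤ} → x ≡ u ⊎ x ≡ v →
              ∃[ y ] ((y ≡ u ⊎ y ≡ v) × (∀ {z} → z ≡ u ⊎ z ≡ v → z ≢ x → z ≡ y))
other-value {u} {v} (inj₁ ≡.refl) = v , inj₂ ≡.refl , λ
  { (inj₁ z≡u) z≢u → contradiction z≡u z≢u
  ; (inj₂ z≡v) _   → z≡v }
other-value {u} {v} (inj₂ ≡.refl) = u , inj₁ ≡.refl , λ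
  { (inj₁ z≡u) _   → z≡u
  ; (inj₂ z≡v) z≢v → contradiction z≡v z≢v }

-- What the graph conditions leave when `B = A + δ`. The numbers `2 ∑ A` and `2 d` are the values of
-- `c₁` at 0 and off 0; being distinct members of {a, b}, they are `a` and `b` in some order.
record IsPaleyPair (p : ℕ) .{{_ : ℕ.NonZero p}} (b a : ℕ) (A B : ℤ → ℤ) : Set where
  open GroupRing p ℤ.+-*-commutativeRing
  field
    A-set    : IsSymmetricSet p A
    A-0      : A 0ℤ ≡ 0ℤ
    B≡A+δ    : ∀ x → B x ≡ A x ℤ.+ δ 0ℤ x
    d        : ℤ
    A⊛A+A≡d  : ∀ {x} → ¬ (_≈ₙ_ p x 0ℤ) → (A ⊛ A) x ℤ.+ A x ≡ d
    2∑A∈     : ∑ A ℤ.+ ∑ A ≡ + a ⊎ ∑ A ℤ.+ ∑ A ≡ + b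
    2d∈      : d ℤ.+ d ≡ + a ⊎ d ℤ.+ d ≡ + b
    2d≢2∑A   : d ℤ.+ d ≢ ∑ A ℤ.+ ∑ A
    nonempty : ∃[ y ] A y ≡ 1ℤ
    proper   : ¬ (∀ {x} → ¬ (_≈ₙ_ p x 0ℤ) → A x ≡ 1ℤ)

-- Reduction to pairs with B = A + δ

module DezaPairs (p : ℕ) .{{_ : ℕ.NonZero p}} (p-prime : Prime p) (p≢2 : p ≢ 2)
  {k b a : ℕ} {A B : ℤ → ℤ} (pair : IsDezaPair p k b a A B) where
  open SymmetricSets p p-prime
  open IsDezaPair pair
  private
    module A where
      open IsSymmetricSet A-set public
      open SymmetricSet A-set public
    module B where
      open IsSymmetricSet B-set public
      open SymmetricSet B-set public

    m r : ℤ
    m = ∑ A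
    r = ∑ B

    2*-≉0 : ∀ {y} → ¬ (y ≈ 0ℤ) → ¬ (+ 2 ℤ.* y ≈ 0ℤ)
    2*-≉0 {y} y≉0 eq with *-≈0 (+ 2) y eq
    ... | inj₁ 2≈0 = 2≉0 p≢2 2≈0
    ... | inj₂ y≈0 = y≉0 y≈0

    c₁-cong : ∀ {x y} → x ≈ y → c₁ x ≡ c₁ y
    c₁-cong eq = ≡.cong₂ ℤ._+_ (⊛-congᵢ A.fn B.fn eq) (⊛-congᵢ A.fn B.fn eq)

    c₀-parity : ∀ y → c₀ (+ 2 ℤ.* y) Two.≈ A y ℤ.+ B y
    c₀-parity y = Two.+-cong (A.⊛-double p≢2 y) (B.⊛-double p≢2 y)

    A≡1⇒≉0 : ∀ {x} → A x ≡ 1ℤ → ¬ (x ≈ 0ℤ)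
    A≡1⇒≉0 Ax≡1 x≈0 = 0≢1 (≡.trans (A.s-cong x≈0) A-0) Ax≡1

    A-not-full : ¬ (∀ x → A x ≡ 1ℤ)
    A-not-full full = 0≢1 A-0 (full 0ℤ)

    A-nonempty : ∀ {x} → B x ≡ A x → ∃[ y ] A y ≡ 1ℤ
    A-nonempty {x} Bx≡Ax with reachable x
    ... | inj₁ Bx≡1           = x , ≡.trans (≡.sym Bx≡Ax) Bx≡1
    ... | inj₂ (y , Ay≡1 , _) = y , Ay≡1

  -- `v` is the even and `w` the odd one of `a` and `b`, so that both orders are treated at once.
  module OppositeParity (v w : ℤ) (v-even : v Two.≈ 0ℤ) (w-odd : ¬ (w Two.≈ 0ℤ))
    (vw₀ : ∀ {x} → ¬ (x ≈ 0ℤ) → c₀ x ≡ v ⊎ c₀ x ≡ w) (vw₁ : ∀ x → c₁ x ≡ v ⊎ c₁ x ≡ w) where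
    private
      c₁≡v : ∀ x → c₁ x ≡ v
      c₁≡v x with vw₁ x
      ... | inj₁ eq = eq
      ... | inj₂ eq = contradiction (Two.trans (Two.reflexive (≡.sym eq)) (even-double ((A ⊛ B) x))) w-odd

      p∣2mr : + p ∣ + 2 ℤ.* (m ℤ.* r)
      p∣2mr = ℤ∣.divides v (begin
        + 2 ℤ.* (m ℤ.* r)             ≡⟨ ≡.cong (+ 2 ℤ.*_) (∑-⊛ A.fn B.fn) ⟨
        + 2 ℤ.* ∑ (A ⊛ B)             ≡⟨ ∑-*ˡ (+ 2) (A ⊛ B) ⟩
        ∑ (λ x → + 2 ℤ.* (A ⊛ B) x)   ≡⟨ ∑-cong (λ x → ≡.trans (lemma ((A ⊛ B) x)) (c₁≡v x)) ⟩
        ∑ (λ x → v)                   ≡⟨ ∑-const v ⟩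
        + p ℤ.* v                     ≡⟨ ℤ.*-comm (+ p) v ⟩
        v ℤ.* + p                     ∎)
        where
        open ≡.≡-Reasoning
        lemma : ∀ x → + 2 ℤ.* x ≡ x ℤ.+ x
        lemma = solve-∀

      ⊛-ones : (∀ x → B x ≡ 1ℤ) → ∀ x → (B ⊛ B) x ≡ + p
      ⊛-ones B≡1 x = ≡.trans (∑-cong λ y → ≡.cong₂ ℤ._*_ (B≡1 y) (B≡1 (x ℤ.- y)))
                             (≡.trans (∑-const 1ℤ) (ℤ.*-identityʳ (+ p)))

      -- The graph would be complete bipartite.
      A-empty : ¬ (∀ x → A x ≡ 0ℤ)
      A-empty A≡0 = ¬srg 0ℤ (+ p)
        ( (λ {x} x≉0 → (λ Ax≡1 → contradiction Ax≡1 (0≢1 (A≡0 x)))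
                     , (λ _ → ≡.trans (≡.cong₂ ℤ._+_ (A⊛≡0 A x) (⊛-ones B≡1 x)) (ℤ.+-identityˡ (+ p))))
        , (λ x → (λ _ → ≡.cong₂ ℤ._+_ (A⊛≡0 B x) (A⊛≡0 B x))
               , (λ Bx≡0 → contradiction (B≡1 x) (0≢1 Bx≡0))))
        where
        A⊛≡0 : ∀ g x → (A ⊛ g) x ≡ 0ℤ
        A⊛≡0 g x = ≡.trans (∑-cong λ y → ≡.trans (≡.cong (ℤ._* g (x ℤ.- y)) (A≡0 y)) (ℤ.*-zeroˡ (g (x ℤ.- y))))
                           (≡.trans (∑-const 0ℤ) (ℤ.*-zeroʳ (+ p)))
        B≡1 : ∀ x → B x ≡ 1ℤ
        B≡1 x with reachable x
        ... | inj₁ Bx≡1           = Bx≡1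
        ... | inj₂ (y , Ay≡1 , _) = contradiction Ay≡1 (0≢1 (A≡0 y))

      -- With `B` empty no edge joins the even and the odd classes, and the graph would be
      -- disconnected.
      B-nonempty : ¬ (∀ x → B x ≡ 0ℤ)
      B-nonempty B≡0 with reachable 0ℤ
      ... | inj₁ B0≡1           = 0≢1 (B≡0 0ℤ) B0≡1
      ... | inj₂ (y , _ , By≡1) = 0≢1 (B≡0 (0ℤ ℤ.- y)) By≡1

      module _ (B≡1 : ∀ x → B x ≡ 1ℤ) where
        -- The complement of `A`, with 0 included. Along doubling its convolution square will be a
        -- multiple of `C` itself off 0, as for a subgroup, and ℤ/p has only the two trivial
        -- subgroups.
        C : ℤ → ℤ
        C x = 1ℤ ℤ.- A x

        C-set : IsSymmetricSet p C
        C-set = record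
          { s-cong = λ eq → ≡.cong (λ z → 1ℤ ℤ.- z) (A.s-cong eq)
          ; s-01   = λ x → Sum.swap (Sum.map (≡.cong (λ z → 1ℤ ℤ.- z)) (≡.cong (λ z → 1ℤ ℤ.- z)) (A.s-01 x))
          ; s-neg  = λ x → ≡.cong (λ z → 1ℤ ℤ.- z) (A.s-neg x)
          }
        module C where
          open IsSymmetricSet C-set public
          open SymmetricSet C-set public

        A≡0⇒C≡1 : ∀ {x} → A x ≡ 0ℤ → C x ≡ 1ℤ
        A≡0⇒C≡1 eq = ≡.cong (λ z → 1ℤ ℤ.- z) eq

        A≡1⇒C≡0 : ∀ {x} → A x ≡ 1ℤ → C x ≡ 0ℤ
        A≡1⇒C≡0 eq = ≡.cong (λ z → 1ℤ ℤ.- z) eq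

        A+C≡1 : ∀ x → A x ℤ.+ C x ≡ 1ℤ
        A+C≡1 x = lemma (A x)
          where
          lemma : ∀ z → z ℤ.+ (1ℤ ℤ.- z) ≡ 1ℤ
          lemma = solve-∀

        c : ℤ
        c = ∑ C

        m+c≡p : m ℤ.+ c ≡ + p
        m+c≡p = ≡.trans (≡.sym (∑-+ A C)) (≡.trans (∑-cong A+C≡1) (≡.trans (∑-const 1ℤ) (ℤ.*-identityʳ (+ p))))

        ⊛-B : ∀ (f : Fn) x → (Func.to f ⊛ B) x ≡ ∑ (Func.to f)
        ⊛-B f x = ∑-cong λ y → ≡.trans (≡.cong (Func.to f y ℤ.*_) (B≡1 (x ℤ.- y))) (ℤ.*-identityʳ (Func.to f y))

        2m≡v : m ℤ.+ m ≡ v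
        2m≡v = ≡.trans (≡.cong₂ ℤ._+_ (≡.sym (⊛-B A.fn 0ℤ)) (≡.sym (⊛-B A.fn 0ℤ))) (c₁≡v 0ℤ)

        -- Both A ⊛ A + A ⊛ C and A ⊛ C + C ⊛ C are constant.
        C⊛C : ∀ x → (C ⊛ C) x ≡ c₀ x ℤ.- v
        C⊛C x = begin
          (C ⊛ C) x                      ≡⟨ lemma₁ ((A ⊛ C) x) ((C ⊛ C) x) ⟩
          (A ⊛ C) x ℤ.+ (C ⊛ C) x ℤ.- (A ⊛ C) x
                                         ≡⟨ ≡.cong (ℤ._- (A ⊛ C) x) (≡.sym (⊛-distribʳ C A C x)) ⟩
          ((λ y → A y ℤ.+ C y) ⊛ C) x ℤ.- (A ⊛ C) x
                                         ≡⟨ ≡.cong (ℤ._- (A ⊛ C) x) (⊛-cong {g = C} A+C≡B (λ _ → ≡.refl) x) ⟩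
          (B ⊛ C) x ℤ.- (A ⊛ C) x        ≡⟨ ≡.cong (ℤ._- (A ⊛ C) x) (≡.trans (⊛-comm B.fn C.fn x) (⊛-B C.fn x)) ⟩
          c ℤ.- (A ⊛ C) x                ≡⟨ lemma₂ c ((A ⊛ A) x) ((A ⊛ C) x) ⟩
          c ℤ.+ (A ⊛ A) x ℤ.- ((A ⊛ A) x ℤ.+ (A ⊛ C) x)
            ≡⟨ ≡.cong (λ z → c ℤ.+ (A ⊛ A) x ℤ.- z) (≡.trans (≡.sym (⊛-distribˡ A A C x))
                 (≡.trans (⊛-cong {f = A} (λ _ → ≡.refl) A+C≡B x) (⊛-B A.fn x))) ⟩
          c ℤ.+ (A ⊛ A) x ℤ.- m          ≡⟨ lemma₃ c ((A ⊛ A) x) m ⟩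
          (A ⊛ A) x ℤ.+ (m ℤ.+ c) ℤ.- (m ℤ.+ m)
            ≡⟨ ≡.cong₂ (λ y z → (A ⊛ A) x ℤ.+ y ℤ.- z) (≡.trans m+c≡p (≡.sym (⊛-ones B≡1 x))) 2m≡v ⟩
          c₀ x ℤ.- v                     ∎
          where
          open ≡.≡-Reasoning
          A+C≡B : ∀ y → A y ℤ.+ C y ≡ B y
          A+C≡B y = ≡.trans (A+C≡1 y) (≡.sym (B≡1 y))
          lemma₁ : ∀ x y → y ≡ x ℤ.+ y ℤ.- x
          lemma₁ = solve-∀
          lemma₂ : ∀ c x y → c ℤ.- y ≡ c ℤ.+ x ℤ.- (x ℤ.+ y)
          lemma₂ = solve-∀
          lemma₃ : ∀ c x m → c ℤ.+ x ℤ.- m ≡ x ℤ.+ (m ℤ.+ c) ℤ.- (m ℤ.+ m)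
          lemma₃ = solve-∀

        w-v : ℤ
        w-v = w ℤ.- v

        -- By `c₀-parity` the value `c₀ (2y)` has the parity of `A y + 1`, so it is `w` for `y` in
        -- `C` and `v` otherwise; `C⊛C` subtracts `v`.
        C⊛C-double : ∀ {y} → ¬ (y ≈ 0ℤ) → (C ⊛ C) (+ 2 ℤ.* y) ≡ w-v ℤ.* C y
        C⊛C-double {y} y≉0 = go (A.s-01 y) (vw₀ (2*-≉0 y≉0))
          where
          go : A y ≡ 0ℤ ⊎ A y ≡ 1ℤ → c₀ (+ 2 ℤ.* y) ≡ v ⊎ c₀ (+ 2 ℤ.* y) ≡ w →
               (C ⊛ C) (+ 2 ℤ.* y) ≡ w-v ℤ.* C y
          go (inj₁ Ay≡0) (inj₁ eq) = contradiction
            (Two.trans (Two.reflexive (≡.sym (≡.cong₂ ℤ._+_ Ay≡0 (B≡1 y))))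
              (Two.trans (Two.sym (c₀-parity y)) (Two.trans (Two.reflexive eq) v-even)))
            (Two.1≉0 (ℕ.n<1+n 1))
          go (inj₁ Ay≡0) (inj₂ eq) = ≡.trans (C⊛C (+ 2 ℤ.* y)) (≡.trans (≡.cong (ℤ._- v) eq)
            (≡.sym (≡.trans (≡.cong (w-v ℤ.*_) (A≡0⇒C≡1 Ay≡0)) (ℤ.*-identityʳ w-v))))
          go (inj₂ Ay≡1) (inj₁ eq) = ≡.trans (C⊛C (+ 2 ℤ.* y)) (≡.trans (≡.cong (ℤ._- v) eq)
            (≡.trans (ℤ.+-inverseʳ v) (≡.sym (≡.trans (≡.cong (w-v ℤ.*_) (A≡1⇒C≡0 Ay≡1)) (ℤ.*-zeroʳ w-v)))))
          go (inj₂ Ay≡1) (inj₂ eq) = contradiction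
            (Two.trans (Two.reflexive (≡.sym eq)) (Two.trans (c₀-parity y)
              (Two.trans (Two.reflexive (≡.cong₂ ℤ._+_ Ay≡1 (B≡1 y))) (even-double 1ℤ))))
            w-odd

        C⊛C-double′ : ∀ y → (C ⊛ C) (+ 2 ℤ.* y) ≡ w-v ℤ.* C y ℤ.+ (c ℤ.- w-v) ℤ.* δ 0ℤ y
        C⊛C-double′ y with 0ℤ ≟ y
        ... | no 0≉y = ≡.trans (C⊛C-double (0≉y ∘ sym)) (lemma (w-v ℤ.* C y) (c ℤ.- w-v))
          where
          lemma : ∀ x z → x ≡ x ℤ.+ z ℤ.* 0ℤ
          lemma = solve-∀
        ... | yes 0≈y = begin
          (C ⊛ C) (+ 2 ℤ.* y)                 ≡⟨ ⊛-congᵢ C.fn C.fn (*-congˡ {+ 2} (sym 0≈y)) ⟩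
          (C ⊛ C) 0ℤ                          ≡⟨ C.⊛-0 ⟩
          c                                   ≡⟨ lemma w-v c ⟩
          w-v ℤ.* 1ℤ ℤ.+ (c ℤ.- w-v) ℤ.* 1ℤ
            ≡⟨ ≡.cong (λ z → w-v ℤ.* z ℤ.+ (c ℤ.- w-v) ℤ.* 1ℤ) (≡.sym (A≡0⇒C≡1 (≡.trans (A.s-cong (sym 0≈y)) A-0))) ⟩
          w-v ℤ.* C y ℤ.+ (c ℤ.- w-v) ℤ.* 1ℤ  ∎
          where
          open ≡.≡-Reasoning
          lemma : ∀ w c → c ≡ w ℤ.* 1ℤ ℤ.+ (c ℤ.- w) ℤ.* 1ℤ
          lemma = solve-∀

        -- Doubling permutes ℤ/p, so the augmentation of `C ⊛ C` may be computed along `2 y`.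
        c²≡ : c ℤ.* c ≡ w-v ℤ.* c ℤ.+ (c ℤ.- w-v)
        c²≡ = begin
          c ℤ.* c                            ≡⟨ ∑-⊛ C.fn C.fn ⟨
          ∑ (C ⊛ C)                          ≡⟨ ∑-bij (scaling (2≉0 p≢2)) (C.fn ⊛ᶠ C.fn) ⟨
          ∑ (λ y → (C ⊛ C) (+ 2 ℤ.* y))      ≡⟨ ∑-cong C⊛C-double′ ⟩
          ∑ (λ y → w-v ℤ.* C y ℤ.+ (c ℤ.- w-v) ℤ.* δ 0ℤ y)
            ≡⟨ ∑-+ (λ y → w-v ℤ.* C y) (λ y → (c ℤ.- w-v) ℤ.* δ 0ℤ y) ⟩
          ∑ (λ y → w-v ℤ.* C y) ℤ.+ ∑ (λ y → (c ℤ.- w-v) ℤ.* δ 0ℤ y)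
            ≡⟨ ≡.cong₂ ℤ._+_ (∑-*ˡ w-v C) (∑-*ˡ (c ℤ.- w-v) (δ 0ℤ)) ⟨
          w-v ℤ.* c ℤ.+ (c ℤ.- w-v) ℤ.* ∑ (δ 0ℤ)
            ≡⟨ ≡.cong (λ z → w-v ℤ.* c ℤ.+ z) (≡.trans (≡.cong ((c ℤ.- w-v) ℤ.*_) ∑-δ) (ℤ.*-identityʳ (c ℤ.- w-v))) ⟩
          w-v ℤ.* c ℤ.+ (c ℤ.- w-v)          ∎
          where open ≡.≡-Reasoning

        -- As `C` contains 0, it is {0}, and the graph is complete.
        singleton : c ℤ.- 1ℤ ≡ 0ℤ → ⊥
        singleton c-1≡0 = incomplete ((λ {x} → A≡1 x) , B≡1)
          where
          le : ∀ x → δ 0ℤ x ℤ.≤ C x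
          le x with 0ℤ ≟ x
          ... | no  _   = C.0≤ x
          ... | yes 0≈x = ℤ.≤-reflexive (≡.sym (A≡0⇒C≡1 (≡.trans (A.s-cong (sym 0≈x)) A-0)))
          C≡δ : ∀ x → δ 0ℤ x ≡ C x
          C≡δ = ∑-≤-≡ δ⟨ 0ℤ ⟩ C.fn le (≡.trans ∑-δ (≡.sym (ℤ.i-j≡0⇒i≡j c 1ℤ c-1≡0)))
          A≡1 : ∀ x → ¬ (x ≈ 0ℤ) → A x ≡ 1ℤ
          A≡1 x x≉0 = [ (λ Ax≡0 → contradiction (A≡0⇒C≡1 Ax≡0)
                          (0≢1 (≡.trans (≡.sym (C≡δ x)) (δ-≉ (x≉0 ∘ sym))))) , id ]′ (A.s-01 x)

        -- A nonzero `x` in `C` would give `(C ⊛ C) (2x) = c`, making `C` invariant under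
        -- translation by `2x`, hence full, and `A` empty. So `C` contains only 0 here as well.
        translate-invariant : c ℤ.- w-v ≡ 0ℤ → ⊥
        translate-invariant c-w-v≡0 = incomplete ((λ {x} → A≡1 x) , B≡1)
          where
          A≡1 : ∀ x → ¬ (x ≈ 0ℤ) → A x ≡ 1ℤ
          A≡1 x x≉0 = [ (λ Ax≡0 → ⊥-elim (A-empty λ y → A≡0 Ax≡0 y)) , id ]′ (A.s-01 x)
            where
            module _ (Ax≡0 : A x ≡ 0ℤ) where
              C≡1 : ∀ y → C y ≡ 1ℤ
              C≡1 = C.translate-invariant⇒full (2*-≉0 x≉0) (≡.trans (C⊛C-double x≉0)
                (≡.trans (≡.cong (w-v ℤ.*_) (A≡0⇒C≡1 Ax≡0))
                (≡.trans (ℤ.*-identityʳ w-v) (≡.sym (ℤ.i-j≡0⇒i≡j c w-v c-w-v≡0)))))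
                (A≡0⇒C≡1 Ax≡0)
              A≡0 : ∀ y → A y ≡ 0ℤ
              A≡0 y = [ id , (λ Ay≡1 → contradiction (C≡1 y) (0≢1 (A≡1⇒C≡0 Ay≡1))) ]′ (A.s-01 y)

        -- The quadratic relation for `c` factors as (c - 1)(c - (w - v)) = 0.
        B-full : ⊥
        B-full = [ singleton , translate-invariant ]′
          (ℤ.i*j≡0⇒i≡0∨j≡0 (c ℤ.- 1ℤ) (≡.trans (lemma c w-v)
            (≡.trans (≡.cong (λ z → z ℤ.- (w-v ℤ.* c ℤ.+ (c ℤ.- w-v))) c²≡) (ℤ.+-inverseʳ (w-v ℤ.* c ℤ.+ (c ℤ.- w-v))))))
          where
          lemma : ∀ c w → (c ℤ.- 1ℤ) ℤ.* (c ℤ.- w) ≡ c ℤ.* c ℤ.- (w ℤ.* c ℤ.+ (c ℤ.- w))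
          lemma = solve-∀

    impossible : ⊥
    impossible = [ 2≉0 p≢2 , [ m≈0⇒⊥ , r≈0⇒⊥ ]′ ∘ *-≈0 m r ]′ (*-≈0 (+ 2) (m ℤ.* r) (∣⇒≈0 p∣2mr))
      where
      m≈0⇒⊥ : m ≈ 0ℤ → ⊥
      m≈0⇒⊥ m≈0 = [ A-empty , A-not-full ]′ (A.p∣∑⇒trivial (≈0⇒∣ m≈0))
      r≈0⇒⊥ : r ≈ 0ℤ → ⊥
      r≈0⇒⊥ r≈0 = [ B-nonempty , B-full ]′ (B.p∣∑⇒trivial (≈0⇒∣ r≈0))

  module EvenValues (even₀ : ∀ {x} → ¬ (x ≈ 0ℤ) → c₀ x Two.≈ 0ℤ) where
    private
      A≡B : ∀ {y} → ¬ (y ≈ 0ℤ) → A y ≡ B y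
      A≡B {y} y≉0 = 01-≈₂⇒≡ (A.s-01 y) (B.s-01 y) (even-sum⇒≈₂
        (Two.trans (Two.sym (c₀-parity y)) (even₀ (2*-≉0 y≉0))))

      -- `c₁` takes one of `a`, `b` at 0; `o` becomes its value everywhere else.
      other = other-value (values₁ 0ℤ)
      o : ℤ
      o = proj₁ other

    -- The graph would be complete multipartite, with parts of size 2.
    B-0≢0 : ¬ (B 0ℤ ≡ 0ℤ)
    B-0≢0 B0≡0 = ¬srg o (c₁ 0ℤ)
      ( (λ {x} x≉0 → (λ _ → c₀≡o x≉0) , (λ Ax≡0 → contradiction (A-full x≉0) (0≢1 Ax≡0)))
      , (λ x → (λ Bx≡1 → c₁≡o (A≡1⇒≉0 (≡.trans (A≗B x) Bx≡1)))
             , (λ Bx≡0 → c₁-cong (≈0 x Bx≡0))) )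
      where
      A≗B : ∀ x → A x ≡ B x
      A≗B x with x ≟ 0ℤ
      ... | no  x≉0 = A≡B x≉0
      ... | yes x≈0 = ≡.trans (A.s-cong x≈0) (≡.trans A-0 (≡.sym (≡.trans (B.s-cong x≈0) B0≡0)))

      A⊛B≡A⊛A : ∀ x → (A ⊛ B) x ≡ (A ⊛ A) x
      A⊛B≡A⊛A = ⊛-cong {f = A} (λ _ → ≡.refl) (≡.sym ∘ A≗B)

      c₁≡ : ∀ x → c₁ x ≡ (A ⊛ A) x ℤ.+ (A ⊛ A) x
      c₁≡ x = ≡.cong₂ ℤ._+_ (A⊛B≡A⊛A x) (A⊛B≡A⊛A x)

      c₀≡c₁ : ∀ x → c₀ x ≡ c₁ x
      c₀≡c₁ x = ≡.trans
        (≡.cong (λ z → (A ⊛ A) x ℤ.+ z) (⊛-cong {g = B} (≡.sym ∘ A≗B) (≡.sym ∘ A≗B) x))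
        (≡.sym (c₁≡ x))

      -- Equality would mean `(A ⊛ A) x = ∑ A`, so that `A` is invariant under translation by `x`
      -- and therefore contains 0.
      c₁≢ : ∀ {x} → ¬ (x ≈ 0ℤ) → c₁ x ≢ c₁ 0ℤ
      c₁≢ {x} x≉0 eq = A-not-full (A.translate-invariant⇒full x≉0
        (≡.trans (double-injective (≡.trans (≡.sym (c₁≡ x)) (≡.trans eq (c₁≡ 0ℤ)))) A.⊛-0)
        (proj₂ (A-nonempty (≡.sym (A≗B 0ℤ)))))

      c₁≡o : ∀ {x} → ¬ (x ≈ 0ℤ) → c₁ x ≡ o
      c₁≡o {x} x≉0 = proj₂ (proj₂ other) (values₁ x) (c₁≢ x≉0)

      c₀≡o : ∀ {x} → ¬ (x ≈ 0ℤ) → c₀ x ≡ o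
      c₀≡o {x} x≉0 = ≡.trans (c₀≡c₁ x) (c₁≡o x≉0)

      A-const : ∀ {x y} → ¬ (x ≈ 0ℤ) → ¬ (y ≈ 0ℤ) → A x ≡ A y
      A-const {x} {y} x≉0 y≉0 = 01-≈₂⇒≡ (A.s-01 x) (A.s-01 y) (Two.trans (Two.sym (A.⊛-double p≢2 x))
        (Two.trans (Two.reflexive (double-injective (≡.trans (≡.sym (c₁≡ (+ 2 ℤ.* x)))
          (≡.trans (≡.trans (c₁≡o (2*-≉0 x≉0)) (≡.sym (c₁≡o (2*-≉0 y≉0)))) (c₁≡ (+ 2 ℤ.* y))))))
        (A.⊛-double p≢2 y)))

      A-full : ∀ {x} → ¬ (x ≈ 0ℤ) → A x ≡ 1ℤ
      A-full x≉0 = let (y , Ay≡1) = A-nonempty (≡.sym (A≗B 0ℤ)) in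
        ≡.trans (A-const x≉0 (A≡1⇒≉0 Ay≡1)) Ay≡1

      ≈0 : ∀ x → B x ≡ 0ℤ → x ≈ 0ℤ
      ≈0 x Bx≡0 with x ≟ 0ℤ
      ... | yes x≈0 = x≈0
      ... | no  x≉0 = contradiction (A-full x≉0) (0≢1 (≡.trans (A≗B x) Bx≡0))

    module _ (B0≡1 : B 0ℤ ≡ 1ℤ) where
      private
        B≡ : ∀ x → B x ≡ A x ℤ.+ δ 0ℤ x
        B≡ x with 0ℤ ≟ x
        ... | no  0≉x = ≡.trans (≡.sym (A≡B (0≉x ∘ sym))) (≡.sym (ℤ.+-identityʳ (A x)))
        ... | yes 0≈x = ≡.trans (B.s-cong (sym 0≈x)) (≡.trans B0≡1
                          (≡.cong (ℤ._+ 1ℤ) (≡.sym (≡.trans (A.s-cong (sym 0≈x)) A-0))))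

        f⊛B : ∀ (f : Fn) x → (Func.to f ⊛ B) x ≡ (Func.to f ⊛ A) x ℤ.+ Func.to f x
        f⊛B f x = ≡.trans (⊛-cong {f = Func.to f} (λ _ → ≡.refl) B≡ x)
          (≡.trans (⊛-distribˡ (Func.to f) A (δ 0ℤ) x) (≡.cong (λ z → (Func.to f ⊛ A) x ℤ.+ z)
          (≡.trans (⊛-comm f δ⟨ 0ℤ ⟩ x) (⊛-identityˡ f x))))

        A⊛B≡ : ∀ x → (A ⊛ B) x ≡ (A ⊛ A) x ℤ.+ A x
        A⊛B≡ = f⊛B A.fn

        B⊛B≡ : ∀ x → (B ⊛ B) x ≡ (A ⊛ A) x ℤ.+ A x ℤ.+ B x
        B⊛B≡ x = ≡.trans (f⊛B B.fn x) (≡.cong (ℤ._+ B x) (≡.trans (⊛-comm B.fn A.fn x) (A⊛B≡ x)))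

        A⊛B-0 : (A ⊛ B) 0ℤ ≡ m
        A⊛B-0 = ≡.trans (A⊛B≡ 0ℤ) (≡.trans (≡.cong₂ ℤ._+_ A.⊛-0 A-0) (ℤ.+-identityʳ m))

        r≡m+1 : r ≡ m ℤ.+ 1ℤ
        r≡m+1 = ≡.trans (∑-cong B≡) (≡.trans (∑-+ A (δ 0ℤ)) (≡.cong (λ z → m ℤ.+ z) ∑-δ))

        ne : ∃[ y ] A y ≡ 1ℤ
        ne = A-nonempty {1ℤ} (≡.sym (A≡B (1≉0 1<p)))

        proper : ¬ (∀ {x} → ¬ (x ≈ 0ℤ) → A x ≡ 1ℤ)
        proper A≡1 = incomplete (A≡1 , B≡1)
          where
          B≡1 : ∀ x → B x ≡ 1ℤ
          B≡1 x with x ≟ 0ℤ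
          ... | yes x≈0 = ≡.trans (B.s-cong x≈0) B0≡1
          ... | no  x≉0 = ≡.trans (≡.sym (A≡B x≉0)) (A≡1 x≉0)

        -- Suppose equality. For `x` outside `A` it reads `(A ⊛ A) x = ∑ A`, so `A` would be full.
        -- For `x` in `A` it gives `(B ⊛ B) x = m + 1 = ∑ B`, so `B` would be full and the graph
        -- complete.
        A⊛B≢m : ∀ {x} → ¬ (x ≈ 0ℤ) → (A ⊛ B) x ≢ m
        A⊛B≢m {x} x≉0 eq = [ Ax≢0 , Ax≢1 ]′ (A.s-01 x)
          where
          Ax≢0 : ¬ (A x ≡ 0ℤ)
          Ax≢0 Ax≡0 = A-not-full (A.translate-invariant⇒full x≉0
            (≡.trans (≡.sym (ℤ.+-identityʳ _)) (≡.trans (≡.cong (λ z → (A ⊛ A) x ℤ.+ z) (≡.sym Ax≡0))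
              (≡.trans (≡.sym (A⊛B≡ x)) eq)))
            (proj₂ ne))
          Ax≢1 : ¬ (A x ≡ 1ℤ)
          Ax≢1 Ax≡1 = proper λ {y} y≉0 → ≡.trans (A≡B y≉0) (B.translate-invariant⇒full x≉0
            (≡.trans (B⊛B≡ x) (≡.trans (≡.cong₂ ℤ._+_ (≡.trans (≡.sym (A⊛B≡ x)) eq) (≡.trans (≡.sym (A≡B x≉0)) Ax≡1))
              (≡.sym r≡m+1)))
            B0≡1 y)

        c₁≡o : ∀ {x} → ¬ (x ≈ 0ℤ) → c₁ x ≡ o
        c₁≡o {x} x≉0 = proj₂ (proj₂ other) (values₁ x)
          λ eq → A⊛B≢m x≉0 (≡.trans (double-injective eq) A⊛B-0)

        d : ℤ
        d = (A ⊛ B) 1ℤ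

      paleyPair : IsPaleyPair p b a A B
      paleyPair = record
        { A-set    = A-set
        ; A-0      = A-0
        ; B≡A+δ    = B≡
        ; d        = d
        ; A⊛A+A≡d  = λ {x} x≉0 → ≡.trans (≡.sym (A⊛B≡ x))
                       (double-injective (≡.trans (c₁≡o x≉0) (≡.sym (c₁≡o (1≉0 1<p)))))
        ; 2∑A∈     = ≡.subst (λ z → z ℤ.+ z ≡ + a ⊎ z ℤ.+ z ≡ + b) A⊛B-0 (values₁ 0ℤ)
        ; 2d∈      = values₁ 1ℤ
        ; 2d≢2∑A   = λ eq → A⊛B≢m (1≉0 1<p) (double-injective eq)
        ; nonempty = ne
        ; proper   = proper
        }

  dezaPair⇒paleyPair : IsPaleyPair p b a A B
  dezaPair⇒paleyPair = byParity (+ a Two.≟ 0ℤ) (+ b Two.≟ 0ℤ)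
    where
    byParity : Dec (+ a Two.≈ 0ℤ) → Dec (+ b Two.≈ 0ℤ) → IsPaleyPair p b a A B
    byParity (yes a-even) (yes b-even) = [ ⊥-elim ∘ B-0≢0 , paleyPair ]′ (B.s-01 0ℤ)
      where
      open EvenValues (λ x≉0 → [ (λ eq → Two.trans (Two.reflexive eq) a-even)
                               , (λ eq → Two.trans (Two.reflexive eq) b-even) ]′ (values₀ x≉0))
    byParity (yes a-even) (no b-odd) = ⊥-elim (OppositeParity.impossible (+ a) (+ b) a-even b-odd values₀ values₁)
    byParity (no a-odd) (yes b-even) = ⊥-elim (OppositeParity.impossible (+ b) (+ a) b-even a-odd
      (Sum.swap ∘ values₀) (Sum.swap ∘ values₁))
    -- `c₁` is twice a convolution, so it takes no odd value.
    byParity (no a-odd) (no b-odd) = ⊥-elim ([ (λ eq → a-odd (Two.trans (Two.reflexive (≡.sym eq)) c₁-even))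
                                             , (λ eq → b-odd (Two.trans (Two.reflexive (≡.sym eq)) c₁-even)) ]′ (values₁ 0ℤ))
      where
      c₁-even : c₁ 0ℤ Two.≈ 0ℤ
      c₁-even = even-double ((A ⊛ B) 0ℤ)

-- Pairs with A ⊛ A + A constant off 0

-- Recursion in steps of two, so that a power with this exponent unfolds into two factors at a time;
-- `U⊛U⊛` and the cube of a sign then apply directly.
1+2* : ℕ → ℕ
1+2* zero    = 1
1+2* (suc h) = suc (suc (1+2* h))

odd-or-even : ∀ n → (∃[ h ] n ≡ 1+2* h) ⊎ 2 ℕ∣.∣ n
odd-or-even zero          = inj₂ (ℕ∣.divides 0 ≡.refl)
odd-or-even (suc zero)    = inj₁ (0 , ≡.refl)
odd-or-even (suc (suc n)) = Sum.map (λ (h , eq) → suc h , ≡.cong (2 ℕ.+_) eq)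
  (λ { (ℕ∣.divides c eq) → ℕ∣.divides (suc c) (≡.cong (2 ℕ.+_) eq) }) (odd-or-even n)

IsSign : ℤ → Set
IsSign x = x ≡ 0ℤ ⊎ x ≡ 1ℤ ⊎ x ≡ ℤ.- 1ℤ

IsSign-* : ∀ {x y} → IsSign x → IsSign y → IsSign (x ℤ.* y)
IsSign-* (inj₁ ≡.refl)        _                      = inj₁ ≡.refl
IsSign-* (inj₂ (inj₁ ≡.refl)) (inj₁ ≡.refl)          = inj₁ ≡.refl
IsSign-* (inj₂ (inj₁ ≡.refl)) (inj₂ (inj₁ ≡.refl))   = inj₂ (inj₁ ≡.refl)
IsSign-* (inj₂ (inj₁ ≡.refl)) (inj₂ (inj₂ ≡.refl))   = inj₂ (inj₂ ≡.refl)
IsSign-* (inj₂ (inj₂ ≡.refl)) (inj₁ ≡.refl)          = inj₁ ≡.refl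
IsSign-* (inj₂ (inj₂ ≡.refl)) (inj₂ (inj₁ ≡.refl))   = inj₂ (inj₂ ≡.refl)
IsSign-* (inj₂ (inj₂ ≡.refl)) (inj₂ (inj₂ ≡.refl))   = inj₂ (inj₁ ≡.refl)

-- Two distinct signs differ by at most 2.
IsSign-≡ : ∀ {q x y} → 2 ℕ.< q → IsSign x → IsSign y → + q ∣ x ℤ.- y → x ≡ y
IsSign-≡ {q} 2<q = λ
  { (inj₁ ≡.refl)        (inj₁ ≡.refl)        _ → ≡.refl
  ; (inj₁ ≡.refl)        (inj₂ (inj₁ ≡.refl)) d → ⊥-elim (small (ℕ.s≤s ℕ.z≤n) d)
  ; (inj₁ ≡.refl)        (inj₂ (inj₂ ≡.refl)) d → ⊥-elim (small (ℕ.s≤s ℕ.z≤n) d)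
  ; (inj₂ (inj₁ ≡.refl)) (inj₁ ≡.refl)        d → ⊥-elim (small (ℕ.s≤s ℕ.z≤n) d)
  ; (inj₂ (inj₁ ≡.refl)) (inj₂ (inj₁ ≡.refl)) _ → ≡.refl
  ; (inj₂ (inj₁ ≡.refl)) (inj₂ (inj₂ ≡.refl)) d → ⊥-elim (small (ℕ.s≤s (ℕ.s≤s ℕ.z≤n)) d)
  ; (inj₂ (inj₂ ≡.refl)) (inj₁ ≡.refl)        d → ⊥-elim (small (ℕ.s≤s ℕ.z≤n) d)
  ; (inj₂ (inj₂ ≡.refl)) (inj₂ (inj₁ ≡.refl)) d → ⊥-elim (small (ℕ.s≤s (ℕ.s≤s ℕ.z≤n)) d)
  ; (inj₂ (inj₂ ≡.refl)) (inj₂ (inj₂ ≡.refl)) _ → ≡.refl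
  }
  where
  small : ∀ {z} → .{{_ : ℕ.NonZero ℤ.∣ z ∣}} → ℤ.∣ z ∣ ℕ.≤ 2 → + q ∣ z → ⊥
  small z≤2 d = ℕ.<⇒≱ 2<q (ℕ.≤-trans (ℕ∣.∣⇒≤ (ℤ∣.∣⇒∣ᵤ d)) z≤2)

module _ (R : CommutativeRing 0ℓ 0ℓ) where
  open CommutativeRing R
  open SemiringSolver commutativeSemiring

  -- To be used with `e` the unit and `j` the constant function -1, which avoids subtraction and
  -- leaves a semiring identity. The terms are grouped around `w` because `A ⊛ A + A` is what is
  -- known off 0.
  square-expand : ∀ a e j →
    let w = a * a + a * e in
    (a + a + e + j) * (a + a + e + j) ≈
    w + w + (w + w) + e * e + (a * j + a * j + (a * j + a * j) + (e * j + e * j)) + j * j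
  square-expand = solve 3 (λ a e j →
    let w = a :* a :+ a :* e in
    (a :+ a :+ e :+ j) :* (a :+ a :+ e :+ j) :=
    w :+ w :+ (w :+ w) :+ e :* e :+ (a :* j :+ a :* j :+ (a :* j :+ a :* j) :+ (e :* j :+ e :* j)) :+ j :* j)
    refl

-- The sign function U and its odd powers

module PaleyPairs (p : ℕ) .{{_ : ℕ.NonZero p}} (p-prime : Prime p) (p≢2 : p ≢ 2)
  {b a : ℕ} {A B : ℤ → ℤ} (pair : IsPaleyPair p b a A B) where
  open SymmetricSets p p-prime
  open IsPaleyPair pair
  open Func
  private
    module A where
      open IsSymmetricSet A-set public
      open SymmetricSet A-set public
    module R where
      open CommutativeRing groupRing public
      open Exp semiring public

    -- The square of `2A + δ` is 4m + 1 at 0 and 4d elsewhere, and `N` is the difference. With J the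
    -- all-one function, the products with -J add -2(2m + 1) + p everywhere, which together with 4d
    -- makes `c`.
    m N c : ℤ
    m = ∑ A
    N = + 4 ℤ.* m ℤ.+ 1ℤ ℤ.- + 4 ℤ.* d
    c = + 4 ℤ.* d ℤ.- + 4 ℤ.* m ℤ.- + 2 ℤ.+ + p

    -1ᶠ : Fn
    -1ᶠ = record { to = λ _ → ℤ.- 1ℤ ; cong = λ _ → ≡.refl }

    f⊛-1 : ∀ (f : Fn) x → (to f ⊛ to -1ᶠ) x ≡ ℤ.- ∑ (to f)
    f⊛-1 f x = ≡.trans (≡.sym (∑-*ʳ (ℤ.- 1ℤ) (to f))) (lemma (∑ (to f)))
      where
      lemma : ∀ x → x ℤ.* (ℤ.- 1ℤ) ≡ ℤ.- x
      lemma = solve-∀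

    -- The values of U off 0 are ±1; up to sign, U is the Legendre symbol.
    U : Fn
    U = A.fn R.+ A.fn R.+ R.1# R.+ -1ᶠ

    U-0 : ∀ {x} → x ≈ 0ℤ → to U x ≡ 0ℤ
    U-0 {x} x≈0 = ≡.cong₂ (λ y z → y ℤ.+ y ℤ.+ z ℤ.- 1ℤ) (≡.trans (A.s-cong x≈0) A-0) (δ-≈ (sym x≈0))

    U-≉ : ∀ {x} → ¬ (x ≈ 0ℤ) → to U x ≡ A x ℤ.+ A x ℤ.- 1ℤ
    U-≉ {x} x≉0 = ≡.trans (≡.cong (λ z → A x ℤ.+ A x ℤ.+ z ℤ.- 1ℤ) (δ-≉ (x≉0 ∘ sym)))
      (≡.cong (ℤ._- 1ℤ) (ℤ.+-identityʳ (A x ℤ.+ A x)))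

    U-1 : ∀ {x} → ¬ (x ≈ 0ℤ) → A x ≡ 1ℤ → to U x ≡ 1ℤ
    U-1 x≉0 eq = ≡.trans (U-≉ x≉0) (≡.cong (λ z → z ℤ.+ z ℤ.- 1ℤ) eq)

    U--1 : ∀ {x} → ¬ (x ≈ 0ℤ) → A x ≡ 0ℤ → to U x ≡ ℤ.- 1ℤ
    U--1 x≉0 eq = ≡.trans (U-≉ x≉0) (≡.cong (λ z → z ℤ.+ z ℤ.- 1ℤ) eq)

    U-sign : ∀ x → IsSign (to U x)
    U-sign x with x ≟ 0ℤ
    ... | yes x≈0 = inj₁ (U-0 x≈0)
    ... | no  x≉0 = inj₂ (Sum.swap (Sum.map (U--1 x≉0) (U-1 x≉0) (A.s-01 x)))

    U² : ∀ {x} → ¬ (x ≈ 0ℤ) → to U x ℤ.* to U x ≡ 1ℤ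
    U² {x} x≉0 = [ (λ eq → ≡.cong (λ u → u ℤ.* u) (U--1 x≉0 eq))
                 , (λ eq → ≡.cong (λ u → u ℤ.* u) (U-1 x≉0 eq)) ]′ (A.s-01 x)

    -- The convolution square of 2A + δ is 4 (A ⊛ A + A) + δ.
    U⊛U-expand : ∀ x → (to U ⊛ to U) x ≡
      + 4 ℤ.* ((A ⊛ A) x ℤ.+ A x) ℤ.+ δ 0ℤ x ℤ.- (+ 4 ℤ.* m ℤ.+ + 2) ℤ.+ + p
    U⊛U-expand x = ≡.trans (square-expand groupRing A.fn R.1# -1ᶠ x)
      (values {aa = (A ⊛ A) x} {m = m} {+ p} (R.*-identityʳ A.fn x) (R.*-identityʳ R.1# x) (f⊛-1 A.fn x)
        (≡.trans (f⊛-1 R.1# x) (≡.cong ℤ.-_ ∑-δ))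
        (≡.trans (f⊛-1 -1ᶠ x) (≡.trans (≡.cong ℤ.-_ (∑-const (ℤ.- 1ℤ))) (lemma₁ (+ p)))))
      where
      lemma₁ : ∀ p → ℤ.- (p ℤ.* (ℤ.- 1ℤ)) ≡ p
      lemma₁ = solve-∀
      lemma : ∀ w e m p → w ℤ.+ w ℤ.+ (w ℤ.+ w) ℤ.+ e ℤ.+
        (ℤ.- m ℤ.+ ℤ.- m ℤ.+ (ℤ.- m ℤ.+ ℤ.- m) ℤ.+ (ℤ.- 1ℤ ℤ.+ ℤ.- 1ℤ)) ℤ.+ p ≡
        + 4 ℤ.* w ℤ.+ e ℤ.- (+ 4 ℤ.* m ℤ.+ + 2) ℤ.+ p
      lemma = solve-∀
      values : ∀ {aa ae ee aj ej jj a e m p} → ae ≡ a → ee ≡ e → aj ≡ ℤ.- m → ej ≡ ℤ.- 1ℤ → jj ≡ p →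
        let w = aa ℤ.+ ae in
        w ℤ.+ w ℤ.+ (w ℤ.+ w) ℤ.+ ee ℤ.+ (aj ℤ.+ aj ℤ.+ (aj ℤ.+ aj) ℤ.+ (ej ℤ.+ ej)) ℤ.+ jj ≡
        + 4 ℤ.* (aa ℤ.+ a) ℤ.+ e ℤ.- (+ 4 ℤ.* m ℤ.+ + 2) ℤ.+ p
      values {aa} {ae} {ee} {jj = jj} {m = m} ≡.refl ≡.refl ≡.refl ≡.refl ≡.refl = lemma (aa ℤ.+ ae) ee m jj

    U⊛U : ∀ x → (to U ⊛ to U) x ≡ N ℤ.* δ 0ℤ x ℤ.+ c
    U⊛U x = ≡.trans (U⊛U-expand x) (byCases (x ≟ 0ℤ))
      where
      lemma₀ : ∀ d m p → + 4 ℤ.* (m ℤ.+ 0ℤ) ℤ.+ 1ℤ ℤ.- (+ 4 ℤ.* m ℤ.+ + 2) ℤ.+ p ≡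
        (+ 4 ℤ.* m ℤ.+ 1ℤ ℤ.- + 4 ℤ.* d) ℤ.* 1ℤ ℤ.+ (+ 4 ℤ.* d ℤ.- + 4 ℤ.* m ℤ.- + 2 ℤ.+ p)
      lemma₀ = solve-∀
      lemma₁ : ∀ d m p → + 4 ℤ.* d ℤ.+ 0ℤ ℤ.- (+ 4 ℤ.* m ℤ.+ + 2) ℤ.+ p ≡
        (+ 4 ℤ.* m ℤ.+ 1ℤ ℤ.- + 4 ℤ.* d) ℤ.* 0ℤ ℤ.+ (+ 4 ℤ.* d ℤ.- + 4 ℤ.* m ℤ.- + 2 ℤ.+ p)
      lemma₁ = solve-∀
      value : ∀ {w e w′ e′ : ℤ} → w ≡ w′ → e ≡ e′ →
        + 4 ℤ.* w′ ℤ.+ e′ ℤ.- (+ 4 ℤ.* m ℤ.+ + 2) ℤ.+ + p ≡ N ℤ.* e′ ℤ.+ c →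
        + 4 ℤ.* w ℤ.+ e ℤ.- (+ 4 ℤ.* m ℤ.+ + 2) ℤ.+ + p ≡ N ℤ.* e ℤ.+ c
      value ≡.refl ≡.refl eq = eq
      byCases : Dec (x ≈ 0ℤ) → + 4 ℤ.* ((A ⊛ A) x ℤ.+ A x) ℤ.+ δ 0ℤ x ℤ.- (+ 4 ℤ.* m ℤ.+ + 2) ℤ.+ + p ≡ N ℤ.* δ 0ℤ x ℤ.+ c
      byCases (yes x≈0) = value {w = (A ⊛ A) x ℤ.+ A x} {δ 0ℤ x} {m ℤ.+ 0ℤ} {1ℤ}
        (≡.cong₂ ℤ._+_ (≡.trans (⊛-congᵢ A.fn A.fn x≈0) A.⊛-0) (≡.trans (A.s-cong x≈0) A-0))
        (δ-≈ (sym x≈0)) (lemma₀ d m (+ p))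
      byCases (no x≉0) = value {w = (A ⊛ A) x ℤ.+ A x} {δ 0ℤ x} {d} {0ℤ}
        (A⊛A+A≡d x≉0) (δ-≉ (x≉0 ∘ sym)) (lemma₁ d m (+ p))

    U⊛U⊛ : ∀ (f : Fn) x → to (U R.* (U R.* f)) x ≡ N ℤ.* to f x ℤ.+ c ℤ.* ∑ (to f)
    U⊛U⊛ f x = begin
      to (U R.* (U R.* f)) x                               ≡⟨ ⊛-assoc U U f x ⟨
      ((to U ⊛ to U) ⊛ to f) x                             ≡⟨ ⊛-cong {g = to f} U⊛U (λ _ → ≡.refl) x ⟩
      ((λ y → N ℤ.* δ 0ℤ y ℤ.+ c) ⊛ to f) x
        ≡⟨ ⊛-distribʳ (to f) (λ y → N ℤ.* δ 0ℤ y) (λ _ → c) x ⟩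
      ∑ (λ y → N ℤ.* δ 0ℤ y ℤ.* to f (x ℤ.- y)) ℤ.+ ∑ (λ y → c ℤ.* to f (x ℤ.- y))
        ≡⟨ ≡.cong₂ ℤ._+_
             (≡.trans (∑-cong λ y → ℤ.*-assoc N (δ 0ℤ y) (to f (x ℤ.- y)))
                      (≡.sym (∑-*ˡ N (λ y → δ 0ℤ y ℤ.* to f (x ℤ.- y)))))
             (≡.sym (∑-*ˡ c (λ y → to f (x ℤ.- y)))) ⟩
      N ℤ.* (δ 0ℤ ⊛ to f) x ℤ.+ c ℤ.* ∑ (λ y → to f (x ℤ.- y))
        ≡⟨ ≡.cong₂ (λ y z → N ℤ.* y ℤ.+ c ℤ.* z) (⊛-identityˡ f x) (∑-bij (reflection x) f) ⟩
      N ℤ.* to f x ℤ.+ c ℤ.* ∑ (to f)                      ∎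
      where open ≡.≡-Reasoning

    -- The constant `c′` can stay implicit: `U-mod-q` finds it by evaluation at 0, and `N≈0` cancels
    -- it by subtracting two values.
    U^odd : ∀ h → ∃[ c′ ] (∀ x → to (U R.^ 1+2* h) x ≡ N ℤ.^ h ℤ.* to U x ℤ.+ c′)
    U^odd zero    = 0ℤ , λ x → ≡.trans (R.*-identityʳ U x) (lemma (to U x))
      where
      lemma : ∀ u → u ≡ 1ℤ ℤ.* u ℤ.+ 0ℤ
      lemma = solve-∀
    U^odd (suc h) = let (c′ , eq) = U^odd h in N ℤ.* c′ ℤ.+ c ℤ.* ∑ (to (U R.^ 1+2* h)) , λ x →
      ≡.trans (U⊛U⊛ (U R.^ 1+2* h) x) (≡.trans
        (≡.cong (λ z → N ℤ.* z ℤ.+ c ℤ.* ∑ (to (U R.^ 1+2* h))) (eq x))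
        (lemma N (N ℤ.^ h) (to U x) c′ (c ℤ.* ∑ (to (U R.^ 1+2* h)))))
      where
      lemma : ∀ n n′ u c s → n ℤ.* (n′ ℤ.* u ℤ.+ c) ℤ.+ s ≡ n ℤ.* n′ ℤ.* u ℤ.+ (n ℤ.* c ℤ.+ s)
      lemma = solve-∀

  -- Powers of U modulo a prime

  module ModPrime {q : ℕ} (q-prime : Prime q) (h : ℕ) (q≡ : q ≡ 1+2* h) where
    c′ : ℤ
    c′ = proj₁ (U^odd h)

    private
      module F = CommutativeRing (ℤ/ q)
      module Rq = Exp (CommutativeRing.semiring (GroupRing.groupRing p (ℤ/ q)))
      module Fq = Exp (CommutativeRing.semiring (ℤ/ q))
      module Frob = GroupRingFrobenius p (ℤ/ q) q-prime (char-ℤ/ q)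

      Uq : GroupRing.Fn p (ℤ/ q)
      Uq = record { to = to U ; cong = λ e → F.reflexive (cong U e) }

      -- Both powers are computed by the same operations on ℤ, so they are equal as integers, not
      -- merely modulo `q`.
      ^-transfer : ∀ n x → to (Uq Rq.^ n) x ≡ to (U R.^ n) x
      ^-transfer zero    x = ≡.refl
      ^-transfer (suc n) x = ∑-cong λ y → ≡.cong (λ z → to U y ℤ.* z) (^-transfer n (x ℤ.- y))

      U^q : ∀ x → to (Uq Rq.^ q) x ≡ N ℤ.^ h ℤ.* to U x ℤ.+ c′
      U^q x = ≡.trans (^-transfer q x) (≡.trans (≡.cong (λ n → to (U R.^ n) x) q≡) (proj₂ (U^odd h) x))

      sign-^ : ∀ {u} → IsSign u → ∀ h → u Fq.^ 1+2* h ≡ u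
      sign-^ {u} u-sign zero    = ℤ.*-identityʳ u
      sign-^ {u} u-sign (suc h) = ≡.trans (≡.cong (λ z → u ℤ.* (u ℤ.* z)) (sign-^ u-sign h)) (cube u-sign)
        where
        cube : ∀ {u} → IsSign u → u ℤ.* (u ℤ.* u) ≡ u
        cube (inj₁ ≡.refl)        = ≡.refl
        cube (inj₂ (inj₁ ≡.refl)) = ≡.refl
        cube (inj₂ (inj₂ ≡.refl)) = ≡.refl

    -- The coefficient of the `q`-th power at `q x` is `N ^ h * U (q x) + c′` by `U^odd` and U(x)^q
    -- = U(x) by Frobenius. At `x = 0` both values of `U` vanish, hence so does `c′` modulo `q`.
    U-mod-q : ¬ (+ q ≈ 0ℤ) → ∀ x → N ℤ.^ h ℤ.* to U (+ q ℤ.* x) F.≈ to U x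
    U-mod-q q≉0 x = F.trans (F.reflexive (lemma (N ℤ.^ h ℤ.* to U (+ q ℤ.* x)) c′))
      (F.trans (F.+-cong (U-mod x) (F.-‿cong c′≈0)) (F.reflexive (ℤ.+-identityʳ (to U x))))
      where
      lemma : ∀ y c → y ≡ y ℤ.+ c ℤ.- c
      lemma = solve-∀
      U-mod : ∀ x → N ℤ.^ h ℤ.* to U (+ q ℤ.* x) ℤ.+ c′ F.≈ to U x
      U-mod x = F.trans (F.reflexive (≡.sym (U^q (+ q ℤ.* x))))
        (F.trans (Frob.frobenius-invertible (*-cancelˡ-≈ (+ q) q≉0) Uq x)
        (F.reflexive (≡.trans (≡.cong (to U x Fq.^_) q≡) (sign-^ (U-sign x) h))))
      c′≈0 : c′ F.≈ 0ℤ
      c′≈0 = F.trans (F.reflexive (≡.sym (≡.trans (≡.cong (ℤ._+ c′) (≡.trans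
          (≡.cong (λ z → N ℤ.^ h ℤ.* z) (U-0 (reflexive (ℤ.*-zeroʳ (+ q))))) (ℤ.*-zeroʳ (N ℤ.^ h))))
          (ℤ.+-identityˡ c′))))
        (F.trans (U-mod 0ℤ) (F.reflexive (U-0 refl)))

    U-mod-p : + q ≈ 0ℤ → ∀ {x} → ¬ (x ≈ 0ℤ) → N ℤ.^ h ℤ.* to U x ℤ.+ c′ F.≈ 0ℤ
    U-mod-p q≈0 {x} x≉0 = F.trans (F.reflexive (≡.sym (U^q x))) (Frob.frobenius-zero q≈0 Uq x≉0)

  -- The size of A and the parameters

  private
    oddPrime : ∀ {q} → Prime q → q ≢ 2 → ∃[ h ] q ≡ 1+2* h
    oddPrime {q} q-prime q≢2 = [ id , (λ 2∣q → ⊥-elim ([ (λ ()) , q≢2 ∘ ≡.sym ]′ (prime⇒irreducible q-prime 2∣q))) ]′ (odd-or-even q)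

    p≈0 : + p ≈ 0ℤ
    p≈0 = ∣⇒≈0 ℤ∣.∣-refl

    ^≈0⇒≈0 : ∀ x h → x ℤ.^ h ≈ 0ℤ → x ≈ 0ℤ
    ^≈0⇒≈0 x zero    1≈0   = contradiction 1≈0 (1≉0 1<p)
    ^≈0⇒≈0 x (suc h) xxʰ≈0 = [ id , ^≈0⇒≈0 x h ]′ (*-≈0 x (x ℤ.^ h) xxʰ≈0)

    -- `U` takes the value 1 by `nonempty` and -1 off 0 by `proper`. Subtracting `U-mod-p` at two
    -- such places gives 2 N^h = 0 modulo p. As `proper` names no place with value -1, the argument
    -- is by contradiction, using that congruence is decidable.
    N≈0 : N ≈ 0ℤ
    N≈0 = decidable-stable (N ≟ 0ℤ) λ N≉0 → proper λ {x} x≉0 →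
      [ (λ Ax≡0 → contradiction (impossible x≉0 Ax≡0) N≉0) , id ]′ (A.s-01 x)
      where
      h = proj₁ (oddPrime p-prime p≢2)
      n = N ℤ.^ h
      open ModPrime p-prime h (proj₂ (oddPrime p-prime p≢2))
      y = proj₁ nonempty
      Ay≡1 = proj₂ nonempty
      y≉0 : ¬ (y ≈ 0ℤ)
      y≉0 y≈0 = 0≢1 (≡.trans (A.s-cong y≈0) A-0) Ay≡1
      lemma : ∀ n c → + 2 ℤ.* n ≡ n ℤ.* 1ℤ ℤ.+ c ℤ.- (n ℤ.* (ℤ.- 1ℤ) ℤ.+ c)
      lemma = solve-∀
      value : ∀ {x u} → to U x ≡ u → n ℤ.* u ≡ n ℤ.* to U x
      value eq = ≡.cong (n ℤ.*_) (≡.sym eq)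
      impossible : ∀ {x} → ¬ (x ≈ 0ℤ) → A x ≡ 0ℤ → N ≈ 0ℤ
      impossible {x} x≉0 Ax≡0 = ^≈0⇒≈0 N h ([ (λ 2≈0 → contradiction 2≈0 (2≉0 p≢2)) , id ]′ (*-≈0 (+ 2) n
        (trans (reflexive (lemma n c′)) (trans (+-cong
          (trans (reflexive (≡.cong (ℤ._+ c′) (value (U-1 y≉0 Ay≡1)))) (U-mod-p p≈0 y≉0))
          (-‿cong (trans (reflexive (≡.cong (ℤ._+ c′) (value (U--1 x≉0 Ax≡0)))) (U-mod-p p≈0 x≉0))))
          refl))))

    ∑U : ∑ (to U) ≡ m ℤ.+ m ℤ.+ 1ℤ ℤ.- + p
    ∑U = begin
      ∑ (to U)                                          ≡⟨ ∑-+ (λ x → A x ℤ.+ A x ℤ.+ δ 0ℤ x) (λ _ → ℤ.- 1ℤ) ⟩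
      ∑ (λ x → A x ℤ.+ A x ℤ.+ δ 0ℤ x) ℤ.+ ∑ (λ _ → ℤ.- 1ℤ)
        ≡⟨ ≡.cong₂ ℤ._+_ (≡.trans (∑-+ (λ x → A x ℤ.+ A x) (δ 0ℤ)) (≡.cong₂ ℤ._+_ (∑-+ A A) ∑-δ))
             (≡.trans (∑-const (ℤ.- 1ℤ)) (lemma (+ p))) ⟩
      m ℤ.+ m ℤ.+ 1ℤ ℤ.- + p                            ∎
      where
      open ≡.≡-Reasoning
      lemma : ∀ p → p ℤ.* (ℤ.- 1ℤ) ≡ ℤ.- p
      lemma = solve-∀

    ∑-δ-form : ∀ u v → ∑ (λ x → u ℤ.* δ 0ℤ x ℤ.+ v) ≡ u ℤ.+ + p ℤ.* v
    ∑-δ-form u v = ≡.trans (∑-+ (λ x → u ℤ.* δ 0ℤ x) (λ _ → v)) (≡.cong₂ ℤ._+_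
      (≡.trans (≡.sym (∑-*ˡ u (δ 0ℤ))) (≡.trans (≡.cong (u ℤ.*_) ∑-δ) (ℤ.*-identityʳ u))) (∑-const v))

    ∑U² : ∑ (to U) ℤ.* ∑ (to U) ≡ N ℤ.+ + p ℤ.* c
    ∑U² = ≡.trans (≡.sym (∑-⊛ U U)) (≡.trans (∑-cong U⊛U) (∑-δ-form N c))

    -- The augmentation of `U ⊛ U` shows that the square of `∑ U = 2m + 1 - p` is `N + p c`, a
    -- multiple of p.
    2m+1≈0 : m ℤ.+ m ℤ.+ 1ℤ ≈ 0ℤ
    2m+1≈0 = trans (reflexive (lemma (m ℤ.+ m ℤ.+ 1ℤ) (+ p))) (trans (+-cong
      (trans (reflexive (≡.sym ∑U)) ([ id , id ]′ (*-≈0 (∑ (to U)) (∑ (to U)) s²≈0))) p≈0) refl)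
      where
      lemma : ∀ x p → x ≡ x ℤ.- p ℤ.+ p
      lemma = solve-∀
      s²≈0 : ∑ (to U) ℤ.* ∑ (to U) ≈ 0ℤ
      s²≈0 = trans (reflexive ∑U²) (+-cong N≈0 (trans (*-congʳ {c} p≈0) (reflexive (ℤ.*-zeroˡ c))))

    m≢0 : m ≢ 0ℤ
    m≢0 m≡0 = 0≢1 (A.∑≡0⇒empty m≡0 (proj₁ nonempty)) (proj₂ nonempty)

    m≢p : m ≢ + p
    m≢p m≡p = 0≢1 A-0 (A.∑≡p⇒full m≡p 0ℤ)

    -- For `μ < p` the number 1 + 2μ is positive and below 2p.
    p∣1+2μ : ∀ {μ} → μ ℕ.< p → p ℕ∣.∣ 1 ℕ.+ (μ ℕ.+ μ) → p ≡ 1 ℕ.+ (μ ℕ.+ μ)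
    p∣1+2μ {μ} μ<p (ℕ∣.divides 1 eq)             = ≡.sym (≡.trans eq (ℕ.*-identityˡ p))
    p∣1+2μ {μ} μ<p (ℕ∣.divides (suc (suc j)) eq) = contradiction
      (≡.subst (p ℕ.+ p ℕ.≤_) (≡.sym eq) (ℕ.+-monoʳ-≤ p (ℕ.m≤m+n p (j ℕ.* p))))
      (ℕ.<⇒≱ (ℕ.+-mono-≤-< μ<p μ<p))

  halfOrder : ∃[ μ ] (∑ A ≡ + μ × p ≡ 1 ℕ.+ (μ ℕ.+ μ))
  halfOrder = go m ≡.refl A.0≤∑ A.∑≤p
    where
    go : ∀ z → z ≡ m → 0ℤ ℤ.≤ z → z ℤ.≤ + p → ∃[ μ ] (z ≡ + μ × p ≡ 1 ℕ.+ (μ ℕ.+ μ))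
    go (+ μ) eq _ μ≤p = μ , ≡.refl , p∣1+2μ (ℕ.≤∧≢⇒< (ℤ.drop‿+≤+ μ≤p) (λ μ≡p → m≢p (≡.trans (≡.sym eq) (≡.cong +_ μ≡p))))
      (≡.subst (p ℕ∣.∣_) (ℕ.+-comm (μ ℕ.+ μ) 1)
        (ℤ∣.∣⇒∣ᵤ (≈0⇒∣ (≡.subst (λ z → z ℤ.+ z ℤ.+ 1ℤ ≈ 0ℤ) (≡.sym eq) 2m+1≈0))))

  private
    μ : ℕ
    μ = proj₁ halfOrder

    m≡μ : m ≡ + μ
    m≡μ = proj₁ (proj₂ halfOrder)

    p≡1+2m : + p ≡ 1ℤ ℤ.+ (m ℤ.+ m)
    p≡1+2m = ≡.trans (≡.cong +_ (proj₂ (proj₂ halfOrder))) (≡.cong (λ z → 1ℤ ℤ.+ (z ℤ.+ z)) (≡.sym m≡μ))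

  -- Sum `A ⊛ A + A` over ℤ/p: the left side gives m² + m, the right side `m` at 0 and `d` at each
  -- of the 2m other places. Then cancel `m ≠ 0`.
  2d≡m : d ℤ.+ d ≡ m
  2d≡m = ≡.sym (ℤ.*-cancelˡ-≡ m m (d ℤ.+ d) {{ℤ.≢-nonZero m≢0}} (begin
    m ℤ.* m                                ≡⟨ lemma₁ (m ℤ.* m) m ⟩
    m ℤ.* m ℤ.+ m ℤ.- m                    ≡⟨ ≡.cong (λ z → z ℤ.+ m ℤ.- m) (∑-⊛ A.fn A.fn) ⟨
    ∑ (A ⊛ A) ℤ.+ m ℤ.- m                  ≡⟨ ≡.cong (ℤ._- m) (∑-+ (A ⊛ A) A) ⟨
    ∑ (λ x → (A ⊛ A) x ℤ.+ A x) ℤ.- m      ≡⟨ ≡.cong (ℤ._- m) (∑-cong pointwise) ⟩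
    ∑ (λ x → (m ℤ.- d) ℤ.* δ 0ℤ x ℤ.+ d) ℤ.- m  ≡⟨ ≡.cong (ℤ._- m) (∑-δ-form (m ℤ.- d) d) ⟩
    m ℤ.- d ℤ.+ + p ℤ.* d ℤ.- m            ≡⟨ ≡.cong (λ z → m ℤ.- d ℤ.+ z ℤ.* d ℤ.- m) p≡1+2m ⟩
    m ℤ.- d ℤ.+ (1ℤ ℤ.+ (m ℤ.+ m)) ℤ.* d ℤ.- m  ≡⟨ lemma₂ m d ⟩
    m ℤ.* (d ℤ.+ d)                        ∎))
    where
    open ≡.≡-Reasoning
    lemma₁ : ∀ x m → x ≡ x ℤ.+ m ℤ.- m
    lemma₁ = solve-∀
    lemma₂ : ∀ m d → m ℤ.- d ℤ.+ (1ℤ ℤ.+ (m ℤ.+ m)) ℤ.* d ℤ.- m ≡ m ℤ.* (d ℤ.+ d)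
    lemma₂ = solve-∀
    lemma₃ : ∀ m d → m ≡ (m ℤ.- d) ℤ.* 1ℤ ℤ.+ d
    lemma₃ = solve-∀
    lemma₄ : ∀ u d → d ≡ u ℤ.* 0ℤ ℤ.+ d
    lemma₄ = solve-∀
    value : ∀ {y z e e′} → y ≡ z → e ≡ e′ → z ≡ (m ℤ.- d) ℤ.* e′ ℤ.+ d → y ≡ (m ℤ.- d) ℤ.* e ℤ.+ d
    value ≡.refl ≡.refl eq = eq
    pointwise : ∀ x → (A ⊛ A) x ℤ.+ A x ≡ (m ℤ.- d) ℤ.* δ 0ℤ x ℤ.+ d
    pointwise x = byCases (x ≟ 0ℤ)
      where
      byCases : Dec (x ≈ 0ℤ) → (A ⊛ A) x ℤ.+ A x ≡ (m ℤ.- d) ℤ.* δ 0ℤ x ℤ.+ d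
      byCases (yes x≈0) = value {e = δ 0ℤ x} {1ℤ}
        (≡.trans (≡.cong₂ ℤ._+_ (≡.trans (⊛-congᵢ A.fn A.fn x≈0) A.⊛-0) (≡.trans (A.s-cong x≈0) A-0)) (ℤ.+-identityʳ m))
        (δ-≈ (sym x≈0)) (lemma₃ m d)
      byCases (no x≉0) = value {e = δ 0ℤ x} {0ℤ} (A⊛A+A≡d x≉0) (δ-≉ (x≉0 ∘ sym)) (lemma₄ (m ℤ.- d) d)

  parameters : a ℕ.≤ b → a ≡ μ × b ≡ μ ℕ.+ μ
  parameters a≤b = go 2d∈ 2∑A∈
    where
    2d≡⇒ : ∀ {z} → d ℤ.+ d ≡ + z → z ≡ μ
    2d≡⇒ eq = ℤ.+-injective (≡.trans (≡.sym eq) (≡.trans 2d≡m m≡μ))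
    2m≡⇒ : ∀ {z} → m ℤ.+ m ≡ + z → z ≡ μ ℕ.+ μ
    2m≡⇒ eq = ℤ.+-injective (≡.trans (≡.sym eq) (≡.cong₂ ℤ._+_ m≡μ m≡μ))
    go : d ℤ.+ d ≡ + a ⊎ d ℤ.+ d ≡ + b → m ℤ.+ m ≡ + a ⊎ m ℤ.+ m ≡ + b → a ≡ μ × b ≡ μ ℕ.+ μ
    go (inj₁ 2d≡a) (inj₁ 2m≡a) = contradiction (≡.trans 2d≡a (≡.sym 2m≡a)) 2d≢2∑A
    go (inj₂ 2d≡b) (inj₂ 2m≡b) = contradiction (≡.trans 2d≡b (≡.sym 2m≡b)) 2d≢2∑A
    go (inj₁ 2d≡a) (inj₂ 2m≡b) = 2d≡⇒ 2d≡a , 2m≡⇒ 2m≡b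
    -- Here b = μ and a = 2μ, and a ≤ b would force μ = 0.
    go (inj₂ 2d≡b) (inj₁ 2m≡a) = contradiction (≡.trans m≡μ (≡.cong +_ (ℕ.n≤0⇒n≡0
      (ℕ.+-cancelˡ-≤ μ μ 0 (≡.subst₂ ℕ._≤_ (2m≡⇒ 2m≡a) (≡.trans (2d≡⇒ 2d≡b) (≡.sym (ℕ.+-identityʳ μ))) a≤b))))) m≢0

  -- p = 1 + 2m and m = 2d; since `d` is given as an integer, its absolute value serves as the
  -- quotient.
  order-mod-4 : p ℕ.% 4 ≡ 1
  order-mod-4 = ≡.trans (≡.cong (ℕ._% 4) p≡1+4ν) (ℕ.[m+kn]%n≡m%n 1 ν 4)
    where
    ν : ℕ
    ν = ℤ.∣ d ∣
    2*d : ∀ d → d ℤ.+ d ≡ + 2 ℤ.* d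
    2*d = solve-∀
    μ≡2ν : μ ≡ 2 ℕ.* ν
    μ≡2ν = ≡.trans (≡.cong ℤ.∣_∣ (≡.trans (≡.sym m≡μ) (≡.trans (≡.sym 2d≡m) (2*d d)))) (ℤ.abs-* (+ 2) d)
    4*ν : ∀ ν → 1 ℕ.+ (2 ℕ.* ν ℕ.+ 2 ℕ.* ν) ≡ 1 ℕ.+ ν ℕ.* 4
    4*ν = ℕ-Solver.solve-∀
    p≡1+4ν : p ≡ 1 ℕ.+ ν ℕ.* 4
    p≡1+4ν = ≡.trans (proj₂ (proj₂ halfOrder)) (≡.trans (≡.cong (λ z → 1 ℕ.+ (z ℕ.+ z)) μ≡2ν) (4*ν ν))

  -- Multipliers of U

  private
    -- The sign `ε` is left undetermined: it disappears when the multiplier is applied twice.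
    IsMultiplier : ℤ → Set
    IsMultiplier u = ∃[ ε ] (ε ℤ.* ε ≡ 1ℤ × (∀ x → to U (u ℤ.* x) ≡ ε ℤ.* to U x))

    IsMultiplier-1 : IsMultiplier 1ℤ
    IsMultiplier-1 = 1ℤ , ≡.refl , λ x → ≡.trans (≡.cong (to U) (ℤ.*-identityˡ x)) (≡.sym (ℤ.*-identityˡ _))

    IsMultiplier-* : ∀ {u v} → IsMultiplier u → IsMultiplier v → IsMultiplier (u ℤ.* v)
    IsMultiplier-* {u} {v} (ε , ε² , εU) (η , η² , ηU) = ε ℤ.* η ,
      ≡.trans (lemma ε η) (≡.cong₂ ℤ._*_ ε² η²) , λ x → begin
        to U (u ℤ.* v ℤ.* x)         ≡⟨ ≡.cong (to U) (ℤ.*-assoc u v x) ⟩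
        to U (u ℤ.* (v ℤ.* x))       ≡⟨ εU (v ℤ.* x) ⟩
        ε ℤ.* to U (v ℤ.* x)         ≡⟨ ≡.cong (ε ℤ.*_) (ηU x) ⟩
        ε ℤ.* (η ℤ.* to U x)         ≡⟨ ℤ.*-assoc ε η (to U x) ⟨
        ε ℤ.* η ℤ.* to U x           ∎
      where
      open ≡.≡-Reasoning
      lemma : ∀ ε η → ε ℤ.* η ℤ.* (ε ℤ.* η) ≡ ε ℤ.* ε ℤ.* (η ℤ.* η)
      lemma = solve-∀

    -- Modulo q the functions U (q x) and U x differ by a constant factor; since their values are
    -- signs and q > 2, they differ by a constant sign.
    IsMultiplier-prime : ∀ {q} → Prime q → q ≢ 2 → ¬ (+ q ≈ 0ℤ) → IsMultiplier (+ q)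
    IsMultiplier-prime {q} q-prime q≢2 q≉0 = ε , ε² , λ x → begin
        to U (+ q ℤ.* x)                             ≡⟨ ℤ.*-identityʳ _ ⟨
        to U (+ q ℤ.* x) ℤ.* 1ℤ                      ≡⟨ ≡.cong (to U (+ q ℤ.* x) ℤ.*_) (U² (1≉0 1<p)) ⟨
        to U (+ q ℤ.* x) ℤ.* (u₁ ℤ.* u₁)             ≡⟨ lemma₁ (to U (+ q ℤ.* x)) u₁ ⟩
        to U (+ q ℤ.* x) ℤ.* u₁ ℤ.* u₁               ≡⟨ ≡.cong (ℤ._* u₁) (proportional x) ⟩
        uq ℤ.* to U x ℤ.* u₁                         ≡⟨ lemma₂ uq (to U x) u₁ ⟩
        ε ℤ.* to U x                                 ∎
      where
      open ≡.≡-Reasoning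
      u₁ = to U 1ℤ
      uq = to U (+ q)
      ε = uq ℤ.* u₁
      h = proj₁ (oddPrime q-prime q≢2)
      n = N ℤ.^ h
      open ModPrime q-prime h (proj₂ (oddPrime q-prime q≢2))
      module F = CommutativeRing (ℤ/ q)
      lemma₁ : ∀ x u → x ℤ.* (u ℤ.* u) ≡ x ℤ.* u ℤ.* u
      lemma₁ = solve-∀
      lemma₂ : ∀ v x u → v ℤ.* x ℤ.* u ≡ v ℤ.* u ℤ.* x
      lemma₂ = solve-∀
      lemma₃ : ∀ u v → u ℤ.* v ℤ.* (u ℤ.* v) ≡ u ℤ.* u ℤ.* (v ℤ.* v)
      lemma₃ = solve-∀
      lemma₄ : ∀ n x y → x ℤ.* (n ℤ.* y) ≡ n ℤ.* x ℤ.* y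
      lemma₄ = solve-∀
      ε² : ε ℤ.* ε ≡ 1ℤ
      ε² = ≡.trans (lemma₃ uq u₁) (≡.cong₂ ℤ._*_ (U² q≉0) (U² (1≉0 1<p)))
      U-mod-1 : n ℤ.* uq F.≈ u₁
      U-mod-1 = F.trans (F.reflexive (≡.cong (λ z → n ℤ.* to U z) (≡.sym (ℤ.*-identityʳ (+ q))))) (U-mod-q q≉0 1ℤ)
      2<q : 2 ℕ.< q
      2<q = ℕ.≤∧≢⇒< (ℕ.nonTrivial⇒n>1 q {{prime⇒nonTrivial q-prime}}) (q≢2 ∘ ≡.sym)
      proportional : ∀ x → to U (+ q ℤ.* x) ℤ.* u₁ ≡ uq ℤ.* to U x
      proportional x = IsSign-≡ 2<q (IsSign-* (U-sign (+ q ℤ.* x)) (U-sign 1ℤ)) (IsSign-* (U-sign (+ q)) (U-sign x))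
        (_≈ₙ_.n∣x-y (F.trans (F.*-congˡ {to U (+ q ℤ.* x)} (F.sym U-mod-1))
          (F.trans (F.reflexive (≡.trans (lemma₄ n (to U (+ q ℤ.* x)) uq) (ℤ.*-comm (n ℤ.* to U (+ q ℤ.* x)) uq)))
            (F.*-congˡ {uq} (U-mod-q q≉0 x)))))

    IsMultiplier-product : ∀ {qs} → All Prime qs → ¬ (2 ℕ∣.∣ product qs) → ¬ (p ℕ∣.∣ product qs) →
                           IsMultiplier (+ product qs)
    IsMultiplier-product [] _ _ = IsMultiplier-1
    IsMultiplier-product {q ∷ qs} (q-prime ∷ qs-prime) 2∤ p∤ =
      ≡.subst IsMultiplier (≡.sym (ℤ.pos-* q (product qs)))
        (IsMultiplier-* {+ q} {+ product qs}
          (IsMultiplier-prime q-prime (λ { ≡.refl → 2∤ (ℕ∣.m∣m*n (product qs)) })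
            (λ q≈0 → p∤ (ℕ∣.∣m⇒∣m*n (product qs) (ℤ∣.∣⇒∣ᵤ (≈0⇒∣ q≈0)))))
          (IsMultiplier-product qs-prime (2∤ ∘ ℕ∣.∣n⇒∣m*n q) (p∤ ∘ ℕ∣.∣n⇒∣m*n q)))

    -- The prime 2 is kept out because the Frobenius argument needs an odd power of `U`: even powers
    -- are combinations of `δ` and a constant and retain nothing of `U`.
    IsMultiplier-odd : ∀ {u} → ¬ (2 ℕ∣.∣ u) → ¬ (p ℕ∣.∣ u) → IsMultiplier (+ u)
    IsMultiplier-odd {zero}     2∤u _   = contradiction (2 ℕ∣.∣0) 2∤u
    IsMultiplier-odd u@{suc _} 2∤u p∤u = ≡.subst (IsMultiplier ∘ +_) (≡.sym isFactorisation)
      (IsMultiplier-product factorsPrime (2∤u ∘ ≡.subst (2 ℕ∣.∣_) (≡.sym isFactorisation))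
                                         (p∤u ∘ ≡.subst (p ℕ∣.∣_) (≡.sym isFactorisation)))
      where open PrimeFactorisation (factorise u)

    2∤p : ¬ (2 ℕ∣.∣ p)
    2∤p 2∣p = [ (λ ()) , p≢2 ∘ ≡.sym ]′ (prime⇒irreducible p-prime 2∣p)

    -- One of u and u + p is odd.
    oddResidue : ∀ z → ¬ (z ≈ 0ℤ) → ∃[ u ] (+ u ≈ z × ¬ (2 ℕ∣.∣ u) × ¬ (p ℕ∣.∣ u))
    oddResidue z z≉0 = choose (2 ℕ∣.∣? u)
      where
      u = toℕ (residue z)
      p∤u : ¬ (p ℕ∣.∣ u)
      p∤u p∣u = z≉0 (trans (sym (≈-residue z)) (∣⇒≈0 (ℤ∣.∣ᵤ⇒∣ p∣u)))
      choose : Dec (2 ℕ∣.∣ u) → ∃[ u ] (+ u ≈ z × ¬ (2 ℕ∣.∣ u) × ¬ (p ℕ∣.∣ u))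
      choose (no  2∤u) = u , ≈-residue z , 2∤u , p∤u
      choose (yes 2∣u) = u ℕ.+ p
        , trans (+-cong (≈-residue z) p≈0) (reflexive (ℤ.+-identityʳ z))
        , (λ 2∣u+p → 2∤p (ℕ∣.∣m+n∣m⇒∣n 2∣u+p 2∣u))
        , (λ p∣u+p → p∤u (ℕ∣.∣m+n∣m⇒∣n (≡.subst (p ℕ∣.∣_) (ℕ.+-comm u p) p∣u+p) ℕ∣.∣-refl))

    -- `z` is congruent to an odd number prime to p, a multiplier; using it twice contributes
    -- `ε * ε = 1`.
    U-square : ∀ {z} → ¬ (z ≈ 0ℤ) → ∀ x → to U (z ℤ.* z ℤ.* x) ≡ to U x
    U-square {z} z≉0 x = go (oddResidue z z≉0)
      where
      open ≡.≡-Reasoning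
      go : ∃[ u ] (+ u ≈ z × ¬ (2 ℕ∣.∣ u) × ¬ (p ℕ∣.∣ u)) → to U (z ℤ.* z ℤ.* x) ≡ to U x
      go (u , u≈z , 2∤u , p∤u) = let (ε , ε² , εU) = IsMultiplier-odd 2∤u p∤u in begin
        to U (z ℤ.* z ℤ.* x)          ≡⟨ cong U (*-congʳ {x} (*-cong u≈z u≈z)) ⟨
        to U (+ u ℤ.* + u ℤ.* x)      ≡⟨ ≡.cong (to U) (ℤ.*-assoc (+ u) (+ u) x) ⟩
        to U (+ u ℤ.* (+ u ℤ.* x))    ≡⟨ ≡.trans (εU (+ u ℤ.* x)) (≡.cong (ε ℤ.*_) (εU x)) ⟩
        ε ℤ.* (ε ℤ.* to U x)          ≡⟨ ℤ.*-assoc ε ε (to U x) ⟨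
        ε ℤ.* ε ℤ.* to U x            ≡⟨ ≡.cong (ℤ._* to U x) ε² ⟩
        1ℤ ℤ.* to U x                 ≡⟨ ℤ.*-identityˡ (to U x) ⟩
        to U x                        ∎

    U≡1⇒A≡1 : ∀ x → to U x ≡ 1ℤ → A x ≡ 1ℤ
    U≡1⇒A≡1 x Ux≡1 = byCases (x ≟ 0ℤ)
      where
      byCases : Dec (x ≈ 0ℤ) → A x ≡ 1ℤ
      byCases (yes x≈0) = contradiction Ux≡1 (0≢1 (U-0 x≈0))
      byCases (no  x≉0) = [ (λ Ax≡0 → contradiction (≡.trans (≡.sym (U--1 x≉0 Ax≡0)) Ux≡1) λ ()) , id ]′ (A.s-01 x)

  square-invariant : ∀ {z} → ¬ (z ≈ 0ℤ) → ∀ {x} → A x ≡ 1ℤ → A (z ℤ.* z ℤ.* x) ≡ 1ℤ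
  square-invariant {z} z≉0 {x} Ax≡1 = U≡1⇒A≡1 (z ℤ.* z ℤ.* x) (≡.trans (U-square z≉0 x)
    (U-1 (λ x≈0 → 0≢1 (≡.trans (A.s-cong x≈0) A-0) Ax≡1) Ax≡1))

  -- A as a coset of the squares

  private
    g : ℤ
    g = proj₁ nonempty

    g≉0 : ¬ (g ≈ 0ℤ)
    g≉0 g≈0 = 0≢1 (≡.trans (A.s-cong g≈0) A-0) (proj₂ nonempty)

    -- On nonzero arguments `t` runs through the coset of `g` modulo squares, each element being hit
    -- twice; `w` is the indicator of the nonzero residues.
    t w : ℤ → ℤ
    t y = g ℤ.* (y ℤ.* y)
    w y = 1ℤ ℤ.- δ 0ℤ y

    A-t : ∀ {y} → ¬ (y ≈ 0ℤ) → A (t y) ≡ 1ℤ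
    A-t {y} y≉0 = ≡.trans (≡.cong A (ℤ.*-comm g (y ℤ.* y))) (square-invariant y≉0 (proj₂ nonempty))

    Root : ℤ → ℤ → Set
    Root x y = ¬ (y ≈ 0ℤ) × t y ≈ x

    roots : ℤ → ℤ
    roots x = ∑ (λ y → w y ℤ.* δ (t y) x)

    rootTerm : ∀ x y → Dec (Root x y) → w y ℤ.* δ (t y) x ≡ 0ℤ ⊎ (Root x y × w y ℤ.* δ (t y) x ≡ 1ℤ)
    rootTerm x y (yes (y≉0 , ty≈x)) = inj₂ ((y≉0 , ty≈x)
      , ≡.cong₂ (λ d e → (1ℤ ℤ.- d) ℤ.* e) (δ-≉ (y≉0 ∘ sym)) (δ-≈ ty≈x))
    rootTerm x y (no ¬root) = inj₁ (byCases (y ≟ 0ℤ))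
      where
      byCases : Dec (y ≈ 0ℤ) → w y ℤ.* δ (t y) x ≡ 0ℤ
      byCases (yes y≈0) = ≡.cong (λ d → (1ℤ ℤ.- d) ℤ.* δ (t y) x) (δ-≈ (sym y≈0))
      byCases (no  y≉0) = ≡.trans (≡.cong (w y ℤ.*_) (δ-≉ λ ty≈x → ¬root (y≉0 , ty≈x))) (ℤ.*-zeroʳ (w y))

    root? : ∀ x y → Dec (Root x y)
    root? x y = ¬? (y ≟ 0ℤ) ×-dec (t y ≟ x)

    someRoot? : ∀ x → Dec (∃[ i ] Root x (+ toℕ i))
    someRoot? x = Fin.any? {n = p} λ i → root? x (+ toℕ i)

    ∑-zero : (f : ℤ → ℤ) → (∀ (i : Fin p) → f (+ toℕ i) ≡ 0ℤ) → ∑ f ≡ 0ℤ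
    ∑-zero f f≡0 = ≡.trans (sum-cong-≗ {p} f≡0) (≡.trans (∑-const 0ℤ) (ℤ.*-zeroʳ (+ p)))

    noRoot⇒0 : ∀ {x} → ¬ (∃[ i ] Root x (+ toℕ i)) → roots x ≡ 0ℤ
    noRoot⇒0 {x} none = ∑-zero (λ y → w y ℤ.* δ (t y) x) λ i →
      [ id , (λ (root , _) → contradiction (i , root) none) ]′ (rootTerm x (+ toℕ i) (root? x (+ toℕ i)))

    0≤δ : ∀ x y → 0ℤ ℤ.≤ δ x y
    0≤δ x y with x ≟ y
    ... | yes _ = ℤ.+≤+ ℕ.z≤n
    ... | no  _ = ℤ.≤-refl

    ∑-δ′ : ∀ x → ∑ (δ x) ≡ 1ℤ
    ∑-δ′ x = ≡.trans (∑-cong λ y → ≡.sym (ℤ.*-identityʳ (δ x y)))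
                     (δ-sift x (record { to = λ _ → 1ℤ ; cong = λ _ → ≡.refl }))

    root-unique : ∀ {x y z} → Root x y → Root x z → y ≈ z ⊎ ℤ.- y ≈ z
    root-unique {x} {y} {z} (_ , ty≈x) (_ , tz≈x) = Sum.map -≈0⇒≈
      (λ y+z≈0 → -≈0⇒≈ (trans (reflexive (lemma₂ y z)) (-‿cong y+z≈0)))
      (*-≈0 (y ℤ.- z) (y ℤ.+ z) (trans (reflexive (lemma₁ y z))
        (≈⇒-≈0 (*-cancelˡ-≈ g g≉0 (trans ty≈x (sym tz≈x))))))
      where
      lemma₁ : ∀ y z → (y ℤ.- z) ℤ.* (y ℤ.+ z) ≡ y ℤ.* y ℤ.- z ℤ.* z
      lemma₁ = solve-∀
      lemma₂ : ∀ y z → ℤ.- y ℤ.- z ≡ ℤ.- (y ℤ.+ z)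
      lemma₂ = solve-∀

    -- Once one root `y` is known, any other is `y` or `- y`, so the summands are bounded by those
    -- of `δ y + δ (- y)`, whose total is 2.
    roots≤2 : ∀ x → roots x ℤ.≤ + 2
    roots≤2 x = byCases (someRoot? x)
      where
      byCases : Dec (∃[ i ] Root x (+ toℕ i)) → roots x ℤ.≤ + 2
      byCases (no none)        = ℤ.≤-trans (ℤ.≤-reflexive (noRoot⇒0 none)) (ℤ.+≤+ ℕ.z≤n)
      byCases (yes (i , root)) = ℤ.≤-trans (sum-mono-≤ {p} λ j → le (+ toℕ j))
        (ℤ.≤-reflexive (≡.trans (∑-+ (δ y) (δ (ℤ.- y))) (≡.cong₂ ℤ._+_ (∑-δ′ y) (∑-δ′ (ℤ.- y)))))
        where
        y = + toℕ i
        le : ∀ z → w z ℤ.* δ (t z) x ℤ.≤ δ y z ℤ.+ δ (ℤ.- y) z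
        le z = [ (λ eq → ℤ.≤-trans (ℤ.≤-reflexive eq) (ℤ.+-mono-≤ (0≤δ y z) (0≤δ (ℤ.- y) z)))
               , (λ (root′ , eq) → ℤ.≤-trans (ℤ.≤-reflexive eq) ([
                   (λ y≈z → ℤ.+-mono-≤ (ℤ.≤-reflexive (≡.sym (δ-≈ y≈z))) (0≤δ (ℤ.- y) z)) ,
                   (λ -y≈z → ℤ.+-mono-≤ (0≤δ y z) (ℤ.≤-reflexive (≡.sym (δ-≈ -y≈z)))) ]′
                   (root-unique root root′))) ]′
               (rootTerm x z (root? x z))

    ∑-w : ∑ w ≡ m ℤ.+ m
    ∑-w = begin
      ∑ w                                        ≡⟨ lemma (∑ w) ⟩
      ∑ w ℤ.+ 1ℤ ℤ.- 1ℤ                          ≡⟨ ≡.cong (λ z → ∑ w ℤ.+ z ℤ.- 1ℤ) ∑-δ ⟨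
      ∑ w ℤ.+ ∑ (δ 0ℤ) ℤ.- 1ℤ                    ≡⟨ ≡.cong (ℤ._- 1ℤ) (∑-+ w (δ 0ℤ)) ⟨
      ∑ (λ y → 1ℤ ℤ.- δ 0ℤ y ℤ.+ δ 0ℤ y) ℤ.- 1ℤ  ≡⟨ ≡.cong (ℤ._- 1ℤ) (∑-cong λ y → lemma₁ (δ 0ℤ y)) ⟩
      ∑ (λ _ → 1ℤ) ℤ.- 1ℤ                        ≡⟨ ≡.cong (ℤ._- 1ℤ) (∑-const 1ℤ) ⟩
      + p ℤ.* 1ℤ ℤ.- 1ℤ                          ≡⟨ ≡.cong (λ z → z ℤ.* 1ℤ ℤ.- 1ℤ) p≡1+2m ⟩
      (1ℤ ℤ.+ (m ℤ.+ m)) ℤ.* 1ℤ ℤ.- 1ℤ           ≡⟨ lemma₂ m ⟩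
      m ℤ.+ m                                    ∎
      where
      open ≡.≡-Reasoning
      lemma : ∀ x → x ≡ x ℤ.+ 1ℤ ℤ.- 1ℤ
      lemma = solve-∀
      lemma₁ : ∀ d → 1ℤ ℤ.- d ℤ.+ d ≡ 1ℤ
      lemma₁ = solve-∀
      lemma₂ : ∀ m → (1ℤ ℤ.+ (m ℤ.+ m)) ℤ.* 1ℤ ℤ.- 1ℤ ≡ m ℤ.+ m
      lemma₂ = solve-∀

    w*A-t : ∀ y → w y ℤ.* A (t y) ≡ w y
    w*A-t y = byCases (y ≟ 0ℤ)
      where
      byCases : Dec (y ≈ 0ℤ) → w y ℤ.* A (t y) ≡ w y
      byCases (yes y≈0) = ≡.trans (≡.cong (λ d → (1ℤ ℤ.- d) ℤ.* A (t y)) (δ-≈ (sym y≈0)))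
        (≡.sym (≡.cong (λ d → 1ℤ ℤ.- d) (δ-≈ (sym y≈0))))
      byCases (no y≉0) = ≡.trans (≡.cong (w y ℤ.*_) (A-t y≉0)) (ℤ.*-identityʳ (w y))

    -- Double counting: each of the 2m nonzero `y` is a root of exactly one residue, `t y`, and that
    -- residue lies in `A`.
    ∑-A*roots : ∑ (λ x → A x ℤ.* roots x) ≡ ∑ (λ x → A x ℤ.* + 2)
    ∑-A*roots = begin
      ∑ (λ x → A x ℤ.* roots x)
        ≡⟨ ∑-cong (λ x → ∑-*ˡ (A x) (λ y → w y ℤ.* δ (t y) x)) ⟩
      ∑ (λ x → ∑ (λ y → A x ℤ.* (w y ℤ.* δ (t y) x)))
        ≡⟨ ∑-swap (λ x y → A x ℤ.* (w y ℤ.* δ (t y) x)) ⟩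
      ∑ (λ y → ∑ (λ x → A x ℤ.* (w y ℤ.* δ (t y) x)))
        ≡⟨ ∑-cong (λ y → ≡.trans (∑-cong λ x → lemma₁ (A x) (w y) (δ (t y) x))
             (≡.trans (≡.sym (∑-*ˡ (w y) (λ x → δ (t y) x ℤ.* A x)))
             (≡.trans (≡.cong (w y ℤ.*_) (δ-sift (t y) A.fn)) (w*A-t y)))) ⟩
      ∑ w                          ≡⟨ ∑-w ⟩
      m ℤ.+ m                      ≡⟨ lemma₂ m ⟩
      m ℤ.* + 2                    ≡⟨ ∑-*ʳ (+ 2) A ⟩
      ∑ (λ x → A x ℤ.* + 2)        ∎
      where
      open ≡.≡-Reasoning
      lemma₁ : ∀ a w d → a ℤ.* (w ℤ.* d) ≡ w ℤ.* (d ℤ.* a)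
      lemma₁ = solve-∀
      lemma₂ : ∀ m → m ℤ.+ m ≡ m ℤ.* + 2
      lemma₂ = solve-∀

    -- The `m` elements of `A` have at most two roots each and 2m in total, so each has exactly two.
    -- This makes every element of `A` a square times `g`.
    roots≡2 : ∀ {x} → A x ≡ 1ℤ → roots x ≡ + 2
    roots≡2 {x} Ax≡1 = ≡.trans (≡.sym (ℤ.*-identityˡ (roots x)))
      (≡.trans (≡.cong (ℤ._* roots x) (≡.sym Ax≡1)) (≡.trans (A*roots≡ x) (≡.cong (ℤ._* + 2) Ax≡1)))
      where
      roots-cong : ∀ {x x′} → x ≈ x′ → roots x ≡ roots x′
      roots-cong eq = ∑-cong λ y → ≡.cong (w y ℤ.*_) (δ-cong (refl {t y}) eq)
      le : ∀ x → A x ℤ.* roots x ℤ.≤ A x ℤ.* + 2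
      le x = ℤ.*-monoˡ-≤-nonNeg (A x) {{ℤ.nonNegative (A.0≤ x)}} (roots≤2 x)
      A*roots≡ : ∀ x → A x ℤ.* roots x ≡ A x ℤ.* + 2
      A*roots≡ = ∑-≤-≡
        (record { to = λ x → A x ℤ.* roots x ; cong = λ eq → ≡.cong₂ ℤ._*_ (A.s-cong eq) (roots-cong eq) })
        (record { to = λ x → A x ℤ.* + 2 ; cong = λ eq → ≡.cong (ℤ._* + 2) (A.s-cong eq) })
        le ∑-A*roots

  -- The squares times g lie in A, and both sets have (p - 1) / 2 elements.
  A-squares : ∃[ u ] (¬ (u ≈ 0ℤ) × (∀ {x} → A x ≡ 1ℤ → IsSquareOfUnit (ℤ/ p) (u ℤ.* x)) ×
                                    (∀ {x} → IsSquareOfUnit (ℤ/ p) (u ℤ.* x) → A x ≡ 1ℤ))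
  A-squares = u , u≉0 , (λ {x} Ax≡1 → forwards (someRoot? x) Ax≡1) , backwards
    where
    u : ℤ
    u = proj₁ (inverse g≉0)
    ug≈1 : u ℤ.* g ≈ 1ℤ
    ug≈1 = proj₂ (inverse g≉0)
    u≉0 : ¬ (u ≈ 0ℤ)
    u≉0 u≈0 = 1≉0 1<p (trans (sym ug≈1) (trans (*-congʳ {g} u≈0) (reflexive (ℤ.*-zeroˡ g))))
    cancel : ∀ y → u ℤ.* (g ℤ.* y) ≈ y
    cancel y = trans (reflexive (≡.sym (ℤ.*-assoc u g y))) (trans (*-congʳ {y} ug≈1) (reflexive (ℤ.*-identityˡ y)))
    forwards : ∀ {x} → Dec (∃[ i ] Root x (+ toℕ i)) → A x ≡ 1ℤ → IsSquareOfUnit (ℤ/ p) (u ℤ.* x)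
    forwards (yes (i , y≉0 , ty≈x)) _ = + toℕ i , y≉0 , trans (*-congˡ {u} (sym ty≈x)) (cancel (+ toℕ i ℤ.* + toℕ i))
    forwards (no none) Ax≡1 = contradiction (≡.trans (≡.sym (roots≡2 Ax≡1)) (noRoot⇒0 none)) λ ()
    lemma : ∀ g u x → g ℤ.* (u ℤ.* x) ≡ u ℤ.* (g ℤ.* x)
    lemma = solve-∀
    backwards : ∀ {x} → IsSquareOfUnit (ℤ/ p) (u ℤ.* x) → A x ≡ 1ℤ
    backwards {x} (y , y≉0 , ux≈y²) = ≡.trans (A.s-cong (trans (sym (cancel x)) (trans (reflexive (≡.sym (lemma g u x)))
      (*-congˡ {g} ux≈y²)))) (A-t y≉0)

  ∑A+∑B : ∑ A ℤ.+ ∑ B ≡ + p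
  ∑A+∑B = ≡.trans (≡.cong (λ z → m ℤ.+ z) (≡.trans (∑-cong B≡A+δ) (≡.trans (∑-+ A (δ 0ℤ))
    (≡.cong (λ z → m ℤ.+ z) ∑-δ)))) (≡.trans (lemma m) (≡.sym p≡1+2m))
    where
    lemma : ∀ m → m ℤ.+ (m ℤ.+ 1ℤ) ≡ 1ℤ ℤ.+ (m ℤ.+ m)
    lemma = solve-∀

-- The isomorphism with the clique extension

+1+2* : ∀ h → + (1+2* h) ≡ 1ℤ ℤ.+ + 2 ℤ.* + h
+1+2* zero    = ≡.refl
+1+2* (suc h) = ≡.trans (≡.cong (λ z → + 2 ℤ.+ z) (+1+2* h)) (lemma (+ h))
  where
  lemma : ∀ h → + 2 ℤ.+ (1ℤ ℤ.+ + 2 ℤ.* h) ≡ 1ℤ ℤ.+ + 2 ℤ.* (1ℤ ℤ.+ h)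
  lemma = solve-∀

open import Data.Nat.Base using (_*_; _∸_; _/_; _%_)

module OddPrime (p : ℕ) .{{_ : ℕ.NonZero p}} (p-prime : Prime p) (h : ℕ) (p≡1+2h : p ≡ 1+2* h)
  (p≢2 : p ≢ 2) (Γ : Graph) {k b a : ℕ} (strictlyDeza : IsStrictlyDeza Γ (2 * p) k b a) (circulant : IsCirculant Γ) where
  open SymmetricSets p p-prime
  open ChineseRemainder p (+ h) (≡.trans (≡.cong +_ p≡1+2h) (+1+2* h))
  private
    module H = Residues (2 * p)
    differenceGraph : DifferenceGraph Γ (2 * p)
    differenceGraph = circulant⇒differenceGraph Γ (2 * p)
      (IsDeza.order-≡ (IsStrictlyDeza.isDeza strictlyDeza)) circulant
    open DifferenceGraph differenceGraph using (s; T?; coordinate; adjacency; isDezaSet; symmetric)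
    open IsSymmetricSet symmetric using (s-cong)
    A B : ℤ → ℤ
    A y = s (even∙ y)
    B y = s (odd∙ y)
    pair : IsDezaPair p k b a A B
    pair = dezaPair (isDezaSet strictlyDeza)
    paleyPair : IsPaleyPair p b a A B
    paleyPair = DezaPairs.dezaPair⇒paleyPair p p-prime p≢2 pair
    open IsPaleyPair paleyPair using (A-set; A-0; B≡A+δ)
    module A = IsSymmetricSet A-set
    open PaleyPairs p p-prime p≢2 paleyPair
    open DifferenceGraph differenceGraph using (to)

    u : ℤ
    u = proj₁ A-squares
    u≉0 : ¬ (u ≈ 0ℤ)
    u≉0 = proj₁ (proj₂ A-squares)

    B≡1⇒ : ∀ {z} → B z ≡ 1ℤ → A z ≡ 1ℤ ⊎ z ≈ 0ℤ
    B≡1⇒ {z} Bz≡1 = byCases (0ℤ ≟ z)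
      where
      byCases : Dec (0ℤ ≈ z) → A z ≡ 1ℤ ⊎ z ≈ 0ℤ
      byCases (yes 0≈z) = inj₂ (sym 0≈z)
      byCases (no  0≉z) = inj₁ (≡.trans (≡.sym (≡.trans (≡.cong (λ d → A z ℤ.+ d) (δ-≉ 0≉z)) (ℤ.+-identityʳ (A z))))
        (≡.trans (≡.sym (B≡A+δ z)) Bz≡1))

    ≈0⇒B≡1 : ∀ {z} → z ≈ 0ℤ → B z ≡ 1ℤ
    ≈0⇒B≡1 {z} z≈0 = ≡.trans (B≡A+δ z) (≡.cong₂ ℤ._+_ (≡.trans (A.s-cong z≈0) A-0) (δ-≈ (sym z≈0)))

    A≡1⇒B≡1 : ∀ {z} → A z ≡ 1ℤ → B z ≡ 1ℤ
    A≡1⇒B≡1 {z} Az≡1 = ≡.trans (B≡A+δ z) (≡.cong₂ ℤ._+_ Az≡1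
      (δ-≉ λ 0≈z → 0≢1 (≡.trans (A.s-cong (sym 0≈z)) A-0) Az≡1))

    data Difference (x y : ℤ) : Set where
      same      : Two.residue x ≡ Two.residue y → s (x ℤ.- y) ≡ A (x ℤ.- y) → Difference x y
      different : Two.residue x ≢ Two.residue y → s (x ℤ.- y) ≡ B (x ℤ.- y) → Difference x y

    difference : ∀ x y → Difference x y
    difference x y = go (Two.residue (x ℤ.- y)) (Two.≈-residue (x ℤ.- y))
      where
      lemma : ∀ x y → x ≡ x ℤ.- y ℤ.+ y
      lemma = solve-∀
      go : (r : Fin 2) → + toℕ r Two.≈ x ℤ.- y → Difference x y
      go 0F 0≈ = same (Two.residue-cong x≈y) (s-cong (H.sym (≈₂0⇒even 0≈)))
        where
        x≈y : x Two.≈ y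
        x≈y = Two.trans (Two.reflexive (lemma x y))
          (Two.trans (Two.+-congʳ {y} (Two.sym 0≈)) (Two.reflexive (ℤ.+-identityˡ y)))
      go 1F 1≈ = different x≢y (s-cong (H.sym (≈₂1⇒odd 1≈)))
        where
        x≢y : Two.residue x ≢ Two.residue y
        x≢y eq = Two.1≉0 (ℕ.n<1+n 1) (Two.trans 1≈ (Two.trans (Two.+-congʳ {ℤ.- y} x≈y) (Two.reflexive (ℤ.+-inverseʳ y))))
          where
          x≈y : x Two.≈ y
          x≈y = Two.trans (Two.sym (Two.≈-residue x))
            (Two.trans (Two.reflexive (≡.cong (λ r → + toℕ r) eq)) (Two.≈-residue y))

    target : Digraph
    target = paley (ℤ/ p) ⟦ K₂ ⟧

    module Target = Digraph target

    -- Multiplication by `u` carries the coset `A` to the squares; the parity, as the vertex of K₂,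
    -- is untouched.
    scale₁ : Inverse (setoid ×ₛ ≡.setoid (Fin 2)) Target.vertices
    scale₁ = record
      { to = λ (x , i) → S.to x , i ; from = λ (x , i) → S.from x , i
      ; to-cong = λ (eq , eq′) → S.to-cong eq , eq′
      ; from-cong = λ (eq , eq′) → S.from-cong eq , eq′
      ; inverse = (λ (eq , eq′) → S.inverseˡ eq , eq′) , (λ (eq , eq′) → S.inverseʳ eq , eq′)
      }
      where module S = Inverse (scaling u≉0)

    bijection : Inverse (Graph.vertices Γ) Target.vertices
    bijection = Comp.inverse coordinate (Comp.inverse crt scale₁)

    *-distribˡ-- : ∀ u x y → u ℤ.* (x ℤ.- y) ≡ u ℤ.* x ℤ.- u ℤ.* y
    *-distribˡ-- = solve-∀

    square⇒A≡1 : ∀ x y → IsSquareOfUnit (ℤ/ p) (u ℤ.* x ℤ.- u ℤ.* y) → A (x ℤ.- y) ≡ 1ℤ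
    square⇒A≡1 x y sq = proj₂ (proj₂ (proj₂ A-squares))
      (≡.subst (IsSquareOfUnit (ℤ/ p)) (≡.sym (*-distribˡ-- u x y)) sq)

    A≡1⇒square : ∀ x y → A (x ℤ.- y) ≡ 1ℤ → IsSquareOfUnit (ℤ/ p) (u ℤ.* x ℤ.- u ℤ.* y)
    A≡1⇒square x y eq = ≡.subst (IsSquareOfUnit (ℤ/ p)) (*-distribˡ-- u x y) (proj₁ (proj₂ (proj₂ A-squares)) eq)

    -- The summand `δ` of `B` yields the edges inside the copies of K₂: equal residues modulo p,
    -- different parity. All other edges come from `A` and are seen in the Paley coordinate,
    -- whatever the parities.
    forwards : ∀ x y → s (x ℤ.- y) ≡ 1ℤ →
      (u ℤ.* x , Two.residue x) Target.~ (u ℤ.* y , Two.residue y)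
    forwards x y s≡1 = go (difference x y)
      where
      Adjacent : Set
      Adjacent = (u ℤ.* x , Two.residue x) Target.~ (u ℤ.* y , Two.residue y)
      go′ : Two.residue x ≢ Two.residue y → A (x ℤ.- y) ≡ 1ℤ ⊎ x ℤ.- y ≈ 0ℤ → Adjacent
      go′ _   (inj₁ A≡1)   = inj₁ (A≡1⇒square x y A≡1)
      go′ x≢y (inj₂ x-y≈0) = inj₂ (*-congˡ {u} (-≈0⇒≈ x-y≈0) , x≢y)
      go : Difference x y → Adjacent
      go (same _ s≡A)        = inj₁ (A≡1⇒square x y (≡.trans (≡.sym s≡A) s≡1))
      go (different x≢y s≡B) = go′ x≢y (B≡1⇒ {x ℤ.- y} (≡.trans (≡.sym s≡B) s≡1))

    backwards : ∀ x y → (u ℤ.* x , Two.residue x) Target.~ (u ℤ.* y , Two.residue y) →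
      s (x ℤ.- y) ≡ 1ℤ
    backwards x y x~y = go (difference x y) x~y
      where
      go : Difference x y → (u ℤ.* x , Two.residue x) Target.~ (u ℤ.* y , Two.residue y) → s (x ℤ.- y) ≡ 1ℤ
      go (same _ s≡A)      (inj₁ sq)          = ≡.trans s≡A (square⇒A≡1 x y sq)
      go (different _ s≡B) (inj₁ sq)          = ≡.trans s≡B (A≡1⇒B≡1 {x ℤ.- y} (square⇒A≡1 x y sq))
      go (same x≡y _)      (inj₂ (_ , x≢y))   = contradiction x≡y x≢y
      go (different _ s≡B) (inj₂ (ux≈uy , _)) = ≡.trans s≡B (≈0⇒B≡1 {x ℤ.- y} (≈⇒-≈0 (*-cancelˡ-≈ u u≉0 ux≈uy)))

  isomorphism : Graph.digraph Γ ≅ paley (ℤ/ p) ⟦ K₂ ⟧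
  isomorphism = record
    { bijection = bijection
    ; adjacency = λ x y → mk⇔
        (λ x~y → forwards (to x) (to y) (indicator-1 (T? (to x ℤ.- to y)) (Equivalence.to (adjacency x y) x~y)))
        (λ fx~fy → Equivalence.from (adjacency x y)
          (indicator-1⁻¹ (T? (to x ℤ.- to y)) (backwards (to x) (to y) fx~fy)))
    }

  conclusion : p % 4 ≡ 1 × Graph.digraph Γ ≅ paley (ℤ/ p) ⟦ K₂ ⟧ × k ≡ p × b ≡ p ∸ 1 × a ≡ (p ∸ 1) / 2
  conclusion = order-mod-4 , isomorphism
    , ℤ.+-injective (≡.trans (≡.sym (IsDezaPair.cardinality pair)) ∑A+∑B)
    , ≡.trans (proj₂ ab) (≡.sym p∸1≡)
    , ≡.trans (proj₁ ab) (≡.sym (≡.trans (≡.cong (_/ 2) (≡.trans p∸1≡ (2* μ))) (ℕ.m*n/n≡m μ 2)))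
    where
    μ : ℕ
    μ = proj₁ halfOrder
    ab : a ≡ μ × b ≡ μ ℕ.+ μ
    ab = parameters (IsDeza.a≤b (IsStrictlyDeza.isDeza strictlyDeza))
    p∸1≡ : p ∸ 1 ≡ μ ℕ.+ μ
    p∸1≡ = ≡.cong (_∸ 1) (proj₂ (proj₂ halfOrder))
    2* : ∀ μ → μ ℕ.+ μ ≡ μ ℕ.* 2
    2* μ = ≡.trans (≡.cong (μ ℕ.+_) (≡.sym (ℕ.+-identityʳ μ))) (ℕ.*-comm 2 μ)

theorem15 : (p : ℕ) → Prime p → (Γ : Graph) (k b a : ℕ) →
    IsStrictlyDeza Γ (2 * p) k b a → IsCirculant Γ →
    p % 4 ≡ 1 ×
    Graph.digraph Γ ≅ paley (ℤ/ p) ⟦ K₂ ⟧ ×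
    k ≡ p × b ≡ p ∸ 1 × a ≡ (p ∸ 1) / 2
theorem15 p p-prime Γ k b a strictlyDeza circulant = byCases (p ℕ.≟ 2) (odd-or-even p)
  where
  instance
    p≢0 : ℕ.NonZero p
    p≢0 = prime⇒nonZero p-prime
  Conclusion = p % 4 ≡ 1 × Graph.digraph Γ ≅ paley (ℤ/ p) ⟦ K₂ ⟧ × k ≡ p × b ≡ p ∸ 1 × a ≡ (p ∸ 1) / 2
  byCases : Dec (p ≡ 2) → (∃[ h ] p ≡ 1+2* h) ⊎ 2 ℕ∣.∣ p → Conclusion
  byCases (yes ≡.refl) _ = ⊥-elim (¬dezaSet-4 (DifferenceGraph.isDezaSet
    (circulant⇒differenceGraph Γ 4 (IsDeza.order-≡ (IsStrictlyDeza.isDeza strictlyDeza)) circulant) strictlyDeza))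
  byCases (no p≢2) (inj₂ 2∣p) = contradiction (prime⇒irreducible p-prime 2∣p) [ (λ ()) , p≢2 ∘ ≡.sym ]′
  byCases (no p≢2) (inj₁ (h , p≡1+2h)) =
    OddPrime.conclusion p p-prime h p≡1+2h p≢2 Γ strictlyDeza circulant
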